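{- Let $\mathbb K$ be an algebraically closed field of characteristic $p>2$. Let $\Lambda_1,\dots,\Lambda_n\in\mathbb F_p^\times\subset\mathbb K$, let $a\in\mathbb K\setminus\mathbb F_p$, and let $x^0=(x^0_1,\dots,x^0_n)\in\mathbb K^n$ be such that all $2np$ linear factors in $s$ in the numerator and denominator of $$\prod_{i=1}^n\prod_{j=0}^{p-1}\frac{s-x_i^0+\Lambda_i+aj}{s-x_i^0+aj}$$ are pairwise distinct. Then for generic $\kappa\in\mathbb K^\times$, the Bethe ansatz equation $$\kappa^p\prod_{i=1}^n\frac{h_p(s-x_i^0+\Lambda_i)}{h_p(s-x_i^0)}=1,\qquad h_p(u)=u^p-a^{p-1}u,$$ has $n$ distinct solutions $s_1^0,\dots,s_n^0$, obtained by deforming the roots $y_1^0,\dots,y_n^0$, where $y_i^0=x_i^0-\Lambda_i$, such that the corresponding vectors $J(s_i^0,x^0)$, $i=1,\dots,n$, are nonzero and form a basis of $V_{\mathbb K}$. Moreover, each $J(s_i^0,x^0)$ is a common eigenvector of the $p$-curvature operators $\tilde K_m(x^0)$, $m=1,\dots,n$, with respective eigenvalues $$-\,\frac{h_p(s_i^0-x_m^0)}{h_p(s_i^0-x_m^0+\Lambda_m)},$$ that is, $$\tilde K_m(x^0)J(s_i^0,x^0)=-\,\frac{h_p(s_i^0-x_m^0)}{h_p(s_i^0-x_m^0+\Lambda_m)}\,J(s_i^0,x^0),\qquad m=1,\dots,n.$$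
   Context: $\mathbb F_p$ is the prime subfield of $\mathbb K$, $n\ge1$, and $f_1,\dots,f_n$ is the standard basis of $\mathbb Z^n$; $x+af_m$ is $x=(x_1,\dots,x_n)$ with the $m$-th coordinate increased by $a$. Fiber. $\mathfrak{gl}_2$ over $\mathbb K$ has standard generators $e_{ij}$; set $e=e_{12}$, $f=e_{21}$, $h_1=e_{11}$, $h_2=e_{22}$. $M_\Lambda$ is the Verma module with basis $f^kv_\Lambda$, $k\ge0$, where $ev_\Lambda=0$, $h_1v_\Lambda=\Lambda v_\Lambda$, $h_2v_\Lambda=0$. $V_{\mathbb K}$ is the weight subspace of $M_{\Lambda_1}\otimes\dots\otimes M_{\Lambda_n}$ of weight $[\sum_j\Lambda_j-1,1]$, i.e. the $n$-dimensional subspace with basis $f^{(j)}=v_{\Lambda_1}\otimes\dots\otimes fv_{\Lambda_j}\otimes\dots\otimes v_{\Lambda_n}$, $j=1,\dots,n$. $R$-matrix. $R_{\Lambda_1,\Lambda_2}(x)\in\mathrm{End}(M_{\Lambda_1}\otimes M_{\Lambda_2})(x)$ is the rational $\mathfrak{gl}_2$ $R$-matrix; it fixes $v_{\Lambda_1}\otimes v_{\Lambda_2}$, and in the basis $fv_{\Lambda_1}\otimes v_{\Lambda_2},\ v_{\Lambda_1}\otimes fv_{\Lambda_2}$ it equals $$\frac1{x-\Lambda_1}\begin{pmatrix}x-\Lambda_1+\Lambda_2&-\Lambda_2\\-\Lambda_1&x\end{pmatrix}$$ (only these weight subspaces are needed here). $R^{(i,j)}_{\Lambda_i,\Lambda_j}$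 denotes its action on the $i$-th and $j$-th tensor factors (first factor of $R$ on the $i$-th). $\kappa^{h_2^{(m)}}$ acts on $V_{\mathbb K}$ by $f^{(m)}\mapsto\kappa f^{(m)}$ and $f^{(j)}\mapsto f^{(j)}$ for $j\neq m$. qKZ functions with values in $\mathrm{GL}(V_{\mathbb K})$ and step $a$: $$K_m(x)=R^{(m,m-1)}_{\Lambda_m,\Lambda_{m-1}}(x_m-x_{m-1}+a)\cdots R^{(m,1)}_{\Lambda_m,\Lambda_1}(x_m-x_1+a)\,\kappa^{h_2^{(m)}}\,R^{(m,n)}_{\Lambda_m,\Lambda_n}(x_m-x_n)\cdots R^{(m,m+1)}_{\Lambda_m,\Lambda_{m+1}}(x_m-x_{m+1}).$$ The $p$-curvature operators are $\tilde K_m(x)=K_m(x+(p-1)af_m)\cdots K_m(x+af_m)K_m(x)$. Bethe vector. $\Phi(s,x)=\kappa\prod_{i=1}^n\frac{s-x_i+\Lambda_i}{s-x_i+a}$; $W(s,x)=\sum_{j=1}^nW_j(s,x)f^{(j)}$ with $W_j(s,x)=\prod_{l<j}(s-x_l+\Lambda_l)\prod_{l>j}(s-x_l)$; and $$J(s,x)=\sum_{d=0}^{p-1}W(s+da,x)\prod_{j=0}^{d-1}\Phi(s+aj,x).$$ Deformation of roots. With $\varepsilon=\kappa^{ -1}$ the Bethe ansatz equation is rewritten as $$\prod_{i=1}^n\prod_{j=0}^{p-1}(s-x_i^0+\Lambda_i+aj)=\varepsilon^p\prod_{i=1}^n\prod_{j=0}^{p-1}(s-x_i^0+aj).$$ At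 $\varepsilon=0$ it has only simple roots, among them $y_i^0=x_i^0-\Lambda_i$, $i=1,\dots,n$; through each $(0,y_i^0)$ passes a unique formal branch $s_i(\varepsilon)\in\mathbb K[[\varepsilon]]$ of solutions with $s_i(0)=y_i^0$. "Obtained by deforming the roots $y_1^0,\dots,y_n^0$" refers to these branches.
   Formalization: The eigenvalue is proved with a plus sign, h_p(s_i−x_m)/h_p(s_i−x_m+Λ_m); the printed minus sign is false: for n=1 the p-curvature is κ^p, which the Bethe ansatz equation makes equal to +h_p(s−x)/h_p(s−x+Λ), and p>2. -}

module Defs where

open import Algebra.Apartness.Bundles using (HeytingField; module HeytingCommutativeRing)
open import Algebra.Bundles using (module CommutativeRing)
open import Algebra.Bundles.Raw using (RawRing)
import Algebra.Definitions.RawSemiring as SemiringOps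
open import Axiom.ExcludedMiddle using (ExcludedMiddle)
open import Data.Bool.Base using (if_then_else_)
open import Data.Fin.Base as Fin using (Fin; toℕ; fromℕ)
open import Data.Fin.Properties as Fin using ()
open import Data.List.Base using (List; foldl; filter; allFin)
open import Data.Nat.Base as ℕ using (ℕ; zero; suc; _∸_)
open import Data.Nat.Divisibility using (_∣_)
open import Data.Product.Base using (_×_; _,_; ∃; proj₁)
open import Data.Sum.Base using (_⊎_; inj₁; inj₂)
open import Data.Vec.Functional using (Vector; updateAt; _∷_)
open import Function.Base using (const)
open import Function.Bundles using (_⇔_)
open import Level using (Level; _⊔_; Lift; lift; lower)
open import Relation.Binary.PropositionalEquality using (_≢_)
open import Relation.Nullary using (Dec; yes; no; does; ¬_)
open import Relation.Nullary.Decidable using (map′)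

private
  variable
    m n : ℕ

-- In the presence of excluded middle a Heyting field is a field in the
-- classical sense, and x # y is the same as ¬ (x ≈ y).
module OverField {c ℓ₁ ℓ₂ : Level}
  (em : ExcludedMiddle (c ⊔ ℓ₁ ⊔ ℓ₂)) (K : HeytingField c ℓ₁ ℓ₂) where

  open HeytingField K public
    using (Carrier; _≈_; _#_; _+_; _*_; -_; _-_; 0#; 1#; #⇒invertible)

  rawRing : RawRing c ℓ₁
  rawRing = CommutativeRing.rawRing
    (HeytingCommutativeRing.commutativeRing (HeytingField.heytingCommutativeRing K))

  open SemiringOps (RawRing.rawSemiring rawRing) public
    using (_^_; sum; product) renaming (_×_ to _·_)

  #0? : ∀ x → Dec (x # 0#)
  #0? x = map′ lower lift (em {P = Lift (c ⊔ ℓ₁) (x # 0#)})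

  infix 8 _⁻¹
  infixl 7 _/_

  -- Total inversion, with 0# ⁻¹ = 0#.
  _⁻¹ : Carrier → Carrier
  x ⁻¹ with #0? x
  ... | yes x#0 = proj₁ (#⇒invertible x#0)
  ... | no  _   = 0#

  _/_ : Carrier → Carrier → Carrier
  x / y = x * y ⁻¹

  HasCharacteristic : ℕ → Set ℓ₁
  HasCharacteristic p = ∀ k → (k · 1# ≈ 0#) ⇔ (p ∣ k)

  -- In positive characteristic the natural multiples of 1# are all of the
  -- prime subfield.
  InPrimeField : Carrier → Set ℓ₁
  InPrimeField x = ∃ λ k → x ≈ k · 1#

  -- The polynomial whose coefficient of degree i is q i, evaluated at t.
  evalPoly : Vector Carrier m → Carrier → Carrier
  evalPoly q t = sum λ i → q i * t ^ toℕ i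

  AlgebraicallyClosed : Set (c ⊔ ℓ₁ ⊔ ℓ₂)
  AlgebraicallyClosed =
    ∀ d (q : Vector Carrier (suc (suc d))) → q (fromℕ (suc d)) # 0# →
    ∃ λ t → evalPoly q t ≈ 0#

  -- P holds on a nonempty Zariski open subset of the multiplicative group;
  -- nonempty because the field will be infinite.
  ForGenericUnit : ∀ {ℓ} → (Carrier → Set ℓ) → Set (c ⊔ ℓ₂ ⊔ ℓ)
  ForGenericUnit P =
    ∃ λ d → ∃ λ (q : Vector Carrier d) → (∃ λ i → q i # 0#) ×
      (∀ κ → κ # 0# → evalPoly q κ # 0# → P κ)

  ----------------------------------------------------------------------
  -- Formal power series in ε

  Series : Set c
  Series = ℕ → Carrier

  constant : Carrier → Series
  constant t zero    = t
  constant t (suc _) = 0#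

  ε : Series
  ε 1 = 1#
  ε _ = 0#

  seriesRing : RawRing c ℓ₁
  seriesRing = record
    { Carrier = Series
    ; _≈_     = λ f g → ∀ k → f k ≈ g k
    ; _+_     = λ f g k → f k + g k
    ; _*_     = λ f g k → sum {suc k} λ i → f (toℕ i) * g (k ∸ toℕ i)
    ; -_      = λ f k → - f k
    ; 0#      = constant 0#
    ; 1#      = constant 1#
    }

  ----------------------------------------------------------------------
  -- Polynomial relations with coefficients in the field

  data Poly (m : ℕ) : Set c where
    con       : Carrier → Poly m
    var       : Fin m → Poly m
    _:+_ _:*_ : Poly m → Poly m → Poly m

  ⟦_⟧ : Poly m → Vector Carrier m → Carrier
  ⟦ con t  ⟧ ρ = t
  ⟦ var i  ⟧ ρ = ρ i
  ⟦ f :+ g ⟧ ρ = ⟦ f ⟧ ρ + ⟦ g ⟧ ρ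
  ⟦ f :* g ⟧ ρ = ⟦ f ⟧ ρ * ⟦ g ⟧ ρ

  ⟦_⟧ˢ : Poly m → Vector Series m → Series
  ⟦ con t  ⟧ˢ ρ = constant t
  ⟦ var i  ⟧ˢ ρ = ρ i
  ⟦ f :+ g ⟧ˢ ρ = RawRing._+_ seriesRing (⟦ f ⟧ˢ ρ) (⟦ g ⟧ˢ ρ)
  ⟦ f :* g ⟧ˢ ρ = RawRing._*_ seriesRing (⟦ f ⟧ˢ ρ) (⟦ g ⟧ˢ ρ)

  -- The branches b i are algebraic over the rational functions in ε, and
  -- s consists of their values at ε = e: every polynomial relation between
  -- ε and the b i holds between e and the s i.  In other words ε ↦ e,
  -- b i ↦ s i is a homomorphism from the algebra generated by ε and the
  -- b i to the field.
  IsSpecialization : Vector Series n → Carrier → Vector Carrier n →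
                     Set (c ⊔ ℓ₁)
  IsSpecialization b e s =
    ∀ F → ⟦ F ⟧ˢ (ε ∷ b) ≈ˢ constant 0# → ⟦ F ⟧ (e ∷ s) ≈ 0#
    where open RawRing seriesRing using () renaming (_≈_ to _≈ˢ_)

  ----------------------------------------------------------------------
  -- Linear algebra in coordinates

  LinearlyIndependent : Vector (Vector Carrier n) m → Set (c ⊔ ℓ₁)
  LinearlyIndependent {m = m} v =
    ∀ (t : Vector Carrier m) → (∀ k → sum (λ i → t i * v i k) ≈ 0#) → ∀ i → t i ≈ 0#

  Spanning : Vector (Vector Carrier n) m → Set (c ⊔ ℓ₁)
  Spanning {n = n} {m = m} v =
    ∀ (w : Vector Carrier n) → ∃ λ (t : Vector Carrier m) →
    ∀ k → sum (λ i → t i * v i k) ≈ w k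

  IsBasis : Vector (Vector Carrier n) m → Set (c ⊔ ℓ₁)
  IsBasis v = LinearlyIndependent v × Spanning v

  NonZeroVector : Vector Carrier n → Set ℓ₂
  NonZeroVector v = ∃ λ k → v k # 0#

  ----------------------------------------------------------------------
  -- The weight space with basis f⁽¹⁾ , … , f⁽ⁿ⁾ is identified with the
  -- coordinate space: v j is the coefficient of f⁽ʲ⁾.

  module QKZ (p : ℕ) {n : ℕ} (Λ : Vector Carrier n) (a : Carrier) where

    V : Set c
    V = Vector Carrier n

    shift : Vector Carrier n → Fin n → Carrier → Vector Carrier n
    shift x i t = updateAt x i (_+ t)

    -- The R-matrix acting in tensor factors i ≠ j, its first factor being
    -- placed on i.  The f⁽ᵏ⁾ with k different from i and j are fixed
    -- because v ⊗ v is; the matrix on f⁽ⁱ⁾ , f⁽ʲ⁾ acts on columns.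
    R : Fin n → Fin n → Carrier → V → V
    R i j u v = updateAt (updateAt v i (const vi)) j (const vj)
      where
      vi vj : Carrier
      vi = ((u - Λ i + Λ j) * v i - Λ j * v j) / (u - Λ i)
      vj = (u * v j - Λ i * v i) / (u - Λ i)

    -- Each foldl applies its operators in order of increasing j.
    qKZ : Carrier → Fin n → Vector Carrier n → V → V
    qKZ κ i x v = foldl lower′ (κ^h₂ (foldl upper v above)) below
      where
      above below : List (Fin n)
      above = filter (λ j → i Fin.<? j) (allFin n)
      below = filter (λ j → j Fin.<? i) (allFin n)

      upper lower′ : V → Fin n → V
      upper  w j = R i j (x i - x j) w
      lower′ w j = R i j (x i - x j + a) w

      κ^h₂ : V → V
      κ^h₂ w = updateAt w i (κ *_)

    qKZ-iterate : ℕ → Carrier → Fin n → Vector Carrier n → V → V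
    qKZ-iterate zero    κ i x v = v
    qKZ-iterate (suc d) κ i x v =
      qKZ κ i (shift x i (d · a)) (qKZ-iterate d κ i x v)

    pCurvature : Carrier → Fin n → Vector Carrier n → V → V
    pCurvature = qKZ-iterate p

    Φ : Carrier → Carrier → Vector Carrier n → Carrier
    Φ κ s x = κ * product λ i → (s - x i + Λ i) / (s - x i + a)

    W : Carrier → Vector Carrier n → V
    W s x j = product λ l →
      if does (l Fin.<? j) then s - x l + Λ l else
      if does (j Fin.<? l) then s - x l       else 1#

    J : Carrier → Carrier → Vector Carrier n → V
    J κ s x k = sum {p} λ d →
      W (s + toℕ d · a) x k * product {toℕ d} λ j → Φ κ (s + toℕ j · a) x

    h : Carrier → Carrier
    h u = u ^ p - a ^ (p ∸ 1) * u

    -- The linear factors s + constantTerm x (inj₁ (i , j)) make up the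
    -- numerator and s + constantTerm x (inj₂ (i , j)) the denominator.
    Factor : Set
    Factor = (Fin n × Fin p) ⊎ (Fin n × Fin p)

    constantTerm : Vector Carrier n → Factor → Carrier
    constantTerm x (inj₁ (i , j)) = - x i + Λ i + toℕ j · a
    constantTerm x (inj₂ (i , j)) = - x i + toℕ j · a

    DistinctFactors : Vector Carrier n → Set ℓ₂
    DistinctFactors x = ∀ u v → u ≢ v → constantTerm x u # constantTerm x v

    -- The nonvanishing of the denominators is part of the equation.
    BetheEquation : Carrier → Vector Carrier n → Carrier → Set (ℓ₁ ⊔ ℓ₂)
    BetheEquation κ x s =
      (∀ i → h (s - x i) # 0#) ×
      (κ ^ p * product (λ i → h (s - x i + Λ i) / h (s - x i)) ≈ 1#)

    -- The formal branch through (0 , x i - Λ i) of the deformed equation.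
    IsBranch : Vector Carrier n → Fin n → Series → Set ℓ₁
    IsBranch x i b = (b 0 ≈ x i - Λ i) ×
      (productˢ (λ l → productˢ {p} λ j →
         b +ˢ constant (constantTerm x (inj₁ (l , j))))
       ≈ˢ
       (ε ^ˢ p) *ˢ productˢ (λ l → productˢ {p} λ j →
         b +ˢ constant (constantTerm x (inj₂ (l , j)))))
      where
      open RawRing seriesRing
        using () renaming (_≈_ to _≈ˢ_; _+_ to _+ˢ_; _*_ to _*ˢ_)
      open SemiringOps (RawRing.rawSemiring seriesRing)
        using () renaming (_^_ to _^ˢ_; product to productˢ)

    -- The sign is the one forced by the definitions: for n = 1 the
    -- p-curvature operator is κ ^ p, which the Bethe equation turns into
    -- h (s - x) / h (s - x + Λ).
    eigenvalue : Vector Carrier n → Carrier → Fin n → Carrier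
    eigenvalue x s i = h (s - x i) / h (s - x i + Λ i)

{-# OPTIONS --safe #-}
module Submission where

-- Put P(s) = ∏ h(s - x_l + Λ_l) and Q(s) = ∏ h(s - x_l), where
-- h(u) = ∏_j (u + j a) is additive, so that the Bethe equation reads
-- κ^p P(s) = Q(s).
--
-- Eigenvectors: R^(m,j) moves m past j in the ordering that defines W, and
-- one full turn gives K_m(x) J(s,x) = ρ J(s, x + a f_m) with ρ the ratio of
-- the master functions; the Bethe equation makes the sum J cyclic.  After p
-- steps the factors ρ multiply to h(s - x_m) / h(s - x_m + Λ_m).
--
-- Branches: Hensel's lemma at the simple roots y_i = x_i - Λ_i of P.  They
-- are integral over K[ε] localized at 1 - ε^p, so by lying over they can be
-- specialized at every ε = e with e^p ≠ 1.
--
-- Genericity: each condition on s excludes finitely many s, and each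
-- excluded s excludes the finitely many κ with κ^p P(s) = Q(s).  If
-- h(s_i) = h(s_j), the relation that the divided differences of P and
-- ε^p Q agree at (b_i + k a, b_j) specializes to the vanishing of P'Q - PQ' at s_j.
-- If J(s) vanishes, then κ^p = Q(s) / P(s) turns the p-th power of a
-- component of J(s), rotated to start at s + a, into a nonzero polynomial
-- vanishing at s.  Distinct h(s_i) give distinct eigenvalues, hence a basis.

open import Defs
open import Algebra.Apartness.Bundles using (HeytingField; module HeytingCommutativeRing)
import Algebra.Apartness.Properties.HeytingCommutativeRing as Apart
open import Algebra.Bundles using (CommutativeRing)
open import Algebra.Bundles.Raw using (RawRing)
open import Axiom.ExcludedMiddle using (ExcludedMiddle)
open import Data.Bool.Base as Bool using (Bool; true; false; if_then_else_; _∧_; _∨_)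
open import Data.Bool.Properties using (∨-identityʳ; ∨-zeroʳ; ∧-identityʳ; ∧-zeroʳ)
open import Data.Empty using (⊥-elim)
open import Data.Fin.Base as Fin using (Fin; zero; suc; toℕ; fromℕ; inject₁; fromℕ<; punchIn; punchOut; opposite)
import Data.Fin.Permutation as Perm
open import Data.Fin.Properties as Fin using (suc-injective; toℕ-inject₁; toℕ-fromℕ; toℕ<n; toℕ-fromℕ<; any?; punchIn-punchOut; toℕ-injective; opposite-prop)
open import Data.List.Base as List using (List; []; _∷_; _++_; foldl; filter; allFin; tabulate)
open import Data.List.Relation.Unary.Any as Any using (Any; here; there)
open import Data.List.Relation.Unary.Any.Properties using (++⁺ˡ; ++⁺ʳ; concat⁺; tabulate⁺)
open import Data.Nat.Base as ℕ using (ℕ; zero; suc; _∸_; z≤n; s≤s; NonZero; _<ᵇ_; _≥_; _>_)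
import Data.Nat.Properties as ℕ
open import Data.Product.Base using (∃; _,_; _×_; proj₁; proj₂)
open import Data.Product.Properties using (,-injectiveˡ; ,-injectiveʳ)
open import Data.Sum.Base using (_⊎_; inj₁; inj₂; [_,_])
open import Data.Sum.Properties using (inj₁-injective; inj₂-injective)
open import Data.Unit.Base using (tt)
open import Data.Vec.Base as Vec using (Vec; []; _∷_; lookup; zipWith; fromList; replicate)
open import Data.Vec.Functional as Vector using (Vector; updateAt)
open import Data.Vec.Functional.Properties using (updateAt-updates; updateAt-minimal)
open import Function.Base using (_∘_; id)
open import Function.Bundles using (Equivalence)
open import Level using (_⊔_; Lift; lift; lower) renaming (suc to lsuc)
open import Relation.Binary.Definitions using (tri<; tri≈; tri>)
open import Relation.Binary.PropositionalEquality as ≡ using (_≡_; _≢_)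
import Relation.Binary.Reasoning.Setoid as SetoidReasoning
open import Relation.Nullary using (yes; no; Dec; ¬_; does)
open import Relation.Nullary.Decidable using (map′; decidable-stable; dec-true; dec-false)

-- A branch lives in `K[[ε]]`, where no convergence is available; only its algebraic relations can
-- be carried over to a value of `ε`. A specialization is therefore a mere homomorphism, chosen
-- without any continuity, and inequalities between series do not pass through it. Every property of
-- the solutions has to come from a polynomial relation between branches or fail for finitely many
-- `κ` only. Hence the treatment of distinctness: the difference of two branches is divided out
-- while it is still a unit, and the relation that remains survives a collision of their values. The
-- shifts `b i + k a` have to be included because the eigenvalues see a solution only through `h`,
-- that is, modulo multiples of `a`. The vector `J` depends on `κ` as well as on `s`, whereas the
-- Bethe equation recovers only `κ ^ p` from `s`; the Frobenius map bridges this gap. In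
-- characteristic `p` derivatives may vanish identically, so the excluding polynomials are shown to
-- be nonzero at the undeformed roots `y i`, which are simple zeros of `P` and no zeros of `Q`.

module RingLemmas {c ℓ} (R : CommutativeRing c ℓ) where

  open CommutativeRing R hiding (zero)
  open import Data.Integer.Base as ℤ using (ℤ; +_; -[1+_]; _⊖_)
  import Data.Integer.Properties as ℤ
  open import Data.Integer.Properties using ([1+m]⊖[1+n]≡m⊖n; pos-*; neg-distribʳ-*; neg-distribˡ-*)
  open import Data.Maybe.Base using (Maybe; just; nothing)
  open import Algebra.Properties.Ring ring public
    using (-‿distribˡ-*; -‿distribʳ-*; -‿involutive; -0#≈0#; -‿+-comm; x∙y⁻¹≈ε⇒x≈y; x≈y⇒x∙y⁻¹≈ε)
  open import Algebra.Properties.Semiring.Sum semiring public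
    using (sum; *-distribˡ-sum; *-distribʳ-sum; ∑-distrib-+; sum-init-last; sum-cong-≋)
  open import Algebra.Properties.CommutativeMonoid.Sum *-commutativeMonoid public
    using () renaming (sum to product; sum-cong-≋ to product-cong; ∑-distrib-+ to product-distrib-*;
                       ∑-comm to product-comm; sum-permute to product-permute)
  open import Algebra.Properties.CommutativeSemiring.Exp commutativeSemiring public
    using (_^_; ^-congˡ; ^-distrib-*; ^-homo-*; ^-assocʳ)
  open import Algebra.Properties.Semiring.Mult semiring public
    using (×-assoc-*; ×1-homo-*; ×-homo-+; ×-congʳ) renaming (_×_ to _·_)
  open import Relation.Binary.Reasoning.Setoid setoid

  -- Integer coefficients for the ring solver

  private
    import Algebra.Properties.Semiring.Mult.TCOptimised semiring as T
    import Algebra.Solver.Ring as Solver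
    open import Algebra.Solver.Ring.AlmostCommutativeRing
      using (fromCommutativeRing; _-Raw-AlmostCommutative⟶_)

    -- The optimised multiple reduces `1 T.× 1#` to `1#`, so that `lit (+ 1)` denotes `1#` by
    -- computation and `1-homo` is `refl`.
    ⟦_⟧ℤ : ℤ → Carrier
    ⟦ + n ⟧ℤ      = n T.× 1#
    ⟦ -[1+ n ] ⟧ℤ = - (suc n T.× 1#)

    cancel-suc : ∀ m n → suc m T.× 1# - suc n T.× 1# ≈ m T.× 1# - n T.× 1#
    cancel-suc m n = begin
      suc m T.× 1# - suc n T.× 1#
        ≈⟨ +-cong (T.1+× m 1#) (-‿cong (T.1+× n 1#)) ⟩
      (1# + m T.× 1#) - (1# + n T.× 1#)
        ≈⟨ +-cong (+-comm _ _) (sym (-‿+-comm _ _)) ⟩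
      (m T.× 1# + 1#) + (- 1# - n T.× 1#)
        ≈⟨ +-assoc _ _ _ ⟩
      m T.× 1# + (1# + (- 1# - n T.× 1#))
        ≈⟨ +-congˡ (+-assoc _ _ _) ⟨
      m T.× 1# + ((1# - 1#) - n T.× 1#)
        ≈⟨ +-congˡ (trans (+-congʳ (-‿inverseʳ 1#)) (+-identityˡ _)) ⟩
      m T.× 1# - n T.× 1# ∎

    ⊖-homo : ∀ m n → ⟦ m ⊖ n ⟧ℤ ≈ m T.× 1# - n T.× 1#
    ⊖-homo m       zero    = sym (trans (+-congˡ -0#≈0#) (+-identityʳ _))
    ⊖-homo zero    (suc n) = sym (+-identityˡ _)
    ⊖-homo (suc m) (suc n) rewrite [1+m]⊖[1+n]≡m⊖n m n = trans (⊖-homo m n) (sym (cancel-suc m n))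

    neg-homo : ∀ i → ⟦ ℤ.- i ⟧ℤ ≈ - ⟦ i ⟧ℤ
    neg-homo (+ zero)   = sym -0#≈0#
    neg-homo (+ suc n)  = refl
    neg-homo -[1+ n ]   = sym (-‿involutive _)

    +-homo′ : ∀ i j → ⟦ i ℤ.+ j ⟧ℤ ≈ ⟦ i ⟧ℤ + ⟦ j ⟧ℤ
    +-homo′ (+ m)    (+ n)    = T.×-homo-+ 1# m n
    +-homo′ (+ m)    -[1+ n ] = ⊖-homo m (suc n)
    +-homo′ -[1+ m ] (+ n)    = trans (⊖-homo n (suc m)) (+-comm _ _)
    +-homo′ -[1+ m ] -[1+ n ] = trans (-‿cong (begin
      suc (suc (m ℕ.+ n)) T.× 1#        ≡⟨ ≡.cong (λ k → suc k T.× 1#) (ℕ.+-suc m n) ⟨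
      (suc m ℕ.+ suc n) T.× 1#          ≈⟨ T.×-homo-+ 1# (suc m) (suc n) ⟩
      suc m T.× 1# + suc n T.× 1#       ∎)) (sym (-‿+-comm _ _))

    *-homo-+ : ∀ m n → ⟦ + m ℤ.* + n ⟧ℤ ≈ m T.× 1# * n T.× 1#
    *-homo-+ m n rewrite ≡.sym (pos-* m n) = T.×1-homo-* m n

    *-homo′ : ∀ i j → ⟦ i ℤ.* j ⟧ℤ ≈ ⟦ i ⟧ℤ * ⟦ j ⟧ℤ
    *-homo′ (+ m)    (+ n)    = *-homo-+ m n
    *-homo′ (+ m)    -[1+ n ] rewrite ≡.sym (neg-distribʳ-* (+ m) (+ suc n)) =
      trans (neg-homo (+ m ℤ.* + suc n)) (trans (-‿cong (*-homo-+ m (suc n))) (-‿distribʳ-* _ _))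
    *-homo′ -[1+ m ] (+ n)    rewrite ≡.sym (neg-distribˡ-* (+ suc m) (+ n)) =
      trans (neg-homo (+ suc m ℤ.* + n)) (trans (-‿cong (*-homo-+ (suc m) n)) (-‿distribˡ-* _ _))
    *-homo′ -[1+ m ] -[1+ n ] = begin
      ⟦ + suc m ℤ.* + suc n ⟧ℤ            ≈⟨ *-homo-+ (suc m) (suc n) ⟩
      suc m T.× 1# * suc n T.× 1#         ≈⟨ -‿involutive _ ⟨
      - - (suc m T.× 1# * suc n T.× 1#)   ≈⟨ -‿cong (-‿distribʳ-* _ _) ⟩
      - (suc m T.× 1# * - (suc n T.× 1#)) ≈⟨ -‿distribˡ-* _ _ ⟩
      ⟦ -[1+ m ] ⟧ℤ * ⟦ -[1+ n ] ⟧ℤ       ∎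

    -- Equality in an arbitrary commutative ring cannot be decided by computation; integer
    -- coefficients let the solver compare and cancel constants.
    coefficients : CommutativeRing.rawRing ℤ.+-*-commutativeRing -Raw-AlmostCommutative⟶ fromCommutativeRing R
    coefficients = record
      { ⟦_⟧ = ⟦_⟧ℤ ; +-homo = +-homo′ ; *-homo = *-homo′ ; -‿homo = neg-homo ; 0-homo = refl ; 1-homo = refl }

    _≟′_ : ∀ i j → Maybe (⟦ i ⟧ℤ ≈ ⟦ j ⟧ℤ)
    i ≟′ j with i ℤ.≟ j
    ... | yes ≡.refl = just refl
    ... | no _       = nothing

  open Solver _ (fromCommutativeRing R) coefficients _≟′_ public
    using (solve)
    renaming (_:=_ to _⊜_; _:+_ to _⊕_; _:*_ to _⊗_; :-_ to ⊝_; _:-_ to _⊟_; con to lit)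

  𝟎 𝟏 : ∀ {n} → Solver.Polynomial _ (fromCommutativeRing R) coefficients _≟′_ n
  𝟎 = lit (+ 0)
  𝟏 = lit (+ 1)

  -- Finite sums and products

  sum-cong : ∀ {n} {f g : Vector Carrier n} → (∀ i → f i ≈ g i) → sum f ≈ sum g
  sum-cong = sum-cong-≋

  sum-zero : ∀ {n} {f : Vector Carrier n} → (∀ i → f i ≈ 0#) → sum f ≈ 0#
  sum-zero {zero}  f≈0 = refl
  sum-zero {suc n} f≈0 = trans (+-cong (f≈0 zero) (sum-zero (λ i → f≈0 (suc i)))) (+-identityˡ 0#)

  product-one : ∀ {n} {f : Vector Carrier n} → (∀ i → f i ≈ 1#) → product f ≈ 1#
  product-one {zero}  f≈1 = refl
  product-one {suc n} f≈1 = trans (*-cong (f≈1 zero) (product-one (λ i → f≈1 (suc i)))) (*-identityˡ 1#)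

  product-zero : ∀ {n} {f : Vector Carrier n} i → f i ≈ 0# → product f ≈ 0#
  product-zero zero    fi≈0 = trans (*-congʳ fi≈0) (zeroˡ _)
  product-zero (suc i) fi≈0 = trans (*-congˡ (product-zero i fi≈0)) (zeroʳ _)

  product-last : ∀ n (f : ℕ → Carrier) →
    product {suc n} (λ i → f (toℕ i)) ≈ product {n} (λ i → f (toℕ i)) * f n
  product-last zero    f = *-comm _ _
  product-last (suc n) f = trans (*-congˡ (product-last n (λ k → f (suc k)))) (sym (*-assoc _ _ _))

  sum-last : ∀ n (f : ℕ → Carrier) →
    sum {suc n} (λ i → f (toℕ i)) ≈ sum {n} (λ i → f (toℕ i)) + f n
  sum-last zero    f = +-comm _ _
  sum-last (suc n) f = trans (+-congˡ (sum-last n (λ k → f (suc k)))) (sym (+-assoc _ _ _))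

  product-^ : ∀ n x → product {n} (λ _ → x) ≈ x ^ n
  product-^ zero    x = refl
  product-^ (suc n) x = *-congˡ (product-^ n x)

  ∑-combine : ∀ {n} x y (f g : Vector Carrier n) →
    sum (λ i → x * f i + y * g i) ≈ x * sum f + y * sum g
  ∑-combine x y f g =
    trans (∑-distrib-+ (λ i → x * f i) (λ i → y * g i)) (+-cong (sym (*-distribˡ-sum x f)) (sym (*-distribˡ-sum y g)))

  -≈0⇒≈ : ∀ {x y} → x - y ≈ 0# → x ≈ y
  -≈0⇒≈ = x∙y⁻¹≈ε⇒x≈y _ _

  ≈⇒-≈0 : ∀ {x y} → x ≈ y → x - y ≈ 0#
  ≈⇒-≈0 = x≈y⇒x∙y⁻¹≈ε

-- Classical field arithmetic with total inversion

module FieldBase {c ℓ₁ ℓ₂} (em : ExcludedMiddle (c ⊔ ℓ₁ ⊔ ℓ₂)) (K : HeytingField c ℓ₁ ℓ₂) where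

  open OverField em K public
    hiding (Carrier; _≈_; _+_; _*_; -_; _-_; 0#; 1#; _^_; sum; product; _·_)
  open HeytingField K using (heytingCommutativeRing; tight)
  open Apart heytingCommutativeRing public using (1#0; x#0y#0→xy#0; #-congʳ)

  ring-K : CommutativeRing c ℓ₁
  ring-K = HeytingCommutativeRing.commutativeRing heytingCommutativeRing

  open CommutativeRing ring-K public
    hiding (_≉_; zero; rawRing)
  open RingLemmas ring-K public
  open import Relation.Binary.Reasoning.Setoid setoid

  decide : (A : Set (c ⊔ ℓ₁)) → Dec A
  decide A = map′ lower lift (em {P = Lift ℓ₂ A})

  infix 4 _≟_

  _≟_ : ∀ x y → Dec (x ≈ y)
  x ≟ y = map′ lower lift (em {P = Lift (c ⊔ ℓ₂) (x ≈ y)})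

  ≉⇒# : ∀ {x y} → ¬ x ≈ y → x # y
  ≉⇒# {x} {y} x≉y with map′ lower lift (em {P = Lift (c ⊔ ℓ₁) (x # y)})
  ... | yes x#y = x#y
  ... | no ¬x#y = ⊥-elim (x≉y (proj₁ (tight x y) ¬x#y))

  #⇒≉ : ∀ {x y} → x # y → ¬ x ≈ y
  #⇒≉ {x} {y} x#y x≈y = proj₂ (tight x y) x≈y x#y

  #0-cong : ∀ {x y} → x ≈ y → x # 0# → y # 0#
  #0-cong = #-congʳ

  ⁻¹-inverseʳ : ∀ {x} → x # 0# → x * x ⁻¹ ≈ 1#
  ⁻¹-inverseʳ {x} x#0 with #0? x
  ... | yes y = trans (*-congʳ (sym (trans (+-congˡ -0#≈0#) (+-identityʳ x)))) (proj₂ (proj₂ (#⇒invertible y)))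
  ... | no ¬y = ⊥-elim (¬y x#0)

  ⁻¹-inverseˡ : ∀ {x} → x # 0# → x ⁻¹ * x ≈ 1#
  ⁻¹-inverseˡ x#0 = trans (*-comm _ _) (⁻¹-inverseʳ x#0)

  *-cancelˡ-# : ∀ {x y z} → x # 0# → x * y ≈ x * z → y ≈ z
  *-cancelˡ-# {x} {y} {z} x#0 xy≈xz = begin
    y               ≈⟨ *-identityˡ y ⟨
    1# * y          ≈⟨ *-congʳ (⁻¹-inverseˡ x#0) ⟨
    x ⁻¹ * x * y    ≈⟨ *-assoc _ _ _ ⟩
    x ⁻¹ * (x * y)  ≈⟨ *-congˡ xy≈xz ⟩
    x ⁻¹ * (x * z)  ≈⟨ *-assoc _ _ _ ⟨
    x ⁻¹ * x * z    ≈⟨ *-congʳ (⁻¹-inverseˡ x#0) ⟩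
    1# * z          ≈⟨ *-identityˡ z ⟩
    z               ∎

  *-zero-# : ∀ {x y} → x # 0# → x * y ≈ 0# → y ≈ 0#
  *-zero-# {x} x#0 xy≈0 = *-cancelˡ-# x#0 (trans xy≈0 (sym (zeroʳ x)))

  #0-*ˡ : ∀ {x y} → x * y # 0# → x # 0#
  #0-*ˡ {y = y} xy#0 = ≉⇒# λ x≈0 → #⇒≉ xy#0 (trans (*-congʳ x≈0) (zeroˡ y))

  #0-*ʳ : ∀ {x y} → x * y # 0# → y # 0#
  #0-*ʳ {x = x} xy#0 = ≉⇒# λ y≈0 → #⇒≉ xy#0 (trans (*-congˡ y≈0) (zeroʳ x))

  ⁻¹-#0 : ∀ {x} → x # 0# → x ⁻¹ # 0#
  ⁻¹-#0 x#0 = #0-*ʳ (#0-cong (sym (⁻¹-inverseʳ x#0)) 1#0)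

  /-unique : ∀ {x y z} → y # 0# → x ≈ y * z → x / y ≈ z
  /-unique {x} {y} {z} y#0 x≈yz = *-cancelˡ-# y#0 (begin
    y * (x * y ⁻¹)  ≈⟨ solve 3 (λ x y i → y ⊗ (x ⊗ i) ⊜ x ⊗ (y ⊗ i)) refl x y (y ⁻¹) ⟩
    x * (y * y ⁻¹)  ≈⟨ *-congˡ (⁻¹-inverseʳ y#0) ⟩
    x * 1#          ≈⟨ *-identityʳ x ⟩
    x               ≈⟨ x≈yz ⟩
    y * z           ∎)

  /-cancel : ∀ {x y} → y # 0# → y * (x / y) ≈ x
  /-cancel {x} {y} y#0 = begin
    y * (x * y ⁻¹)  ≈⟨ solve 3 (λ x y i → y ⊗ (x ⊗ i) ⊜ x ⊗ (y ⊗ i)) refl x y (y ⁻¹) ⟩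
    x * (y * y ⁻¹)  ≈⟨ *-congˡ (⁻¹-inverseʳ y#0) ⟩
    x * 1#          ≈⟨ *-identityʳ x ⟩
    x               ∎

  ^-#0 : ∀ {x} n → x # 0# → x ^ n # 0#
  ^-#0 zero    x#0 = 1#0
  ^-#0 (suc n) x#0 = x#0y#0→xy#0 x#0 (^-#0 n x#0)

  product-#0 : ∀ {n} {f : Vector Carrier n} → (∀ i → f i # 0#) → product f # 0#
  product-#0 {zero}  f#0 = 1#0
  product-#0 {suc n} f#0 = x#0y#0→xy#0 (f#0 zero) (product-#0 (λ i → f#0 (suc i)))

  *-≈0 : ∀ {x y} → x * y ≈ 0# → x ≈ 0# ⊎ y ≈ 0#
  *-≈0 {x} xy≈0 with x ≟ 0#
  ... | yes x≈0 = inj₁ x≈0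
  ... | no  x≉0 = inj₂ (*-zero-# (≉⇒# x≉0) xy≈0)

  product-≈0 : ∀ {n} {f : Vector Carrier n} → product f ≈ 0# → ∃ λ i → f i ≈ 0#
  product-≈0 {zero}  1≈0 = ⊥-elim (#⇒≉ 1#0 1≈0)
  product-≈0 {suc n} ff≈0 with *-≈0 ff≈0
  ... | inj₁ f≈0 = zero , f≈0
  ... | inj₂ g≈0 with product-≈0 g≈0
  ...   | i , fi≈0 = suc i , fi≈0

  -- The inverse is extracted from a proof of apartness, so equal arguments may receive different
  -- witnesses. Uniqueness of inverses settles the nonzero case, the default value `0#` the other.
  ⁻¹-cong : ∀ {x y} → x ≈ y → x ⁻¹ ≈ y ⁻¹
  ⁻¹-cong {x} {y} x≈y with x ≟ 0#
  ... | no x≉0 = *-cancelˡ-# x#0 (begin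
    x * x ⁻¹  ≈⟨ ⁻¹-inverseʳ x#0 ⟩
    1#        ≈⟨ ⁻¹-inverseʳ (#0-cong x≈y x#0) ⟨
    y * y ⁻¹  ≈⟨ *-congʳ x≈y ⟨
    x * y ⁻¹  ∎)
    where x#0 = ≉⇒# x≉0
  ... | yes x≈0 = trans (⁻¹-zero x≈0) (sym (⁻¹-zero (trans (sym x≈y) x≈0)))
    where
    ⁻¹-zero : ∀ {x} → x ≈ 0# → x ⁻¹ ≈ 0#
    ⁻¹-zero {x} x≈0 with #0? x
    ... | yes x#0 = ⊥-elim (#⇒≉ x#0 x≈0)
    ... | no  _   = refl

  /-cong : ∀ {x x′ y y′} → x ≈ x′ → y ≈ y′ → x / y ≈ x′ / y′
  /-cong x≈x′ y≈y′ = *-cong x≈x′ (⁻¹-cong y≈y′)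

  /-inverse : ∀ {x y x′ y′} → x # 0# → y # 0# → x ≈ x′ → y ≈ y′ → (x / y) * (y′ / x′) ≈ 1#
  /-inverse {x} {y} {x′} {y′} x#0 y#0 x≈x′ y≈y′ = begin
    x * y ⁻¹ * (y′ * x′ ⁻¹)    ≈⟨ *-congˡ (*-cong y≈y′ (⁻¹-cong x≈x′)) ⟨
    x * y ⁻¹ * (y * x ⁻¹)      ≈⟨ solve 4 (λ x y i j → x ⊗ j ⊗ (y ⊗ i) ⊜ (x ⊗ i) ⊗ (y ⊗ j)) refl x y (x ⁻¹) (y ⁻¹) ⟩
    (x * x ⁻¹) * (y * y ⁻¹)    ≈⟨ *-cong (⁻¹-inverseʳ x#0) (⁻¹-inverseʳ y#0) ⟩
    1# * 1#                    ≈⟨ *-identityˡ 1# ⟩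
    1#                         ∎

  product-/ : ∀ {n} (f g : Vector Carrier n) → (∀ i → g i # 0#) → product (λ i → f i / g i) * product g ≈ product f
  product-/ f g g#0 = trans (sym (product-distrib-* (λ i → f i / g i) g))
    (product-cong λ i → trans (*-comm _ _) (/-cancel (g#0 i)))

-- Formal power series and contractions in the ε-adic topology

module FormalSeries {c ℓ₁ ℓ₂} (em : ExcludedMiddle (c ⊔ ℓ₁ ⊔ ℓ₂)) (K : HeytingField c ℓ₁ ℓ₂) where

  open FieldBase em K
  open import Relation.Binary.Reasoning.Setoid setoid
  open RawRing seriesRing using ()
    renaming (_≈_ to _≈ˢ_; _+_ to _+ˢ_; _*_ to _*ˢ_; -_ to -ˢ_; 0# to 0ˢ; 1# to 1ˢ)

  shiftˢ : Series → Series
  shiftˢ f k = f (suc k)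

  scale : Carrier → Series → Series
  scale t f k = t * f k

  *ˢ-cong : ∀ {f f′ g g′} → f ≈ˢ f′ → g ≈ˢ g′ → f *ˢ g ≈ˢ f′ *ˢ g′
  *ˢ-cong f≈f′ g≈g′ k = sum-cong {suc k} λ i → *-cong (f≈f′ (toℕ i)) (g≈g′ (k ∸ toℕ i))

  *ˢ-zero : ∀ f g → (f *ˢ g) 0 ≈ f 0 * g 0
  *ˢ-zero f g = +-identityʳ _

  -- The defining sum splits off the constant term of the first factor; the induction for
  -- commutativity also needs to split off that of the second.
  *ˢ-sucʳ : ∀ f g k → (f *ˢ g) (suc k) ≈ (f *ˢ shiftˢ g) k + f (suc k) * g 0
  *ˢ-sucʳ f g zero = begin
    f 0 * g 1 + (f 1 * g 0 + 0#)  ≈⟨ +-cong (sym (+-identityʳ _)) (+-identityʳ _) ⟩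
    f 0 * g 1 + 0# + f 1 * g 0    ∎
  *ˢ-sucʳ f g (suc k) = begin
    f 0 * g (2 ℕ.+ k) + (shiftˢ f *ˢ g) (suc k)
      ≈⟨ +-congˡ (*ˢ-sucʳ (shiftˢ f) g k) ⟩
    f 0 * g (2 ℕ.+ k) + ((shiftˢ f *ˢ shiftˢ g) k + f (2 ℕ.+ k) * g 0)
      ≈⟨ +-assoc _ _ _ ⟨
    (f *ˢ shiftˢ g) (suc k) + f (2 ℕ.+ k) * g 0 ∎

  *ˢ-comm : ∀ f g → f *ˢ g ≈ˢ g *ˢ f
  *ˢ-comm f g zero    = +-congʳ (*-comm _ _)
  *ˢ-comm f g (suc k) = begin
    f 0 * g (suc k) + (shiftˢ f *ˢ g) k  ≈⟨ +-cong (*-comm _ _) (*ˢ-comm (shiftˢ f) g k) ⟩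
    g (suc k) * f 0 + (g *ˢ shiftˢ f) k  ≈⟨ +-comm _ _ ⟩
    (g *ˢ shiftˢ f) k + g (suc k) * f 0  ≈⟨ *ˢ-sucʳ g f k ⟨
    (g *ˢ f) (suc k)                     ∎

  *ˢ-distribʳ : ∀ h f g → (f +ˢ g) *ˢ h ≈ˢ f *ˢ h +ˢ g *ˢ h
  *ˢ-distribʳ h f g k = trans
    (sum-cong {suc k} (λ i → distribʳ (h (k ∸ toℕ i)) (f (toℕ i)) (g (toℕ i))))
    (∑-distrib-+ {suc k} (λ i → f (toℕ i) * h (k ∸ toℕ i)) (λ i → g (toℕ i) * h (k ∸ toℕ i)))

  scale-* : ∀ t f g → scale t f *ˢ g ≈ˢ scale t (f *ˢ g)
  scale-* t f g k = trans
    (sum-cong {suc k} (λ i → *-assoc t (f (toℕ i)) (g (k ∸ toℕ i))))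
    (sym (*-distribˡ-sum t (λ (i : Fin (suc k)) → f (toℕ i) * g (k ∸ toℕ i))))

  *ˢ-assoc : ∀ f g h → (f *ˢ g) *ˢ h ≈ˢ f *ˢ (g *ˢ h)
  *ˢ-assoc f g h zero = begin
    ((f *ˢ g) *ˢ h) 0    ≈⟨ *ˢ-zero (f *ˢ g) h ⟩
    (f *ˢ g) 0 * h 0     ≈⟨ *-congʳ (*ˢ-zero f g) ⟩
    f 0 * g 0 * h 0      ≈⟨ *-assoc _ _ _ ⟩
    f 0 * (g 0 * h 0)    ≈⟨ *-congˡ (*ˢ-zero g h) ⟨
    f 0 * (g *ˢ h) 0     ≈⟨ *ˢ-zero f (g *ˢ h) ⟨
    (f *ˢ (g *ˢ h)) 0    ∎
  *ˢ-assoc f g h (suc k) = begin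
    (f *ˢ g) 0 * h (suc k) + (shiftˢ (f *ˢ g) *ˢ h) k
      ≈⟨ +-cong (*-congʳ (*ˢ-zero f g)) (*ˢ-distribʳ h (scale (f 0) (shiftˢ g)) (shiftˢ f *ˢ g) k) ⟩
    f 0 * g 0 * h (suc k) + ((scale (f 0) (shiftˢ g) *ˢ h) k + ((shiftˢ f *ˢ g) *ˢ h) k)
      ≈⟨ +-congˡ (+-cong (scale-* (f 0) (shiftˢ g) h k) (*ˢ-assoc (shiftˢ f) g h k)) ⟩
    f 0 * g 0 * h (suc k) + (f 0 * (shiftˢ g *ˢ h) k + (shiftˢ f *ˢ (g *ˢ h)) k)
      ≈⟨ solve 5 (λ x y z u v → x ⊗ y ⊗ z ⊕ (x ⊗ u ⊕ v) ⊜ x ⊗ (y ⊗ z ⊕ u) ⊕ v) refl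
           (f 0) (g 0) (h (suc k)) ((shiftˢ g *ˢ h) k) ((shiftˢ f *ˢ (g *ˢ h)) k) ⟩
    f 0 * (g *ˢ h) (suc k) + (shiftˢ f *ˢ (g *ˢ h)) k ∎

  zeroˢ : ∀ f → (λ _ → 0#) *ˢ f ≈ˢ λ _ → 0#
  zeroˢ f k = sum-zero {suc k} λ i → zeroˡ (f (k ∸ toℕ i))

  constant-* : ∀ t f → constant t *ˢ f ≈ˢ scale t f
  constant-* t f zero    = +-identityʳ _
  constant-* t f (suc k) = trans (+-congˡ (zeroˢ f k)) (+-identityʳ _)

  0ˢ-coefficient : ∀ k → 0ˢ k ≈ 0#
  0ˢ-coefficient zero    = refl
  0ˢ-coefficient (suc k) = refl

  ring-S : CommutativeRing c ℓ₁
  ring-S = record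
    { Carrier = Series ; _≈_ = _≈ˢ_ ; _+_ = _+ˢ_ ; _*_ = _*ˢ_ ; -_ = -ˢ_ ; 0# = 0ˢ ; 1# = 1ˢ
    ; isCommutativeRing = record
      { isRing = record
        { +-isAbelianGroup = record
          { isGroup = record
            { isMonoid = record
              { isSemigroup = record
                { isMagma = record
                  { isEquivalence = record
                    { refl  = λ k → refl
                    ; sym   = λ f≈g k → sym (f≈g k)
                    ; trans = λ f≈g g≈h k → trans (f≈g k) (g≈h k) }
                  ; ∙-cong = λ f≈f′ g≈g′ k → +-cong (f≈f′ k) (g≈g′ k) }
                ; assoc = λ f g h k → +-assoc _ _ _ }
              ; identity = (λ f k → trans (+-congʳ (0ˢ-coefficient k)) (+-identityˡ _))
                         , (λ f k → trans (+-congˡ (0ˢ-coefficient k)) (+-identityʳ _)) }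
            ; inverse = (λ f k → trans (-‿inverseˡ _) (sym (0ˢ-coefficient k)))
                      , (λ f k → trans (-‿inverseʳ _) (sym (0ˢ-coefficient k)))
            ; ⁻¹-cong = λ f≈g k → -‿cong (f≈g k) }
          ; comm = λ f g k → +-comm _ _ }
        ; *-cong = *ˢ-cong
        ; *-assoc = *ˢ-assoc
        ; *-identity = (λ f k → trans (constant-* 1# f k) (*-identityˡ _))
                     , (λ f k → trans (*ˢ-comm f 1ˢ k) (trans (constant-* 1# f k) (*-identityˡ _)))
        ; distrib = (λ f g h k → trans (*ˢ-comm f (g +ˢ h) k)
                      (trans (*ˢ-distribʳ f g h k) (+-cong (*ˢ-comm g f k) (*ˢ-comm h f k))))
                  , *ˢ-distribʳ }
      ; *-comm = *ˢ-comm } }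

  constant-cong : ∀ {s t} → s ≈ t → constant s ≈ˢ constant t
  constant-cong s≈t zero    = s≈t
  constant-cong s≈t (suc k) = refl

  constant-+-homo : ∀ s t → constant (s + t) ≈ˢ constant s +ˢ constant t
  constant-+-homo s t zero    = refl
  constant-+-homo s t (suc k) = sym (+-identityˡ 0#)

  constant-*-homo : ∀ s t → constant (s * t) ≈ˢ constant s *ˢ constant t
  constant-*-homo s t zero    = sym (constant-* s (constant t) zero)
  constant-*-homo s t (suc k) = sym (trans (constant-* s (constant t) (suc k)) (zeroʳ s))

  constant-neg-homo : ∀ t → constant (- t) ≈ˢ -ˢ constant t
  constant-neg-homo t zero    = refl
  constant-neg-homo t (suc k) = sym -0#≈0#

  ε-zero : ∀ f → (ε *ˢ f) 0 ≈ 0#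
  ε-zero f = trans (*ˢ-zero ε f) (zeroˡ _)

  ε-suc : ∀ f k → (ε *ˢ f) (suc k) ≈ f k
  ε-suc f k = begin
    0# * f (suc k) + (shiftˢ ε *ˢ f) k   ≈⟨ +-cong (zeroˡ _) (*ˢ-cong {g = f} shift-ε (λ _ → refl) k) ⟩
    0# + (1ˢ *ˢ f) k                     ≈⟨ trans (+-identityˡ _) (trans (constant-* 1# f k) (*-identityˡ _)) ⟩
    f k                                  ∎
    where
    shift-ε : shiftˢ ε ≈ˢ 1ˢ
    shift-ε zero    = refl
    shift-ε (suc k) = refl

  infix 4 _≈[_]_

  -- Congruence modulo the `k`-th power of `ε`.
  _≈[_]_ : Series → ℕ → Series → Set ℓ₁
  f ≈[ k ] g = ∀ {i} → i ℕ.< k → f i ≈ g i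

  ≈[]-+ : ∀ {k f f′ g g′} → f ≈[ k ] f′ → g ≈[ k ] g′ → f +ˢ g ≈[ k ] f′ +ˢ g′
  ≈[]-+ f≈f′ g≈g′ i<k = +-cong (f≈f′ i<k) (g≈g′ i<k)

  ≈[]-* : ∀ {k f f′ g g′} → f ≈[ k ] f′ → g ≈[ k ] g′ → f *ˢ g ≈[ k ] f′ *ˢ g′
  ≈[]-* f≈f′ g≈g′ {i} i<k = sum-cong {suc i} λ j → *-cong
    (f≈f′ (ℕ.≤-<-trans (Fin.toℕ≤pred[n] j) i<k))
    (g≈g′ (ℕ.≤-<-trans (ℕ.m∸n≤m i (toℕ j)) i<k))

  ≈[]-ε : ∀ {k f g} → f ≈[ k ] g → ε *ˢ f ≈[ suc k ] ε *ˢ g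
  ≈[]-ε {f = f} {g} f≈g {zero}  _         = trans (ε-zero f) (sym (ε-zero g))
  ≈[]-ε {f = f} {g} f≈g {suc i} (s≤s i<k) = trans (ε-suc f i) (trans (f≈g i<k) (sym (ε-suc g i)))

  -- Each application of `Ψ` settles one more coefficient, so coefficient `k` no longer changes
  -- after `suc k` iterations and the diagonal of the iterates is their limit.
  fixed-point : (Ψ : Series → Series) → (∀ k f g → f ≈[ k ] g → Ψ f ≈[ suc k ] Ψ g) →
                ∃ λ f → f ≈ˢ Ψ f
  fixed-point Ψ contraction = limit , λ k →
    contraction k (iterate k) limit (λ i<k → sym (limit≈ i<k)) (ℕ.n<1+n k)
    where
    iterate : ℕ → Series
    iterate zero    = 0ˢ
    iterate (suc k) = Ψ (iterate k)

    limit : Series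
    limit k = iterate (suc k) k

    stable : ∀ k → iterate k ≈[ k ] iterate (suc k)
    stable zero    ()
    stable (suc k) = contraction k (iterate k) (iterate (suc k)) (stable k)

    limit≈ : ∀ {i k} → i ℕ.< k → limit i ≈ iterate k i
    limit≈ {i} {suc k} (s≤s i≤k) with ℕ.m≤n⇒m<n∨m≡n i≤k
    ... | inj₁ i<k    = trans (limit≈ i<k) (stable k i<k)
    ... | inj₂ ≡.refl = refl

  -- No inverse series is built: in each degree the coefficients of `g` already known to vanish
  -- leave only `f 0` times the next one.
  cancel-unit : ∀ f g → f 0 # 0# → f *ˢ g ≈ˢ 0ˢ → g ≈ˢ 0ˢ
  cancel-unit f g f₀#0 fg≈0 k = trans (vanish (suc k) (ℕ.n<1+n k)) (sym (0ˢ-coefficient k))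
    where
    zero-* : ∀ k → g ≈[ k ] (λ _ → 0#) → (shiftˢ f *ˢ g) ≈[ k ] λ _ → 0#
    zero-* k g≈0 {i} i<k = trans (≈[]-* {f = shiftˢ f} (λ _ → refl) g≈0 i<k)
      (trans (*ˢ-comm (shiftˢ f) (λ _ → 0#) i) (zeroˢ (shiftˢ f) i))

    vanish : ∀ k → g ≈[ k ] λ _ → 0#
    vanish (suc k) {zero} _ = *-zero-# f₀#0 (trans (sym (*ˢ-zero f g)) (fg≈0 0))
    vanish (suc k) {suc i} (s≤s i<k) = *-zero-# f₀#0 (begin
      f 0 * g (suc i)                         ≈⟨ +-identityʳ _ ⟨
      f 0 * g (suc i) + 0#                    ≈⟨ +-congˡ (zero-* k (vanish k) i<k) ⟨
      f 0 * g (suc i) + (shiftˢ f *ˢ g) i     ≈⟨ fg≈0 (suc i) ⟩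
      0#                                      ∎)

-- Polynomials as syntax trees, Horner forms and coefficient lists

module Polynomials {c ℓ₁ ℓ₂} (em : ExcludedMiddle (c ⊔ ℓ₁ ⊔ ℓ₂)) (K : HeytingField c ℓ₁ ℓ₂) where

  open FieldBase em K hiding (solve; _⊜_; _⊕_; _⊗_; ⊝_; _⊟_; 𝟎; 𝟏)
  open FormalSeries em K using (ring-S; constant-cong; constant-+-homo; constant-*-homo; constant-neg-homo)

  -- The evaluations in the field and in the series ring are two separate recursive functions. The
  -- record gathers their common laws, so that each identity is proved once and then read both
  -- before and after specialization.
  record KAlgebra : Set (lsuc (c ⊔ ℓ₁)) where
    field
      algebraRing : CommutativeRing c ℓ₁
    private module A = CommutativeRing algebraRing
    field
      ι       : Carrier → A.Carrier
      ι-cong  : ∀ {s t} → s ≈ t → ι s A.≈ ι t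
      ι-+     : ∀ s t → ι (s + t) A.≈ ι s A.+ ι t
      ι-*     : ∀ s t → ι (s * t) A.≈ ι s A.* ι t
      ι-neg   : ∀ t → ι (- t) A.≈ A.- ι t
      ι-0     : ι 0# A.≈ A.0#
      ι-1     : ι 1# A.≈ A.1#
      eval    : ∀ {m} → Poly m → Vector A.Carrier m → A.Carrier
      eval-con : ∀ {m} t (ρ : Vector A.Carrier m) → eval (con t) ρ A.≈ ι t
      eval-var : ∀ {m} i (ρ : Vector A.Carrier m) → eval (var i) ρ A.≈ ρ i
      eval-+   : ∀ {m} F G (ρ : Vector A.Carrier m) → eval (F :+ G) ρ A.≈ eval F ρ A.+ eval G ρ
      eval-*   : ∀ {m} F G (ρ : Vector A.Carrier m) → eval (F :* G) ρ A.≈ eval F ρ A.* eval G ρ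

  algebra-K : KAlgebra
  algebra-K = record
    { algebraRing = ring-K ; ι = id ; ι-cong = id ; ι-+ = λ _ _ → refl ; ι-* = λ _ _ → refl
    ; ι-neg = λ _ → refl ; ι-0 = refl ; ι-1 = refl ; eval = ⟦_⟧
    ; eval-con = λ _ _ → refl ; eval-var = λ _ _ → refl
    ; eval-+ = λ _ _ _ → refl ; eval-* = λ _ _ _ → refl }

  algebra-S : KAlgebra
  algebra-S = record
    { algebraRing = ring-S ; ι = constant ; ι-cong = constant-cong ; ι-+ = constant-+-homo ; ι-* = constant-*-homo
    ; ι-neg = constant-neg-homo ; ι-0 = λ _ → refl ; ι-1 = λ _ → refl ; eval = ⟦_⟧ˢ
    ; eval-con = λ _ _ _ → refl ; eval-var = λ _ _ _ → refl
    ; eval-+ = λ _ _ _ _ → refl ; eval-* = λ _ _ _ _ → refl }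

  substP : ∀ {m k} → Poly m → (Fin m → Poly k) → Poly k
  substP (con t)  σ = con t
  substP (var i)  σ = σ i
  substP (F :+ G) σ = substP F σ :+ substP G σ
  substP (F :* G) σ = substP F σ :* substP G σ

  productP : ∀ {m n} → (Fin n → Poly m) → Poly m
  productP {n = zero}  f = con 1#
  productP {n = suc n} f = f zero :* productP (f ∘ suc)

  powP : ∀ {m} → Poly m → ℕ → Poly m
  powP F n = productP {n = n} λ _ → F

  infixl 6 _:-_

  _:-_ : ∀ {m} → Poly m → Poly m → Poly m
  F :- G = F :+ (con (- 1#) :* G)

  sumP : ∀ {m n} → (Fin n → Poly m) → Poly m
  sumP {n = zero}  f = con 0#
  sumP {n = suc n} f = f zero :+ sumP (f ∘ suc)

  -- The divided difference (f X - f Y) / (X - Y), where X and Y are the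
  -- variables 0 and 1.
  DD : Poly 1 → Poly 2
  DD (con t)  = con 0#
  DD (var i)  = con 1#
  DD (F :+ G) = DD F :+ DD G
  DD (F :* G) = (substP F (λ _ → var zero) :* DD G) :+ (DD F :* substP G (λ _ → var (suc zero)))

  -- Horner form: the coefficients of increasing degree are the entries of
  -- the vector, followed by the top coefficient τ.
  module _ (𝔸 : KAlgebra) where
    open KAlgebra 𝔸
    open CommutativeRing algebraRing using () renaming (Carrier to A; _+_ to _+ᴬ_; _*_ to _*ᴬ_)

    horner : ∀ {N} → Carrier → Vec Carrier N → A → A
    horner τ []       x = ι τ
    horner τ (c ∷ cs) x = ι c +ᴬ x *ᴬ horner τ cs x

  -- The quotient of X f(X) by X - t.
  synthetic : ∀ {N} → Carrier → Carrier → Vec Carrier N → Vec Carrier N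
  synthetic τ t []       = []
  synthetic τ t (c ∷ cs) = horner algebra-K τ (c ∷ cs) t ∷ synthetic τ t cs

  add : List Carrier → List Carrier → List Carrier
  add []       ds       = ds
  add (c ∷ cs) []       = c ∷ cs
  add (c ∷ cs) (d ∷ ds) = c + d ∷ add cs ds

  mul : List Carrier → List Carrier → List Carrier
  mul []       ds = []
  mul (c ∷ cs) ds = add (List.map (c *_) ds) (0# ∷ mul cs ds)

  coefficients : Poly 1 → List Carrier
  coefficients (con t)  = t ∷ []
  coefficients (var i)  = 0# ∷ 1# ∷ []
  coefficients (F :+ G) = add (coefficients F) (coefficients G)
  coefficients (F :* G) = mul (coefficients F) (coefficients G)

  addHead : ∀ {N} → Carrier → Vec Carrier (suc N) → Vec Carrier (suc N)
  addHead t (c ∷ cs) = t + c ∷ cs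

  -- Multiplication by `X + t` of a Horner form whose top coefficient, left out of the vector, is
  -- `1#`.
  mulLinear : ∀ {N} → Carrier → Vec Carrier N → Vec Carrier (suc N)
  mulLinear t []       = t ∷ []
  mulLinear t (c ∷ cs) = t * c ∷ addHead c (mulLinear t cs)

  mulLinears : ∀ {k N} → (Fin k → Carrier) → Vec Carrier N → Vec Carrier (k ℕ.+ N)
  mulLinears {zero}  t cs = cs
  mulLinears {suc k} t cs = mulLinear (t zero) (mulLinears (t ∘ suc) cs)

  module InAlgebra (𝔸 : KAlgebra) where
    open KAlgebra 𝔸
    open CommutativeRing algebraRing hiding (zero; rawRing)
      renaming (Carrier to A; _≈_ to _≈ᴬ_; _+_ to _+ᴬ_; _*_ to _*ᴬ_; -_ to -ᴬ_; _-_ to _-ᴬ_; 0# to 0ᴬ; 1# to 1ᴬ;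
                refl to reflᴬ; sym to symᴬ; trans to transᴬ; setoid to setoidᴬ)
    private module R = CommutativeRing algebraRing
    private module L = RingLemmas algebraRing
    open L using (solve; _⊜_; _⊕_; _⊗_; ⊝_; _⊟_; 𝟎; 𝟏)
    open import Relation.Binary.Reasoning.Setoid setoidᴬ

    eval-cong : ∀ {m} (F : Poly m) {ρ ρ′} → (∀ i → ρ i ≈ᴬ ρ′ i) → eval F ρ ≈ᴬ eval F ρ′
    eval-cong (con t)  ρ≈ρ′ = transᴬ (eval-con _ _) (symᴬ (eval-con _ _))
    eval-cong (var i)  ρ≈ρ′ = transᴬ (eval-var _ _) (transᴬ (ρ≈ρ′ i) (symᴬ (eval-var _ _)))
    eval-cong (F :+ G) ρ≈ρ′ =
      transᴬ (eval-+ _ _ _) (transᴬ (R.+-cong (eval-cong F ρ≈ρ′) (eval-cong G ρ≈ρ′)) (symᴬ (eval-+ _ _ _)))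
    eval-cong (F :* G) ρ≈ρ′ =
      transᴬ (eval-* _ _ _) (transᴬ (R.*-cong (eval-cong F ρ≈ρ′) (eval-cong G ρ≈ρ′)) (symᴬ (eval-* _ _ _)))

    eval-subst : ∀ {m k} (F : Poly m) (σ : Fin m → Poly k) ρ →
                 eval (substP F σ) ρ ≈ᴬ eval F (λ i → eval (σ i) ρ)
    eval-subst (con t)  σ ρ = transᴬ (eval-con _ _) (symᴬ (eval-con _ _))
    eval-subst (var i)  σ ρ = symᴬ (eval-var _ _)
    eval-subst (F :+ G) σ ρ =
      transᴬ (eval-+ _ _ _) (transᴬ (R.+-cong (eval-subst F σ ρ) (eval-subst G σ ρ)) (symᴬ (eval-+ _ _ _)))
    eval-subst (F :* G) σ ρ =
      transᴬ (eval-* _ _ _) (transᴬ (R.*-cong (eval-subst F σ ρ) (eval-subst G σ ρ)) (symᴬ (eval-* _ _ _)))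

    eval-product : ∀ {m n} (f : Fin n → Poly m) ρ → eval (productP f) ρ ≈ᴬ L.product (λ i → eval (f i) ρ)
    eval-product {n = zero}  f ρ = transᴬ (eval-con _ _) ι-1
    eval-product {n = suc n} f ρ = transᴬ (eval-* _ _ _) (R.*-congˡ (eval-product (f ∘ suc) ρ))

    eval-sum : ∀ {m n} (f : Fin n → Poly m) ρ → eval (sumP f) ρ ≈ᴬ L.sum (λ i → eval (f i) ρ)
    eval-sum {n = zero}  f ρ = transᴬ (eval-con _ _) ι-0
    eval-sum {n = suc n} f ρ = transᴬ (eval-+ _ _ _) (R.+-congˡ (eval-sum (f ∘ suc) ρ))

    eval-pow : ∀ {m} (F : Poly m) n ρ → eval (powP F n) ρ ≈ᴬ eval F ρ L.^ n
    eval-pow F n ρ = transᴬ (eval-product {n = n} (λ _ → F) ρ) (L.product-^ n _)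

    eval-minus : ∀ {m} (F G : Poly m) ρ → eval (F :- G) ρ ≈ᴬ eval F ρ -ᴬ eval G ρ
    eval-minus F G ρ = begin
      eval (F :- G) ρ                       ≈⟨ eval-+ _ _ _ ⟩
      eval F ρ +ᴬ eval (con (- 1#) :* G) ρ  ≈⟨ R.+-congˡ (eval-* _ _ _) ⟩
      eval F ρ +ᴬ eval (con (- 1#)) ρ *ᴬ eval G ρ
        ≈⟨ R.+-congˡ (R.*-congʳ (transᴬ (eval-con _ _) (transᴬ (ι-neg _) (R.-‿cong ι-1)))) ⟩
      eval F ρ +ᴬ (-ᴬ 1ᴬ) *ᴬ eval G ρ
        ≈⟨ solve 2 (λ x y → x ⊕ ⊝ 𝟏 ⊗ y ⊜ x ⊟ y) reflᴬ (eval F ρ) (eval G ρ) ⟩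
      eval F ρ -ᴬ eval G ρ                  ∎

    at : A → Vector A 1
    at x _ = x

    pair : A → A → Vector A 2
    pair x y zero    = x
    pair x y (suc _) = y

    eval-DD : ∀ F x y → eval F (at x) -ᴬ eval F (at y) ≈ᴬ (x -ᴬ y) *ᴬ eval (DD F) (pair x y)
    eval-DD (con t) x y = begin
      eval (con t) (at x) -ᴬ eval (con t) (at y)
        ≈⟨ R.+-cong (eval-con _ _) (R.-‿cong (eval-con _ _)) ⟩
      ι t -ᴬ ι t            ≈⟨ R.-‿inverseʳ _ ⟩
      0ᴬ                    ≈⟨ R.zeroʳ _ ⟨
      (x -ᴬ y) *ᴬ 0ᴬ        ≈⟨ R.*-congˡ (transᴬ (eval-con _ _) ι-0) ⟨
      (x -ᴬ y) *ᴬ eval (con 0#) (pair x y) ∎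
    eval-DD (var i) x y = begin
      eval (var i) (at x) -ᴬ eval (var i) (at y)
        ≈⟨ R.+-cong (eval-var _ _) (R.-‿cong (eval-var _ _)) ⟩
      x -ᴬ y                ≈⟨ R.*-identityʳ _ ⟨
      (x -ᴬ y) *ᴬ 1ᴬ        ≈⟨ R.*-congˡ (transᴬ (eval-con _ _) ι-1) ⟨
      (x -ᴬ y) *ᴬ eval (con 1#) (pair x y) ∎
    eval-DD (F :+ G) x y = begin
      eval (F :+ G) (at x) -ᴬ eval (F :+ G) (at y)
        ≈⟨ R.+-cong (eval-+ _ _ _) (R.-‿cong (eval-+ _ _ _)) ⟩
      (f +ᴬ g) -ᴬ (f′ +ᴬ g′)
        ≈⟨ solve 4 (λ f g f′ g′ → (f ⊕ g) ⊟ (f′ ⊕ g′) ⊜ (f ⊟ f′) ⊕ (g ⊟ g′)) reflᴬ f g f′ g′ ⟩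
      (f -ᴬ f′) +ᴬ (g -ᴬ g′)
        ≈⟨ R.+-cong (eval-DD F x y) (eval-DD G x y) ⟩
      (x -ᴬ y) *ᴬ eval (DD F) (pair x y) +ᴬ (x -ᴬ y) *ᴬ eval (DD G) (pair x y)
        ≈⟨ R.distribˡ _ _ _ ⟨
      (x -ᴬ y) *ᴬ (eval (DD F) (pair x y) +ᴬ eval (DD G) (pair x y))
        ≈⟨ R.*-congˡ (eval-+ _ _ _) ⟨
      (x -ᴬ y) *ᴬ eval (DD (F :+ G)) (pair x y) ∎
      where
      f = eval F (at x)
      g = eval G (at x)
      f′ = eval F (at y)
      g′ = eval G (at y)
    eval-DD (F :* G) x y = begin
      eval (F :* G) (at x) -ᴬ eval (F :* G) (at y)
        ≈⟨ R.+-cong (eval-* _ _ _) (R.-‿cong (eval-* _ _ _)) ⟩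
      f *ᴬ g -ᴬ f′ *ᴬ g′
        ≈⟨ solve 4 (λ f g f′ g′ → f ⊗ g ⊟ f′ ⊗ g′ ⊜ f ⊗ (g ⊟ g′) ⊕ (f ⊟ f′) ⊗ g′) reflᴬ f g f′ g′ ⟩
      f *ᴬ (g -ᴬ g′) +ᴬ (f -ᴬ f′) *ᴬ g′
        ≈⟨ R.+-cong (R.*-congˡ (eval-DD G x y)) (R.*-congʳ (eval-DD F x y)) ⟩
      f *ᴬ ((x -ᴬ y) *ᴬ dG) +ᴬ ((x -ᴬ y) *ᴬ dF) *ᴬ g′
        ≈⟨ solve 5 (λ f z dG dF g′ → f ⊗ (z ⊗ dG) ⊕ (z ⊗ dF) ⊗ g′ ⊜ z ⊗ (f ⊗ dG ⊕ dF ⊗ g′))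
             reflᴬ f (x -ᴬ y) dG dF g′ ⟩
      (x -ᴬ y) *ᴬ (f *ᴬ dG +ᴬ dF *ᴬ g′)
        ≈⟨ R.*-congˡ (R.+-cong (R.*-congʳ (relabel F zero)) (R.*-congˡ (relabel G (suc zero)))) ⟨
      (x -ᴬ y) *ᴬ (eval (substP F (λ _ → var zero)) (pair x y) *ᴬ dG
                    +ᴬ dF *ᴬ eval (substP G (λ _ → var (suc zero))) (pair x y))
        ≈⟨ R.*-congˡ (transᴬ (eval-+ _ _ _) (R.+-cong (eval-* _ _ _) (eval-* _ _ _))) ⟨
      (x -ᴬ y) *ᴬ eval (DD (F :* G)) (pair x y) ∎
      where
      f = eval F (at x)
      g = eval G (at x)
      f′ = eval F (at y)
      g′ = eval G (at y)
      dF = eval (DD F) (pair x y)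
      dG = eval (DD G) (pair x y)
      relabel : ∀ H i → eval (substP H (λ _ → var i)) (pair x y) ≈ᴬ eval H (at (pair x y i))
      relabel H i = transᴬ (eval-subst H _ _) (eval-cong H λ _ → eval-var _ _)

    horner-cong : ∀ {N} τ (cs : Vec Carrier N) {x y} → x ≈ᴬ y → horner 𝔸 τ cs x ≈ᴬ horner 𝔸 τ cs y
    horner-cong τ []       x≈y = reflᴬ
    horner-cong τ (c ∷ cs) x≈y = R.+-congˡ (R.*-cong x≈y (horner-cong τ cs x≈y))

    horner-synthetic : ∀ {N} τ t (cs : Vec Carrier N) x →
      x *ᴬ horner 𝔸 τ cs x -ᴬ ι (t * horner algebra-K τ cs t) ≈ᴬ (x -ᴬ ι t) *ᴬ horner 𝔸 τ (synthetic τ t cs) x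
    horner-synthetic τ t [] x = begin
      x *ᴬ ι τ -ᴬ ι (t * τ)      ≈⟨ R.+-congˡ (R.-‿cong (ι-* t τ)) ⟩
      x *ᴬ ι τ -ᴬ ι t *ᴬ ι τ     ≈⟨ solve 3 (λ x τ t → x ⊗ τ ⊟ t ⊗ τ ⊜ (x ⊟ t) ⊗ τ) reflᴬ x (ι τ) (ι t) ⟩
      (x -ᴬ ι t) *ᴬ ι τ          ∎
    horner-synthetic τ t (c ∷ cs) x = begin
      x *ᴬ (ι c +ᴬ x *ᴬ X) -ᴬ ι (t * T′)
        ≈⟨ R.+-congˡ (R.-‿cong (transᴬ (ι-* _ _) (R.*-congˡ T′≈))) ⟩
      x *ᴬ (ι c +ᴬ x *ᴬ X) -ᴬ ι t *ᴬ (ι c +ᴬ ι (t * T))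
        ≈⟨ solve 5 (λ x c X t T → x ⊗ (c ⊕ x ⊗ X) ⊟ t ⊗ (c ⊕ T) ⊜ (x ⊟ t) ⊗ (c ⊕ T) ⊕ x ⊗ (x ⊗ X ⊟ T))
             reflᴬ x (ι c) X (ι t) (ι (t * T)) ⟩
      (x -ᴬ ι t) *ᴬ (ι c +ᴬ ι (t * T)) +ᴬ x *ᴬ (x *ᴬ X -ᴬ ι (t * T))
        ≈⟨ R.+-cong (R.*-congˡ (symᴬ T′≈)) (R.*-congˡ (horner-synthetic τ t cs x)) ⟩
      (x -ᴬ ι t) *ᴬ ι T′ +ᴬ x *ᴬ ((x -ᴬ ι t) *ᴬ Q)
        ≈⟨ solve 4 (λ z T′ x Q → z ⊗ T′ ⊕ x ⊗ (z ⊗ Q) ⊜ z ⊗ (T′ ⊕ x ⊗ Q)) reflᴬ (x -ᴬ ι t) (ι T′) x Q ⟩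
      (x -ᴬ ι t) *ᴬ (ι T′ +ᴬ x *ᴬ Q) ∎
      where
      X = horner 𝔸 τ cs x
      T = horner algebra-K τ cs t
      T′ = c + t * T
      Q = horner 𝔸 τ (synthetic τ t cs) x
      T′≈ : ι T′ ≈ᴬ ι c +ᴬ ι (t * T)
      T′≈ = ι-+ _ _

    horner-root : ∀ {N} τ t c (cs : Vec Carrier N) → horner algebra-K τ (c ∷ cs) t ≈ 0# → ∀ x →
      horner 𝔸 τ (c ∷ cs) x ≈ᴬ (x -ᴬ ι t) *ᴬ horner 𝔸 τ (synthetic τ t cs) x
    horner-root τ t c cs root x = begin
      ι c +ᴬ x *ᴬ X
        ≈⟨ solve 3 (λ c xX tT → c ⊕ xX ⊜ (c ⊕ tT) ⊕ (xX ⊟ tT)) reflᴬ (ι c) (x *ᴬ X) (ι (t * T)) ⟩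
      (ι c +ᴬ ι (t * T)) +ᴬ (x *ᴬ X -ᴬ ι (t * T))
        ≈⟨ R.+-cong (transᴬ (symᴬ (ι-+ _ _)) (transᴬ (ι-cong root) ι-0)) (horner-synthetic τ t cs x) ⟩
      0ᴬ +ᴬ (x -ᴬ ι t) *ᴬ horner 𝔸 τ (synthetic τ t cs) x
        ≈⟨ R.+-identityˡ _ ⟩
      (x -ᴬ ι t) *ᴬ horner 𝔸 τ (synthetic τ t cs) x ∎
      where
      X = horner 𝔸 τ cs x
      T = horner algebra-K τ cs t

    -- Keeping track of the top coefficient serves two purposes: an affine combination of monic
    -- forms stays monic, and the difference of two monic forms has top coefficient `0#`, hence a
    -- smaller degree.
    horner-linear : ∀ {N} α β σ τ {γ} → γ ≈ α * σ + β * τ → (cs ds : Vec Carrier N) → ∀ x →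
      horner 𝔸 γ (zipWith (λ c d → α * c + β * d) cs ds) x ≈ᴬ ι α *ᴬ horner 𝔸 σ cs x +ᴬ ι β *ᴬ horner 𝔸 τ ds x
    horner-linear α β σ τ γ≈ [] [] x =
      transᴬ (ι-cong γ≈) (transᴬ (ι-+ _ _) (R.+-cong (ι-* _ _) (ι-* _ _)))
    horner-linear α β σ τ {γ} γ≈ (c ∷ cs) (d ∷ ds) x = begin
      ι (α * c + β * d) +ᴬ x *ᴬ horner 𝔸 γ (zipWith (λ c d → α * c + β * d) cs ds) x
        ≈⟨ R.+-cong (transᴬ (ι-+ _ _) (R.+-cong (ι-* _ _) (ι-* _ _)))
                    (R.*-congˡ (horner-linear α β σ τ γ≈ cs ds x)) ⟩
      (ι α *ᴬ ι c +ᴬ ι β *ᴬ ι d) +ᴬ x *ᴬ (ι α *ᴬ C +ᴬ ι β *ᴬ D)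
        ≈⟨ solve 7 (λ α c β d x C D →
             (α ⊗ c ⊕ β ⊗ d) ⊕ x ⊗ (α ⊗ C ⊕ β ⊗ D) ⊜ α ⊗ (c ⊕ x ⊗ C) ⊕ β ⊗ (d ⊕ x ⊗ D))
             reflᴬ (ι α) (ι c) (ι β) (ι d) x C D ⟩
      ι α *ᴬ (ι c +ᴬ x *ᴬ C) +ᴬ ι β *ᴬ (ι d +ᴬ x *ᴬ D) ∎
      where
      C = horner 𝔸 σ cs x
      D = horner 𝔸 τ ds x

    hornerˡ : List Carrier → A → A
    hornerˡ cs = horner 𝔸 0# (fromList cs)

    horner-add : ∀ cs ds x → hornerˡ (add cs ds) x ≈ᴬ hornerˡ cs x +ᴬ hornerˡ ds x
    horner-add []       ds x = symᴬ (transᴬ (R.+-congʳ ι-0) (R.+-identityˡ _))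
    horner-add (c ∷ cs) [] x = symᴬ (transᴬ (R.+-congˡ ι-0) (R.+-identityʳ _))
    horner-add (c ∷ cs) (d ∷ ds) x = transᴬ (R.+-cong (ι-+ c d) (R.*-congˡ (horner-add cs ds x)))
      (solve 5 (λ c d x C D → (c ⊕ d) ⊕ x ⊗ (C ⊕ D) ⊜ (c ⊕ x ⊗ C) ⊕ (d ⊕ x ⊗ D)) reflᴬ
        (ι c) (ι d) x (hornerˡ cs x) (hornerˡ ds x))

    horner-map : ∀ t cs x → hornerˡ (List.map (t *_) cs) x ≈ᴬ ι t *ᴬ hornerˡ cs x
    horner-map t []       x = transᴬ ι-0 (symᴬ (transᴬ (R.*-congˡ ι-0) (R.zeroʳ _)))
    horner-map t (c ∷ cs) x = transᴬ (R.+-cong (ι-* t c) (R.*-congˡ (horner-map t cs x)))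
      (solve 4 (λ t c x C → t ⊗ c ⊕ x ⊗ (t ⊗ C) ⊜ t ⊗ (c ⊕ x ⊗ C)) reflᴬ (ι t) (ι c) x (hornerˡ cs x))

    horner-mul : ∀ cs ds x → hornerˡ (mul cs ds) x ≈ᴬ hornerˡ cs x *ᴬ hornerˡ ds x
    horner-mul []       ds x = transᴬ ι-0 (symᴬ (transᴬ (R.*-congʳ ι-0) (R.zeroˡ _)))
    horner-mul (c ∷ cs) ds x = transᴬ (horner-add (List.map (c *_) ds) (0# ∷ mul cs ds) x)
      (transᴬ (R.+-cong (horner-map c ds x) (R.+-cong ι-0 (R.*-congˡ (horner-mul cs ds x))))
        (solve 4 (λ c x C D → c ⊗ D ⊕ (𝟎 ⊕ x ⊗ (C ⊗ D)) ⊜ (c ⊕ x ⊗ C) ⊗ D) reflᴬ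
          (ι c) x (hornerˡ cs x) (hornerˡ ds x)))

    horner-coefficients : ∀ F x → hornerˡ (coefficients F) x ≈ᴬ eval F (at x)
    horner-coefficients (con t) x = transᴬ (R.+-congˡ (transᴬ (R.*-congˡ ι-0) (R.zeroʳ _)))
      (transᴬ (R.+-identityʳ _) (symᴬ (eval-con _ _)))
    horner-coefficients (var i) x = transᴬ (R.+-cong ι-0 (R.*-congˡ (R.+-cong ι-1 (R.*-congˡ ι-0))))
      (transᴬ (solve 1 (λ x → 𝟎 ⊕ x ⊗ (𝟏 ⊕ x ⊗ 𝟎) ⊜ x) reflᴬ x) (symᴬ (eval-var _ _)))
    horner-coefficients (F :+ G) x = transᴬ (horner-add (coefficients F) (coefficients G) x)
      (transᴬ (R.+-cong (horner-coefficients F x) (horner-coefficients G x)) (symᴬ (eval-+ _ _ _)))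
    horner-coefficients (F :* G) x = transᴬ (horner-mul (coefficients F) (coefficients G) x)
      (transᴬ (R.*-cong (horner-coefficients F x) (horner-coefficients G x)) (symᴬ (eval-* _ _ _)))

    horner-addHead : ∀ {N} τ t (cs : Vec Carrier (suc N)) x →
      horner 𝔸 τ (addHead t cs) x ≈ᴬ ι t +ᴬ horner 𝔸 τ cs x
    horner-addHead τ t (c ∷ cs) x = transᴬ (R.+-congʳ (ι-+ t c)) (R.+-assoc _ _ _)

    monic-mulLinear : ∀ {N} t (cs : Vec Carrier N) x →
      horner 𝔸 1# (mulLinear t cs) x ≈ᴬ (x +ᴬ ι t) *ᴬ horner 𝔸 1# cs x
    monic-mulLinear t [] x = transᴬ (R.+-congˡ (R.*-congˡ ι-1))
      (transᴬ (solve 2 (λ x t → t ⊕ x ⊗ 𝟏 ⊜ (x ⊕ t) ⊗ 𝟏) reflᴬ x (ι t)) (R.*-congˡ (symᴬ ι-1)))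
    monic-mulLinear t (c ∷ cs) x = transᴬ
      (R.+-cong (ι-* t c) (R.*-congˡ (transᴬ (horner-addHead 1# c (mulLinear t cs) x) (R.+-congˡ (monic-mulLinear t cs x)))))
      (solve 4 (λ t c x C → t ⊗ c ⊕ x ⊗ (c ⊕ (x ⊕ t) ⊗ C) ⊜ (x ⊕ t) ⊗ (c ⊕ x ⊗ C)) reflᴬ
        (ι t) (ι c) x (horner 𝔸 1# cs x))

    monic-mulLinears : ∀ {k N} (t : Fin k → Carrier) (cs : Vec Carrier N) x →
      horner 𝔸 1# (mulLinears t cs) x ≈ᴬ L.product (λ i → x +ᴬ ι (t i)) *ᴬ horner 𝔸 1# cs x
    monic-mulLinears {zero}  t cs x = symᴬ (R.*-identityˡ _)
    monic-mulLinears {suc k} t cs x = transᴬ (monic-mulLinear (t zero) (mulLinears (t ∘ suc) cs) x)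
      (transᴬ (R.*-congˡ (monic-mulLinears (t ∘ suc) cs x)) (symᴬ (R.*-assoc _ _ _)))

    horner-power-sum : ∀ {N} τ (cs : Vec Carrier N) x →
      horner 𝔸 τ cs x ≈ᴬ ι τ *ᴬ x L.^ N +ᴬ L.sum (λ j → ι (lookup cs j) *ᴬ x L.^ toℕ j)
    horner-power-sum τ [] x = symᴬ (transᴬ (R.+-identityʳ _) (R.*-identityʳ _))
    horner-power-sum {suc N} τ (c ∷ cs) x = begin
      ι c +ᴬ x *ᴬ horner 𝔸 τ cs x
        ≈⟨ R.+-congˡ (R.*-congˡ (horner-power-sum τ cs x)) ⟩
      ι c +ᴬ x *ᴬ (ι τ *ᴬ x L.^ N +ᴬ S)
        ≈⟨ solve 5 (λ c x τ p S → c ⊕ x ⊗ (τ ⊗ p ⊕ S) ⊜ τ ⊗ (x ⊗ p) ⊕ (c ⊗ 𝟏 ⊕ x ⊗ S)) reflᴬ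
             (ι c) x (ι τ) (x L.^ N) S ⟩
      ι τ *ᴬ x L.^ suc N +ᴬ (ι c *ᴬ 1ᴬ +ᴬ x *ᴬ S)
        ≈⟨ R.+-congˡ (R.+-congˡ (transᴬ (L.*-distribˡ-sum {N} x _) (L.sum-cong {N} λ j →
             solve 3 (λ x c p → x ⊗ (c ⊗ p) ⊜ c ⊗ (x ⊗ p)) reflᴬ x (ι (lookup cs j)) (x L.^ toℕ j)))) ⟩
      ι τ *ᴬ x L.^ suc N +ᴬ L.sum (λ j → ι (lookup (c ∷ cs) j) *ᴬ x L.^ toℕ j) ∎
      where
      S = L.sum (λ j → ι (lookup cs j) *ᴬ x L.^ toℕ j)

-- Polynomial functions, their finitely many zeros, and genericity

module PolynomialFunctions {c ℓ₁ ℓ₂} (em : ExcludedMiddle (c ⊔ ℓ₁ ⊔ ℓ₂)) (K : HeytingField c ℓ₁ ℓ₂) where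

  open FieldBase em K
  open Polynomials em K
  open InAlgebra algebra-K
  open import Relation.Binary.Reasoning.Setoid setoid

  value : ∀ {N} → Carrier → Vec Carrier N → Carrier → Carrier
  value = horner algebra-K

  IsPolynomial : (Carrier → Carrier) → Set (c ⊔ ℓ₁)
  IsPolynomial f = ∃ λ F → ∀ x → f x ≈ ⟦ F ⟧ (at x)

  poly-const : ∀ t → IsPolynomial (λ _ → t)
  poly-const t = con t , λ x → refl

  poly-id : IsPolynomial (λ x → x)
  poly-id = var zero , λ x → refl

  poly-+ : ∀ {f g} → IsPolynomial f → IsPolynomial g → IsPolynomial (λ x → f x + g x)
  poly-+ (F , f≈F) (G , g≈G) = F :+ G , λ x → +-cong (f≈F x) (g≈G x)

  poly-* : ∀ {f g} → IsPolynomial f → IsPolynomial g → IsPolynomial (λ x → f x * g x)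
  poly-* (F , f≈F) (G , g≈G) = F :* G , λ x → *-cong (f≈F x) (g≈G x)

  poly-neg : ∀ {f} → IsPolynomial f → IsPolynomial (λ x → - f x)
  poly-neg {f} (F , f≈F) = con (- 1#) :* F , λ x → trans
    (solve 1 (λ y → ⊝ y ⊜ ⊝ 𝟏 ⊗ y) refl (f x)) (*-congˡ (f≈F x))

  poly-sum : ∀ {n} {f : Fin n → Carrier → Carrier} → (∀ i → IsPolynomial (f i)) →
             IsPolynomial (λ x → sum λ i → f i x)
  poly-sum {zero}  f-poly = poly-const 0#
  poly-sum {suc n} f-poly = poly-+ (f-poly zero) (poly-sum (f-poly ∘ suc))

  poly-product : ∀ {n} {f : Fin n → Carrier → Carrier} → (∀ i → IsPolynomial (f i)) →
                 IsPolynomial (λ x → product λ i → f i x)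
  poly-product {zero}  f-poly = poly-const 1#
  poly-product {suc n} f-poly = poly-* (f-poly zero) (poly-product (f-poly ∘ suc))

  poly-^ : ∀ {f} n → IsPolynomial f → IsPolynomial (λ x → f x ^ n)
  poly-^ zero    f-poly = poly-const 1#
  poly-^ (suc n) f-poly = poly-* f-poly (poly-^ n f-poly)

  poly-eval : ∀ {m} (F : Poly m) {ρ : Fin m → Carrier → Carrier} → (∀ i → IsPolynomial (ρ i)) →
              IsPolynomial (λ x → ⟦ F ⟧ (λ i → ρ i x))
  poly-eval (con t)  ρ-poly = poly-const t
  poly-eval (var i)  ρ-poly = ρ-poly i
  poly-eval (F :+ G) ρ-poly = poly-+ (poly-eval F ρ-poly) (poly-eval G ρ-poly)
  poly-eval (F :* G) ρ-poly = poly-* (poly-eval F ρ-poly) (poly-eval G ρ-poly)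

  -- A point `y` of nonvanishing takes the place of a leading coefficient: after division by `X - r`
  -- the quotient is still nonzero at `y`, and its vector is shorter. Excluded middle tells whether
  -- a further root exists.
  finite-rootsᵛ : ∀ {N} (cs : Vec Carrier N) y → value 0# cs y # 0# →
                  ∃ λ rs → ∀ t → value 0# cs t ≈ 0# → Any (t ≈_) rs
  finite-rootsᵛ [] y 0#0 = ⊥-elim (#⇒≉ 0#0 refl)
  finite-rootsᵛ (c ∷ cs) y fy#0 with decide (∃ λ t → value 0# (c ∷ cs) t ≈ 0#)
  ... | no no-root = [] , λ t root → ⊥-elim (no-root (t , root))
  ... | yes (r , root) = r ∷ proj₁ rest , covers
    where
    factor : ∀ x → value 0# (c ∷ cs) x ≈ (x - r) * value 0# (synthetic 0# r cs) x
    factor = horner-root 0# r c cs root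
    rest = finite-rootsᵛ (synthetic 0# r cs) y (#0-*ʳ (#0-cong (factor y) fy#0))
    covers : ∀ t → value 0# (c ∷ cs) t ≈ 0# → Any (t ≈_) (r ∷ proj₁ rest)
    covers t ft≈0 = [ (λ t-r≈0 → here (-≈0⇒≈ t-r≈0)) , (λ qt≈0 → there (proj₂ rest t qt≈0)) ]
                      (*-≈0 (trans (sym (factor t)) ft≈0))

  -- Abstract, so that the roots of concrete polynomials are never computed.
  abstract
    finite-roots : ∀ {f} → IsPolynomial f → ∀ y → f y # 0# → ∃ λ rs → ∀ t → f t ≈ 0# → Any (t ≈_) rs
    finite-roots {f} (F , f≈F) y fy#0 = proj₁ roots , λ t ft≈0 → proj₂ roots t (trans (sym (f≈ t)) ft≈0)
      where
      f≈ : ∀ t → f t ≈ hornerˡ (coefficients F) t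
      f≈ t = trans (f≈F t) (sym (horner-coefficients F t))
      roots : ∃ λ rs → ∀ t → hornerˡ (coefficients F) t ≈ 0# → Any (t ≈_) rs
      roots = finite-rootsᵛ (fromList (coefficients F)) y (#0-cong (f≈ y) fy#0)

  too-many-roots : ∀ {N} (cs : Vec Carrier N) (r : Fin N → Carrier) → (∀ i j → i ≢ j → r i # r j) →
                   (∀ i → value 0# cs (r i) ≈ 0#) → ∀ x → value 0# cs x ≈ 0#
  too-many-roots []       r distinct root x = refl
  too-many-roots (c ∷ cs) r distinct root x = begin
    value 0# (c ∷ cs) x                           ≈⟨ factor x ⟩
    (x - r zero) * value 0# (synthetic 0# (r zero) cs) x
      ≈⟨ *-congˡ (too-many-roots (synthetic 0# (r zero) cs) (r ∘ suc)
           (λ i j i≢j → distinct (suc i) (suc j) (i≢j ∘ suc-injective)) rest x) ⟩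
    (x - r zero) * 0#                             ≈⟨ zeroʳ _ ⟩
    0#                                            ∎
    where
    factor : ∀ x → value 0# (c ∷ cs) x ≈ (x - r zero) * value 0# (synthetic 0# (r zero) cs) x
    factor = horner-root 0# (r zero) c cs (root zero)
    rest : ∀ i → value 0# (synthetic 0# (r zero) cs) (r (suc i)) ≈ 0#
    rest i = *-zero-# (≉⇒# λ z → #⇒≉ (distinct (suc i) zero λ ()) (-≈0⇒≈ z))
      (trans (sym (factor (r (suc i)))) (root (suc i)))

  monic-vector : ∀ {N} → Vec Carrier N → Vector Carrier (suc N)
  monic-vector []       _       = 1#
  monic-vector (c ∷ cs) zero    = c
  monic-vector (c ∷ cs) (suc i) = monic-vector cs i

  monic-vector-top : ∀ {N} (cs : Vec Carrier N) → monic-vector cs (fromℕ N) # 0#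
  monic-vector-top []       = 1#0
  monic-vector-top (c ∷ cs) = monic-vector-top cs

  evalPoly-monic : ∀ {N} (cs : Vec Carrier N) t → evalPoly (monic-vector cs) t ≈ value 1# cs t
  evalPoly-monic [] t = trans (+-identityʳ _) (*-identityʳ _)
  evalPoly-monic {suc N} (c ∷ cs) t = +-cong (*-identityʳ c) (begin
    sum (λ (i : Fin (suc N)) → monic-vector cs i * (t * t ^ toℕ i))
      ≈⟨ sum-cong {suc N} (λ i → solve 3 (λ q t p → q ⊗ (t ⊗ p) ⊜ t ⊗ (q ⊗ p)) refl (monic-vector cs i) t (t ^ toℕ i)) ⟩
    sum (λ (i : Fin (suc N)) → t * (monic-vector cs i * t ^ toℕ i))
      ≈⟨ *-distribˡ-sum {suc N} t (λ i → monic-vector cs i * t ^ toℕ i) ⟨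
    t * evalPoly (monic-vector cs) t
      ≈⟨ *-congˡ (evalPoly-monic cs t) ⟩
    t * value 1# cs t ∎)

  monic-root : AlgebraicallyClosed → ∀ {N} c (cs : Vec Carrier N) → ∃ λ t → value 1# (c ∷ cs) t ≈ 0#
  monic-root closed {N} c cs with closed N (monic-vector (c ∷ cs)) (monic-vector-top (c ∷ cs))
  ... | t , root = t , trans (sym (evalPoly-monic (c ∷ cs) t)) root

  -- A finite exceptional set is the zero set of the product of the `X - r`, a polynomial that is
  -- nonzero because it is monic.
  generic-avoiding : ∀ {ℓ} {P : Carrier → Set ℓ} (rs : List Carrier) →
    (∀ κ → κ # 0# → ¬ Any (κ ≈_) rs → P κ) → ForGenericUnit P
  generic-avoiding rs holds = _ , monic-vector q , (fromℕ _ , monic-vector-top q) , λ κ κ#0 q#0 →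
    holds κ κ#0 (avoids κ q#0)
    where
    q = mulLinears (λ i → - List.lookup rs i) []

    avoids : ∀ κ → evalPoly (monic-vector q) κ # 0# → ¬ Any (κ ≈_) rs
    avoids κ q#0 κ∈rs = #⇒≉ q#0 (begin
      evalPoly (monic-vector q) κ                        ≈⟨ evalPoly-monic q κ ⟩
      value 1# q κ                                       ≈⟨ monic-mulLinears (λ i → - List.lookup rs i) [] κ ⟩
      product (λ i → κ - List.lookup rs i) * 1#          ≈⟨ *-identityʳ _ ⟩
      product (λ i → κ - List.lookup rs i)               ≈⟨ product-zero (Any.index κ∈rs) (≈⇒-≈0 (lookup-index κ∈rs)) ⟩
      0#                                                 ∎)
      where
      lookup-index : ∀ {rs} (κ∈rs : Any (κ ≈_) rs) → κ ≈ List.lookup rs (Any.index κ∈rs)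
      lookup-index (here κ≈r)    = κ≈r
      lookup-index (there κ∈rs) = lookup-index κ∈rs

  -- Turns finitely many excluded solutions `r` into finitely many excluded parameters `κ`.
  -- Membership in `rs` holds only up to `_≈_`, which is why `B` must respect it.
  finite-union : ∀ {ℓ} {B : Carrier → Carrier → Set ℓ} →
    (∀ {r r′} κ → r ≈ r′ → B r κ → B r′ κ) →
    (∀ r → ∃ λ ks → ∀ κ → B r κ → Any (κ ≈_) ks) →
    ∀ rs → ∃ λ ks → ∀ r κ → Any (r ≈_) rs → B r κ → Any (κ ≈_) ks
  finite-union resp finite []       = [] , λ r κ ()
  finite-union resp finite (r ∷ rs) with finite r | finite-union resp finite rs
  ... | ks , covers | ks′ , covers′ = ks ++ ks′ , λ where
    r′ κ (here r′≈r)  bad → ++⁺ˡ (covers κ (resp κ r′≈r bad))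
    r′ κ (there r′∈rs) bad → ++⁺ʳ ks (covers′ r′ κ r′∈rs bad)

-- Lying over: specializing integral series

module Specialization {c ℓ₁ ℓ₂} (em : ExcludedMiddle (c ⊔ ℓ₁ ⊔ ℓ₂)) (K : HeytingField c ℓ₁ ℓ₂) where

  private module F = FieldBase em K
  open F using (Carrier; _≈_; _#_; 0#; 1#; Poly; con; var; _:+_; _:*_; ⟦_⟧; ⟦_⟧ˢ; Series; ε; constant; AlgebraicallyClosed)
  open FormalSeries em K using (ring-S; ε-zero; ε-suc; constant-cong; constant-*-homo; 0ˢ-coefficient)
  open Polynomials em K
  open PolynomialFunctions em K using (monic-root)
  private module AK = InAlgebra algebra-K
  private module AS = InAlgebra algebra-S
  open AS using (eval-minus; at)
  open CommutativeRing ring-S hiding (zero; rawRing; Carrier)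
    renaming (_≈_ to _≈ˢ_; _+_ to _+ˢ_; _*_ to _*ˢ_; -_ to -ˢ_; _-_ to _-ˢ_; 0# to 0ˢ; 1# to 1ˢ)
  open RingLemmas ring-S renaming (_^_ to _^ˢ_)
  open import Relation.Binary.Reasoning.Setoid setoid

  hornerˢ : ∀ {N} → Vec Carrier N → Series → Series
  hornerˢ = horner algebra-S 1#

  Specializes : ∀ {m} → Vector Series m → Vector Carrier m → Set _
  Specializes ρˢ ρ = ∀ F → ⟦ F ⟧ˢ ρˢ ≈ˢ 0ˢ → ⟦ F ⟧ ρ ≈ 0#

  module _ {m} (ρˢ : Vector Series m) (ρ : Vector Carrier m) where

    -- Nakayama's lemma: a finitely generated module equal to its product
    -- with the kernel of the specialization is annihilated by an element
    -- outside that kernel.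
    nakayama : ∀ {N} (g : Fin N → Series) (u : Fin N → Poly m) (M : Fin N → Fin N → Poly m) →
      (∀ i → ⟦ u i ⟧ ρ # 0#) → (∀ i j → ⟦ M i j ⟧ ρ ≈ 0#) →
      (∀ i → ⟦ u i ⟧ˢ ρˢ *ˢ g i ≈ˢ sum (λ j → ⟦ M i j ⟧ˢ ρˢ *ˢ g j)) →
      ∃ λ v → (⟦ v ⟧ ρ # 0#) × (∀ i → ⟦ v ⟧ˢ ρˢ *ˢ g i ≈ˢ 0ˢ)
    nakayama {zero}  g u M u#0 M≈0 relation = con 1# , F.1#0 , λ ()
    nakayama {suc N} g u M u#0 M≈0 relation = w :* v , F.x#0y#0→xy#0 w#0 v#0 , λ where
        zero    → begin
          ŵ *ˢ v̂ *ˢ g zero                        ≈⟨ *-assoc ŵ v̂ (g zero) ⟩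
          ŵ *ˢ (v̂ *ˢ g zero)                      ≈⟨ *-congˡ {ŵ} eliminate ⟩
          ŵ *ˢ sum T                              ≈⟨ *-distribˡ-sum ŵ T ⟩
          sum (λ j → ŵ *ˢ T j)                    ≈⟨ sum-zero {N} {λ j → ŵ *ˢ T j} (λ j → begin
            ŵ *ˢ (⟦ M zero (suc j) ⟧ˢ ρˢ *ˢ g (suc j))
              ≈⟨ solve 3 (λ w m g → w ⊗ (m ⊗ g) ⊜ m ⊗ (w ⊗ g)) refl ŵ (⟦ M zero (suc j) ⟧ˢ ρˢ) (g (suc j)) ⟩
            ⟦ M zero (suc j) ⟧ˢ ρˢ *ˢ (ŵ *ˢ g (suc j))
              ≈⟨ *-congˡ {⟦ M zero (suc j) ⟧ˢ ρˢ} (kills j) ⟩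
            ⟦ M zero (suc j) ⟧ˢ ρˢ *ˢ 0ˢ          ≈⟨ zeroʳ (⟦ M zero (suc j) ⟧ˢ ρˢ) ⟩
            0ˢ ∎) ⟩
          0ˢ ∎
        (suc i) → begin
          ŵ *ˢ v̂ *ˢ g (suc i)      ≈⟨ solve 3 (λ w v g → w ⊗ v ⊗ g ⊜ v ⊗ (w ⊗ g)) refl ŵ v̂ (g (suc i)) ⟩
          v̂ *ˢ (ŵ *ˢ g (suc i))    ≈⟨ *-congˡ {v̂} (kills i) ⟩
          v̂ *ˢ 0ˢ                  ≈⟨ zeroʳ v̂ ⟩
          0ˢ ∎
      where
      -- The pivot of an elimination without division. It is nonzero at the specialization because
      -- `M zero zero` vanishes there, so multiplying by it keeps the multipliers outside the
      -- kernel.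
      v = u zero :- M zero zero
      v̂ = ⟦ v ⟧ˢ ρˢ
      T : Fin N → Series
      T j = ⟦ M zero (suc j) ⟧ˢ ρˢ *ˢ g (suc j)
      v#0 : ⟦ v ⟧ ρ # 0#
      v#0 = F.#0-cong (F.sym (F.trans (AK.eval-minus (u zero) (M zero zero) ρ)
        (F.trans (F.+-congˡ (F.trans (F.-‿cong (M≈0 zero zero)) F.-0#≈0#)) (F.+-identityʳ _)))) (u#0 zero)
      eliminate : v̂ *ˢ g zero ≈ˢ sum T
      eliminate = begin
        v̂ *ˢ g zero
          ≈⟨ *-congʳ {g zero} (eval-minus (u zero) (M zero zero) ρˢ) ⟩
        (⟦ u zero ⟧ˢ ρˢ -ˢ ⟦ M zero zero ⟧ˢ ρˢ) *ˢ g zero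
          ≈⟨ solve 3 (λ u m g → (u ⊟ m) ⊗ g ⊜ u ⊗ g ⊟ m ⊗ g) refl (⟦ u zero ⟧ˢ ρˢ) (⟦ M zero zero ⟧ˢ ρˢ) (g zero) ⟩
        ⟦ u zero ⟧ˢ ρˢ *ˢ g zero -ˢ ⟦ M zero zero ⟧ˢ ρˢ *ˢ g zero
          ≈⟨ +-congʳ { -ˢ (⟦ M zero zero ⟧ˢ ρˢ *ˢ g zero)} (relation zero) ⟩
        (⟦ M zero zero ⟧ˢ ρˢ *ˢ g zero +ˢ sum T) -ˢ ⟦ M zero zero ⟧ˢ ρˢ *ˢ g zero
          ≈⟨ solve 2 (λ m t → (m ⊕ t) ⊟ m ⊜ t) refl (⟦ M zero zero ⟧ˢ ρˢ *ˢ g zero) (sum T) ⟩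
        sum T ∎
      -- Row `suc i` multiplied by `v`, with `v` times `g zero` replaced by `sum T`.
      M′ : Fin N → Fin N → Poly m
      M′ i j = (M (suc i) zero :* M zero (suc j)) :+ (v :* M (suc i) (suc j))
      reduced = nakayama (g ∘ suc) (λ i → v :* u (suc i)) M′
        (λ i → F.x#0y#0→xy#0 v#0 (u#0 (suc i)))
        (λ i j → F.trans (F.+-cong (F.trans (F.*-congˡ (M≈0 zero (suc j))) (F.zeroʳ _))
                                   (F.trans (F.*-congˡ (M≈0 (suc i) (suc j))) (F.zeroʳ _))) (F.+-identityˡ _))
        (λ i → let S = λ j → ⟦ M (suc i) (suc j) ⟧ˢ ρˢ *ˢ g (suc j)
                   m₀ = ⟦ M (suc i) zero ⟧ˢ ρˢ in begin
          v̂ *ˢ ⟦ u (suc i) ⟧ˢ ρˢ *ˢ g (suc i)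
            ≈⟨ *-assoc v̂ (⟦ u (suc i) ⟧ˢ ρˢ) (g (suc i)) ⟩
          v̂ *ˢ (⟦ u (suc i) ⟧ˢ ρˢ *ˢ g (suc i))
            ≈⟨ *-congˡ {v̂} (relation (suc i)) ⟩
          v̂ *ˢ (m₀ *ˢ g zero +ˢ sum S)
            ≈⟨ solve 4 (λ v m g s → v ⊗ (m ⊗ g ⊕ s) ⊜ m ⊗ (v ⊗ g) ⊕ v ⊗ s) refl v̂ m₀ (g zero) (sum S) ⟩
          m₀ *ˢ (v̂ *ˢ g zero) +ˢ v̂ *ˢ sum S
            ≈⟨ +-congʳ {v̂ *ˢ sum S} (*-congˡ {m₀} eliminate) ⟩
          m₀ *ˢ sum T +ˢ v̂ *ˢ sum S
            ≈⟨ ∑-combine m₀ v̂ T S ⟨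
          sum (λ j → m₀ *ˢ T j +ˢ v̂ *ˢ S j)
            ≈⟨ sum-cong {N} (λ j →
                 solve 5 (λ m t v s g → m ⊗ (t ⊗ g) ⊕ v ⊗ (s ⊗ g) ⊜ (m ⊗ t ⊕ v ⊗ s) ⊗ g) refl
                   m₀ (⟦ M zero (suc j) ⟧ˢ ρˢ) v̂ (⟦ M (suc i) (suc j) ⟧ˢ ρˢ) (g (suc j))) ⟩
          sum (λ j → ⟦ M′ i j ⟧ˢ ρˢ *ˢ g (suc j)) ∎)
      w = proj₁ reduced
      ŵ = ⟦ w ⟧ˢ ρˢ
      w#0 = proj₁ (proj₂ reduced)
      kills = proj₂ (proj₂ reduced)

  horner-poly : ∀ {m N} → Vec Carrier N → Poly (suc m)
  horner-poly []       = con 1#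
  horner-poly (c ∷ cs) = con c :+ (var zero :* horner-poly cs)

  eval-horner-poly : ∀ {m N} (cs : Vec Carrier N) b (ρˢ : Vector Series m) →
    ⟦ horner-poly cs ⟧ˢ (b Vector.∷ ρˢ) ≈ˢ hornerˢ cs b
  eval-horner-poly []       b ρˢ = refl
  eval-horner-poly (c ∷ cs) b ρˢ = +-congˡ {constant c} (*-congˡ {b} (eval-horner-poly cs b ρˢ))

  -- Lying over for the integral equation P(b) = η Q(b).
  module Extension {m} (ρˢ : Vector Series m) (ρ : Vector Carrier m) (specializes : Specializes ρˢ ρ)
    {N′} (P Q : Vec Carrier (suc N′)) (η : Poly m) (1-η#0 : ⟦ con 1# :- η ⟧ ρ # 0#)
    (b : Series) (relation : hornerˢ P b ≈ˢ ⟦ η ⟧ˢ ρˢ *ˢ hornerˢ Q b) where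

    private
      N = suc N′
      η̂ = ⟦ η ⟧ˢ ρˢ

    extended : Vector Series (suc m)
    extended = b Vector.∷ ρˢ

    leading : Poly m
    leading = con 1# :- η

    lower-coefficient : Fin N → Poly m
    lower-coefficient j = (η :* con (lookup Q j)) :- con (lookup P j)

    -- `P` and `Q` are monic of the same degree, so their top terms combine to `1 - η`. This is
    -- invertible near the specialization exactly when `η` does not take the value `1#` there.
    integral : ⟦ leading ⟧ˢ ρˢ *ˢ b ^ˢ N ≈ˢ sum (λ j → ⟦ lower-coefficient j ⟧ˢ ρˢ *ˢ b ^ˢ toℕ j)
    integral = begin
      ⟦ leading ⟧ˢ ρˢ *ˢ bᴺ
        ≈⟨ *-congʳ {bᴺ} (eval-minus (con 1#) η ρˢ) ⟩
      (1ˢ -ˢ η̂) *ˢ bᴺ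
        ≈⟨ solve 3 (λ η b s → (𝟏 ⊟ η) ⊗ b ⊜ (𝟏 ⊗ b ⊕ s) ⊟ η ⊗ b ⊟ s) refl η̂ bᴺ sP ⟩
      (1ˢ *ˢ bᴺ +ˢ sP) -ˢ η̂ *ˢ bᴺ -ˢ sP
        ≈⟨ +-congʳ { -ˢ sP} (+-congʳ { -ˢ (η̂ *ˢ bᴺ)} (begin
             1ˢ *ˢ bᴺ +ˢ sP          ≈⟨ AS.horner-power-sum 1# P b ⟨
             hornerˢ P b             ≈⟨ relation ⟩
             η̂ *ˢ hornerˢ Q b        ≈⟨ *-congˡ {η̂} (AS.horner-power-sum 1# Q b) ⟩
             η̂ *ˢ (1ˢ *ˢ bᴺ +ˢ sQ)   ∎)) ⟩
      η̂ *ˢ (1ˢ *ˢ bᴺ +ˢ sQ) -ˢ η̂ *ˢ bᴺ -ˢ sP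
        ≈⟨ solve 4 (λ η b sP sQ → η ⊗ (𝟏 ⊗ b ⊕ sQ) ⊟ η ⊗ b ⊟ sP ⊜ η ⊗ sQ ⊕ (⊝ 𝟏) ⊗ sP) refl η̂ bᴺ sP sQ ⟩
      η̂ *ˢ sQ +ˢ (-ˢ 1ˢ) *ˢ sP
        ≈⟨ ∑-combine {N} η̂ (-ˢ 1ˢ) q p ⟨
      sum {N} (λ j → η̂ *ˢ q j +ˢ (-ˢ 1ˢ) *ˢ p j)
        ≈⟨ sum-cong {N} (λ j → begin
             η̂ *ˢ q j +ˢ (-ˢ 1ˢ) *ˢ p j
               ≈⟨ solve 4 (λ η q p b → η ⊗ (q ⊗ b) ⊕ (⊝ 𝟏) ⊗ (p ⊗ b) ⊜ (η ⊗ q ⊟ p) ⊗ b) refl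
                    η̂ (constant (lookup Q j)) (constant (lookup P j)) (b ^ˢ toℕ j) ⟩
             (η̂ *ˢ constant (lookup Q j) -ˢ constant (lookup P j)) *ˢ b ^ˢ toℕ j
               ≈⟨ *-congʳ {b ^ˢ toℕ j} (eval-minus (η :* con (lookup Q j)) (con (lookup P j)) ρˢ) ⟨
             ⟦ lower-coefficient j ⟧ˢ ρˢ *ˢ b ^ˢ toℕ j ∎) ⟩
      sum (λ j → ⟦ lower-coefficient j ⟧ˢ ρˢ *ˢ b ^ˢ toℕ j) ∎
      where
      bᴺ = b ^ˢ N
      p q : Fin N → Series
      p j = constant (lookup P j) *ˢ b ^ˢ toℕ j
      q j = constant (lookup Q j) *ˢ b ^ˢ toℕ j
      sP = sum p
      sQ = sum q

    -- The localization at the specialization of the ideal generated by its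
    -- kernel in the algebra generated by b.
    InIdeal : Series → Set (c ⊔ ℓ₁ ⊔ ℓ₂)
    InIdeal x = ∃ λ u → ∃ λ (M : Fin N → Poly m) → (⟦ u ⟧ ρ # 0#) × (∀ j → ⟦ M j ⟧ ρ ≈ 0#) ×
      (⟦ u ⟧ˢ ρˢ *ˢ x ≈ˢ sum (λ j → ⟦ M j ⟧ˢ ρˢ *ˢ b ^ˢ toℕ j))

    ideal-≈ : ∀ {x y} → x ≈ˢ y → InIdeal x → InIdeal y
    ideal-≈ x≈y (u , M , u#0 , M≈0 , eq) =
      u , M , u#0 , M≈0 , trans (*-congˡ {⟦ u ⟧ˢ ρˢ} (sym x≈y)) eq

    ideal-+ : ∀ {x y} → InIdeal x → InIdeal y → InIdeal (x +ˢ y)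
    ideal-+ {x} {y} (u , M , u#0 , M≈0 , eq) (u′ , M′ , u′#0 , M′≈0 , eq′) =
      u :* u′ , (λ j → (u′ :* M j) :+ (u :* M′ j)) , F.x#0y#0→xy#0 u#0 u′#0 ,
      (λ j → F.trans (F.+-cong (F.trans (F.*-congˡ (M≈0 j)) (F.zeroʳ _)) (F.trans (F.*-congˡ (M′≈0 j)) (F.zeroʳ _)))
               (F.+-identityˡ _)) ,
      (begin
        û *ˢ û′ *ˢ (x +ˢ y)
          ≈⟨ solve 4 (λ u v x y → u ⊗ v ⊗ (x ⊕ y) ⊜ v ⊗ (u ⊗ x) ⊕ u ⊗ (v ⊗ y)) refl û û′ x y ⟩
        û′ *ˢ (û *ˢ x) +ˢ û *ˢ (û′ *ˢ y)
          ≈⟨ +-cong (*-congˡ {û′} eq) (*-congˡ {û} eq′) ⟩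
        û′ *ˢ sum f +ˢ û *ˢ sum f′
          ≈⟨ ∑-combine û′ û f f′ ⟨
        sum (λ j → û′ *ˢ f j +ˢ û *ˢ f′ j)
          ≈⟨ sum-cong {N} (λ j → solve 5 (λ v f u f′ b → v ⊗ (f ⊗ b) ⊕ u ⊗ (f′ ⊗ b) ⊜ (v ⊗ f ⊕ u ⊗ f′) ⊗ b) refl
               û′ (⟦ M j ⟧ˢ ρˢ) û (⟦ M′ j ⟧ˢ ρˢ) (b ^ˢ toℕ j)) ⟩
        sum (λ j → ⟦ (u′ :* M j) :+ (u :* M′ j) ⟧ˢ ρˢ *ˢ b ^ˢ toℕ j) ∎)
      where
      û = ⟦ u ⟧ˢ ρˢ
      û′ = ⟦ u′ ⟧ˢ ρˢ
      f f′ : Fin N → Series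
      f j = ⟦ M j ⟧ˢ ρˢ *ˢ b ^ˢ toℕ j
      f′ j = ⟦ M′ j ⟧ˢ ρˢ *ˢ b ^ˢ toℕ j

    ideal-base : ∀ G {x} → InIdeal x → InIdeal (⟦ G ⟧ˢ ρˢ *ˢ x)
    ideal-base G {x} (u , M , u#0 , M≈0 , eq) =
      u , (λ j → G :* M j) , u#0 , (λ j → F.trans (F.*-congˡ (M≈0 j)) (F.zeroʳ _)) , (begin
        û *ˢ (Ĝ *ˢ x)         ≈⟨ solve 3 (λ u g x → u ⊗ (g ⊗ x) ⊜ g ⊗ (u ⊗ x)) refl û Ĝ x ⟩
        Ĝ *ˢ (û *ˢ x)         ≈⟨ *-congˡ {Ĝ} eq ⟩
        Ĝ *ˢ sum f            ≈⟨ *-distribˡ-sum Ĝ f ⟩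
        sum (λ j → Ĝ *ˢ f j)  ≈⟨ sum-cong {N} (λ j → sym (*-assoc Ĝ (⟦ M j ⟧ˢ ρˢ) (b ^ˢ toℕ j))) ⟩
        sum (λ j → ⟦ G :* M j ⟧ˢ ρˢ *ˢ b ^ˢ toℕ j) ∎)
      where
      û = ⟦ u ⟧ˢ ρˢ
      Ĝ = ⟦ G ⟧ˢ ρˢ
      f : Fin N → Series
      f j = ⟦ M j ⟧ˢ ρˢ *ˢ b ^ˢ toℕ j

    ideal-b : ∀ {x} → InIdeal x → InIdeal (b *ˢ x)
    ideal-b {x} (u , M , u#0 , M≈0 , eq) =
      -- Multiplication by `b` pushes the last coefficient up to the power `N` of `b`, which
      -- `integral` brings down again at the price of the factor `leading`.
      leading :* u , (λ j → (leading :* shifted j) :+ (M (fromℕ N′) :* lower-coefficient j)) , F.x#0y#0→xy#0 1-η#0 u#0 ,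
      (λ j → F.trans (F.+-cong (F.trans (F.*-congˡ (shifted≈0 j)) (F.zeroʳ _))
                               (F.trans (F.*-congʳ (M≈0 (fromℕ N′))) (F.zeroˡ _))) (F.+-identityˡ _)) ,
      (begin
        l̂ *ˢ û *ˢ (b *ˢ x)
          ≈⟨ solve 4 (λ l u b x → l ⊗ u ⊗ (b ⊗ x) ⊜ l ⊗ (b ⊗ (u ⊗ x))) refl l̂ û b x ⟩
        l̂ *ˢ (b *ˢ (û *ˢ x))
          ≈⟨ *-congˡ {l̂} (*-congˡ {b} eq) ⟩
        l̂ *ˢ (b *ˢ sum f)
          ≈⟨ *-congˡ {l̂} (*-congˡ {b} (sum-init-last f)) ⟩
        l̂ *ˢ (b *ˢ (sum (f ∘ inject₁) +ˢ f (fromℕ N′)))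
          ≈⟨ *-congˡ {l̂} (*-congˡ {b} (+-congˡ {sum (f ∘ inject₁)}
               (*-congˡ {top} (reflexive (≡.cong (b ^ˢ_) (toℕ-fromℕ N′)))))) ⟩
        l̂ *ˢ (b *ˢ (sum (f ∘ inject₁) +ˢ top *ˢ b ^ˢ N′))
          ≈⟨ solve 5 (λ l b s t p → l ⊗ (b ⊗ (s ⊕ t ⊗ p)) ⊜ l ⊗ (b ⊗ s) ⊕ t ⊗ (l ⊗ (b ⊗ p))) refl
               l̂ b (sum (f ∘ inject₁)) top (b ^ˢ N′) ⟩
        l̂ *ˢ (b *ˢ sum (f ∘ inject₁)) +ˢ top *ˢ (l̂ *ˢ b ^ˢ N)
          ≈⟨ +-cong (*-congˡ {l̂} (begin
               b *ˢ sum (f ∘ inject₁)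
                 ≈⟨ *-distribˡ-sum b (f ∘ inject₁) ⟩
               sum (λ j → b *ˢ f (inject₁ j))
                 ≈⟨ sum-cong {N′} (λ j → trans
                      (*-congˡ {b} (*-congˡ {⟦ M (inject₁ j) ⟧ˢ ρˢ} (reflexive (≡.cong (b ^ˢ_) (toℕ-inject₁ j)))))
                      (solve 3 (λ b m p → b ⊗ (m ⊗ p) ⊜ m ⊗ (b ⊗ p)) refl b (⟦ M (inject₁ j) ⟧ˢ ρˢ) (b ^ˢ toℕ j))) ⟩
               sum (s ∘ suc)
                 ≈⟨ sym (trans (+-congʳ {sum (s ∘ suc)} (zeroˡ 1ˢ)) (+-identityˡ (sum (s ∘ suc)))) ⟩
               sum s ∎)) (*-congˡ {top} integral) ⟩
        l̂ *ˢ sum s +ˢ top *ˢ sum t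
          ≈⟨ ∑-combine l̂ top s t ⟨
        sum (λ j → l̂ *ˢ s j +ˢ top *ˢ t j)
          ≈⟨ sum-cong {N} (λ j → solve 5 (λ l s m t b → l ⊗ (s ⊗ b) ⊕ m ⊗ (t ⊗ b) ⊜ (l ⊗ s ⊕ m ⊗ t) ⊗ b) refl
               l̂ (⟦ shifted j ⟧ˢ ρˢ) top (⟦ lower-coefficient j ⟧ˢ ρˢ) (b ^ˢ toℕ j)) ⟩
        sum (λ j → ⟦ (leading :* shifted j) :+ (M (fromℕ N′) :* lower-coefficient j) ⟧ˢ ρˢ *ˢ b ^ˢ toℕ j) ∎)
      where
      û = ⟦ u ⟧ˢ ρˢ
      l̂ = ⟦ leading ⟧ˢ ρˢ
      top = ⟦ M (fromℕ N′) ⟧ˢ ρˢ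
      shifted : Fin N → Poly m
      shifted zero    = con 0#
      shifted (suc j) = M (inject₁ j)
      shifted≈0 : ∀ j → ⟦ shifted j ⟧ ρ ≈ 0#
      shifted≈0 zero    = F.refl
      shifted≈0 (suc j) = M≈0 (inject₁ j)
      f s t : Fin N → Series
      f j = ⟦ M j ⟧ˢ ρˢ *ˢ b ^ˢ toℕ j
      s j = ⟦ shifted j ⟧ˢ ρˢ *ˢ b ^ˢ toℕ j
      t j = ⟦ lower-coefficient j ⟧ˢ ρˢ *ˢ b ^ˢ toℕ j

    ideal-* : ∀ G {x} → InIdeal x → InIdeal (⟦ G ⟧ˢ extended *ˢ x)
    ideal-* (con t)       x∈I = ideal-base (con t) x∈I
    ideal-* (var zero)    x∈I = ideal-b x∈I
    ideal-* (var (suc i)) x∈I = ideal-base (var i) x∈I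
    ideal-* (G :+ H) {x}  x∈I =
      ideal-≈ (sym (distribʳ x (⟦ G ⟧ˢ extended) (⟦ H ⟧ˢ extended))) (ideal-+ (ideal-* G x∈I) (ideal-* H x∈I))
    ideal-* (G :* H) {x}  x∈I =
      ideal-≈ (sym (*-assoc (⟦ G ⟧ˢ extended) (⟦ H ⟧ˢ extended) x)) (ideal-* G (ideal-* H x∈I))

    ideal-kernel : ∀ G → ⟦ G ⟧ ρ ≈ 0# → InIdeal (⟦ G ⟧ˢ ρˢ)
    ideal-kernel G G≈0 = con 1# , M , F.1#0 , M≈0 , (begin
      1ˢ *ˢ Ĝ                         ≈⟨ *-identityˡ Ĝ ⟩
      Ĝ                               ≈⟨ *-identityʳ Ĝ ⟨
      Ĝ *ˢ 1ˢ                         ≈⟨ +-identityʳ (Ĝ *ˢ 1ˢ) ⟨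
      Ĝ *ˢ 1ˢ +ˢ 0ˢ                   ≈⟨ +-congˡ {Ĝ *ˢ 1ˢ} (sum-zero {N′} (λ j → zeroˡ (b ^ˢ suc (toℕ j)))) ⟨
      sum (λ j → ⟦ M j ⟧ˢ ρˢ *ˢ b ^ˢ toℕ j) ∎)
      where
      Ĝ = ⟦ G ⟧ˢ ρˢ
      M : Fin N → Poly m
      M zero    = G
      M (suc j) = con 0#
      M≈0 : ∀ j → ⟦ M j ⟧ ρ ≈ 0#
      M≈0 zero    = G≈0
      M≈0 (suc j) = F.refl

    -- If `1ˢ` were in the ideal, so would be all powers of `b`, and Nakayama would provide a `v`
    -- that is zero as a series, since it kills `b ^ˢ 0`, but nonzero at `ρ`. This contradicts
    -- `specializes`.
    ideal-proper : ¬ InIdeal 1ˢ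
    ideal-proper 1∈I = F.#⇒≉ (proj₁ (proj₂ annihilator)) (specializes v (begin
      ⟦ v ⟧ˢ ρˢ                ≈⟨ *-identityʳ (⟦ v ⟧ˢ ρˢ) ⟨
      ⟦ v ⟧ˢ ρˢ *ˢ b ^ˢ 0      ≈⟨ proj₂ (proj₂ annihilator) zero ⟩
      0ˢ                       ∎))
      where
      powers : ∀ k → InIdeal (b ^ˢ k)
      powers zero    = 1∈I
      powers (suc k) = ideal-b (powers k)
      multiplier : Fin N → Poly m
      multiplier i = proj₁ (powers (toℕ i))
      matrix : Fin N → Fin N → Poly m
      matrix i = proj₁ (proj₂ (powers (toℕ i)))
      annihilator = nakayama ρˢ ρ (λ j → b ^ˢ toℕ j) multiplier matrix
        (λ i → proj₁ (proj₂ (proj₂ (powers (toℕ i)))))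
        (λ i → proj₁ (proj₂ (proj₂ (proj₂ (powers (toℕ i))))))
        (λ i → proj₂ (proj₂ (proj₂ (proj₂ (powers (toℕ i))))))
      v = proj₁ annihilator

    -- The ideal generated by `InIdeal` and `b - t`. Evaluation at `t` respects all relations as
    -- soon as `1ˢ` is not in it.
    Over : Carrier → Series → Set (c ⊔ ℓ₁ ⊔ ℓ₂)
    Over t x = ∃ λ y → ∃ λ G → InIdeal y × (x ≈ˢ y +ˢ (b -ˢ constant t) *ˢ ⟦ G ⟧ˢ extended)

    -- If `1ˢ` is in `Over t`, then `b - t` is invertible modulo the ideal and can be cancelled from
    -- the product of linear factors that lies in it. Cancelling all factors would leave `1ˢ` in the
    -- ideal, against `ideal-proper`, so some root must stop the process.
    exists-root : AlgebraicallyClosed → ∀ {k} (cs : Vec Carrier k) → InIdeal (hornerˢ cs b) → ∃ λ t → ¬ Over t 1ˢ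
    exists-root closed []       1∈I = ⊥-elim (ideal-proper 1∈I)
    exists-root closed {suc k} (d ∷ cs) q∈I = peel em
      where
      t = proj₁ (monic-root closed d cs)
      quotient : Vec Carrier k
      quotient = synthetic 1# t cs
      q′ = hornerˢ quotient b
      factor : hornerˢ (d ∷ cs) b ≈ˢ (b -ˢ constant t) *ˢ q′
      factor = AS.horner-root 1# t d cs (proj₂ (monic-root closed d cs)) b
      quotient∈I : Over t 1ˢ → InIdeal q′
      quotient∈I (y , G , y∈I , 1≈) = ideal-≈ (sym (begin
        q′                                          ≈⟨ *-identityʳ q′ ⟨
        q′ *ˢ 1ˢ                                    ≈⟨ *-congˡ {q′} 1≈ ⟩
        q′ *ˢ (y +ˢ (b -ˢ constant t) *ˢ Ĝ)         ≈⟨ solve 4 (λ q y z g → q ⊗ (y ⊕ z ⊗ g) ⊜ q ⊗ y ⊕ g ⊗ (z ⊗ q)) refl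
                                                         q′ y (b -ˢ constant t) Ĝ ⟩
        q′ *ˢ y +ˢ Ĝ *ˢ ((b -ˢ constant t) *ˢ q′)   ≈⟨ +-cong (*-congʳ {y} (sym (eval-horner-poly quotient b ρˢ)))
                                                         (*-congˡ {Ĝ} (sym factor)) ⟩
        ⟦ horner-poly quotient ⟧ˢ extended *ˢ y +ˢ Ĝ *ˢ hornerˢ (d ∷ cs) b ∎))
        (ideal-+ (ideal-* (horner-poly quotient) y∈I) (ideal-* G q∈I))
        where Ĝ = ⟦ G ⟧ˢ extended
      peel : Dec (Over t 1ˢ) → ∃ λ t → ¬ Over t 1ˢ
      peel (no proper) = t , proper
      peel (yes 1∈)    = exists-root closed quotient (quotient∈I 1∈)

    over-* : ∀ {t} H {x} → Over t x → Over t (⟦ H ⟧ˢ extended *ˢ x)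
    over-* {t} H {x} (y , G , y∈I , x≈) = _ , H :* G , ideal-* H y∈I , trans (*-congˡ {⟦ H ⟧ˢ extended} x≈)
      (solve 4 (λ h y z g → h ⊗ (y ⊕ z ⊗ g) ⊜ h ⊗ y ⊕ z ⊗ (h ⊗ g)) refl
        (⟦ H ⟧ˢ extended) y (b -ˢ constant t) (⟦ G ⟧ˢ extended))

    over-+ : ∀ {t x y} → Over t x → Over t y → Over t (x +ˢ y)
    over-+ {t} (y , G , y∈I , x≈) (y′ , G′ , y′∈I , x′≈) = _ , G :+ G′ , ideal-+ y∈I y′∈I , trans (+-cong x≈ x′≈)
      (solve 5 (λ y z g y′ g′ → (y ⊕ z ⊗ g) ⊕ (y′ ⊕ z ⊗ g′) ⊜ (y ⊕ y′) ⊕ z ⊗ (g ⊕ g′)) refl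
        y (b -ˢ constant t) (⟦ G ⟧ˢ extended) y′ (⟦ G′ ⟧ˢ extended))

    over-≈ : ∀ {t x y} → x ≈ˢ y → Over t x → Over t y
    over-≈ x≈y (y , G , y∈I , x≈) = y , G , y∈I , trans (sym x≈y) x≈

    over-ideal : ∀ {t x} → InIdeal x → Over t x
    over-ideal {t} {x} x∈I = x , con 0# , x∈I , sym (trans (+-congˡ {x} (zeroʳ (b -ˢ constant t))) (+-identityʳ x))

    -- Modulo `Over t` only constants remain. A relation with nonzero value would thus put a nonzero
    -- constant, and hence `1ˢ`, into `Over t`.
    congruent : ∀ t G → Over t (⟦ G ⟧ˢ extended -ˢ constant (⟦ G ⟧ (t Vector.∷ ρ)))
    congruent t (con r) = over-≈ (sym (-‿inverseʳ (constant r))) (over-ideal (ideal-kernel (con 0#) F.refl))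
    congruent t (var zero) = 0ˢ , con 1# , ideal-kernel (con 0#) F.refl ,
      sym (trans (+-identityˡ ((b -ˢ constant t) *ˢ 1ˢ)) (*-identityʳ (b -ˢ constant t)))
    congruent t (var (suc i)) = over-ideal (ideal-≈ (eval-minus (var i) (con (ρ i)) ρˢ)
      (ideal-kernel (var i :- con (ρ i)) (F.trans (AK.eval-minus (var i) (con (ρ i)) ρ) (F.-‿inverseʳ _))))
    congruent t (G :+ H) = over-≈ (begin
      (Ĝ -ˢ constant g) +ˢ (Ĥ -ˢ constant h)
        ≈⟨ solve 4 (λ G g H h → (G ⊟ g) ⊕ (H ⊟ h) ⊜ (G ⊕ H) ⊟ (g ⊕ h)) refl Ĝ (constant g) Ĥ (constant h) ⟩
      (Ĝ +ˢ Ĥ) -ˢ (constant g +ˢ constant h)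
        ≈⟨ +-congˡ {Ĝ +ˢ Ĥ} (-‿cong (KAlgebra.ι-+ algebra-S g h)) ⟨
      (Ĝ +ˢ Ĥ) -ˢ constant (g F.+ h) ∎) (over-+ (congruent t G) (congruent t H))
      where
      Ĝ = ⟦ G ⟧ˢ extended
      Ĥ = ⟦ H ⟧ˢ extended
      g = ⟦ G ⟧ (t Vector.∷ ρ)
      h = ⟦ H ⟧ (t Vector.∷ ρ)
    congruent t (G :* H) = over-≈ (begin
      Ĝ *ˢ (Ĥ -ˢ constant h) +ˢ constant h *ˢ (Ĝ -ˢ constant g)
        ≈⟨ solve 4 (λ G g H h → G ⊗ (H ⊟ h) ⊕ h ⊗ (G ⊟ g) ⊜ G ⊗ H ⊟ g ⊗ h) refl Ĝ (constant g) Ĥ (constant h) ⟩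
      Ĝ *ˢ Ĥ -ˢ constant g *ˢ constant h
        ≈⟨ +-congˡ {Ĝ *ˢ Ĥ} (-‿cong (constant-*-homo g h)) ⟨
      Ĝ *ˢ Ĥ -ˢ constant (g F.* h) ∎) (over-+ (over-* G (congruent t H)) (over-* (con h) (congruent t G)))
      where
      Ĝ = ⟦ G ⟧ˢ extended
      Ĥ = ⟦ H ⟧ˢ extended
      g = ⟦ G ⟧ (t Vector.∷ ρ)
      h = ⟦ H ⟧ (t Vector.∷ ρ)

    extend : AlgebraicallyClosed → ∃ λ t → Specializes extended (t Vector.∷ ρ)
    extend closed = t , λ G G≈0 → vanishes G G≈0
      where
      e = ⟦ η ⟧ ρ
      1-e#0 : 1# F.- e # 0#
      1-e#0 = F.#0-cong (AK.eval-minus (con 1#) η ρ) 1-η#0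
      -- `q` is `(P - e Q) / (1 - e)`, the specialized equation made monic. Its value at `b` lies in
      -- the ideal because `P(b) - e Q(b)` equals `(η - e) Q(b)`, and `η - e` vanishes at `ρ`.
      α = (1# F.- e) F.⁻¹
      β = F.- (α F.* e)
      α+β : 1# ≈ α F.* 1# F.+ β F.* 1#
      α+β = F.sym (F.trans (F.solve 2 (λ α e → α F.⊗ F.𝟏 F.⊕ F.⊝ (α F.⊗ e) F.⊗ F.𝟏 F.⊜ α F.⊗ (F.𝟏 F.⊟ e)) F.refl α e)
                           (F.⁻¹-inverseˡ 1-e#0))
      q = zipWith (λ x y → α F.* x F.+ β F.* y) P Q
      Qb = hornerˢ Q b
      κ = con α :* (η :- con e)
      q∈I : InIdeal (hornerˢ q b)
      q∈I = ideal-≈ (begin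
        ⟦ horner-poly Q ⟧ˢ extended *ˢ ⟦ κ ⟧ˢ ρˢ
          ≈⟨ *-cong (eval-horner-poly Q b ρˢ) (*-congˡ {constant α} (eval-minus η (con e) ρˢ)) ⟩
        Qb *ˢ (constant α *ˢ (η̂ -ˢ constant e))
          ≈⟨ solve 4 (λ Q α η e → Q ⊗ (α ⊗ (η ⊟ e)) ⊜ α ⊗ (η ⊗ Q) ⊕ ⊝ (α ⊗ e) ⊗ Q) refl Qb (constant α) η̂ (constant e) ⟩
        constant α *ˢ (η̂ *ˢ Qb) +ˢ (-ˢ (constant α *ˢ constant e)) *ˢ Qb
          ≈⟨ +-cong (*-congˡ {constant α} (sym relation))
               (*-congʳ {Qb} (trans (-‿cong (sym (constant-*-homo α e))) (sym (KAlgebra.ι-neg algebra-S (α F.* e))))) ⟩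
        constant α *ˢ hornerˢ P b +ˢ constant β *ˢ Qb
          ≈⟨ AS.horner-linear α β 1# 1# α+β P Q b ⟨
        hornerˢ q b ∎)
        (ideal-* (horner-poly Q) (ideal-kernel κ (F.trans (F.*-congˡ (F.trans (AK.eval-minus η (con e) ρ) (F.-‿inverseʳ _))) (F.zeroʳ _))))
      root = exists-root closed q q∈I
      t = proj₁ root
      vanishes : ∀ G → ⟦ G ⟧ˢ extended ≈ˢ 0ˢ → ⟦ G ⟧ (t Vector.∷ ρ) ≈ 0#
      vanishes G G≈0 = decidable-stable (g F.≟ 0#) λ g≉0 → proj₂ root (over-≈ (begin
        constant (F.- (g F.⁻¹)) *ˢ (⟦ G ⟧ˢ extended -ˢ constant g)
          ≈⟨ *-congˡ {constant (F.- (g F.⁻¹))} (+-congʳ { -ˢ constant g} G≈0) ⟩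
        constant (F.- (g F.⁻¹)) *ˢ (0ˢ -ˢ constant g)
          ≈⟨ *-congʳ {0ˢ -ˢ constant g} (KAlgebra.ι-neg algebra-S (g F.⁻¹)) ⟩
        (-ˢ constant (g F.⁻¹)) *ˢ (0ˢ -ˢ constant g)
          ≈⟨ solve 2 (λ i g → ⊝ i ⊗ (𝟎 ⊟ g) ⊜ i ⊗ g) refl (constant (g F.⁻¹)) (constant g) ⟩
        constant (g F.⁻¹) *ˢ constant g
          ≈⟨ constant-*-homo (g F.⁻¹) g ⟨
        constant (g F.⁻¹ F.* g)
          ≈⟨ constant-cong (F.⁻¹-inverseˡ (F.≉⇒# g≉0)) ⟩
        1ˢ ∎) (over-* (con (F.- (g F.⁻¹))) (congruent t G)))
        where g = ⟦ G ⟧ (t Vector.∷ ρ)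

  -- `ε` is transcendental over `K`: comparing coefficients from the bottom, a vanishing Horner form
  -- in `ε` has only zero entries. Hence every value `e` is admissible.
  specializes-ε : ∀ e → Specializes (at ε) (AK.at e)
  specializes-ε e G G≈0 = F.trans (F.sym (AK.horner-coefficients G e))
    (vanish (coefficients G) (trans (AS.horner-coefficients G ε) G≈0))
    where
    vanish : ∀ cs → AS.hornerˡ cs ε ≈ˢ 0ˢ → AK.hornerˡ cs e ≈ 0#
    vanish []       _     = F.refl
    vanish (d ∷ cs) ds≈0 = F.trans (F.+-cong d≈0 (F.trans (F.*-congˡ (vanish cs cs≈0)) (F.zeroʳ e))) (F.+-identityˡ 0#)
      where
      f = AS.hornerˡ cs ε
      d≈0 : d ≈ 0#
      d≈0 = F.trans (F.sym (F.trans (F.+-congˡ (ε-zero f)) (F.+-identityʳ d))) (ds≈0 0)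
      cs≈0 : f ≈ˢ 0ˢ
      cs≈0 k = F.trans (F.sym (F.trans (F.+-congˡ (ε-suc f k)) (F.+-identityˡ (f k))))
                       (F.trans (ds≈0 (suc k)) (F.sym (0ˢ-coefficient k)))

  specializes-rename : ∀ {m k} {ρˢ : Vector Series m} {ρ} {σˢ : Vector Series k} {σ} (φ : Fin k → Fin m) →
    (∀ i → ρˢ (φ i) ≈ˢ σˢ i) → (∀ i → ρ (φ i) ≈ σ i) → Specializes ρˢ ρ → Specializes σˢ σ
  specializes-rename {ρˢ = ρˢ} {ρ} φ ρˢ≈σˢ ρ≈σ specializes G G≈0 =
    F.trans (F.sym (F.trans (AK.eval-subst G (var ∘ φ) ρ) (AK.eval-cong G ρ≈σ)))
      (specializes (substP G (var ∘ φ)) (trans (AS.eval-subst G (var ∘ φ) ρˢ) (trans (AS.eval-cong G ρˢ≈σˢ) G≈0)))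

  -- The series are adjoined one at a time, each over the algebra generated by `ε` and those already
  -- specialized. Separate specializations would not preserve relations between different branches.
  specialization : AlgebraicallyClosed → ∀ {n N′} (P Q : Vec Carrier (suc N′)) r e → 1# F.- e F.^ r # 0# →
    (b : Vector Series n) → (∀ i → hornerˢ P (b i) ≈ˢ ε ^ˢ r *ˢ hornerˢ Q (b i)) →
    ∃ λ s → Specializes (ε Vector.∷ b) (e Vector.∷ s)
  specialization closed {zero} P Q r e 1-eʳ#0 b relation =
    Vector.[] , specializes-rename {ρˢ = at ε} {AK.at e} (λ i → i)
      (λ where zero → refl) (λ where zero → F.refl) (specializes-ε e)
  specialization closed {suc n} P Q r e 1-eʳ#0 b relation with specialization closed P Q r e 1-eʳ#0 (b ∘ suc) (relation ∘ suc)
  ... | s , specializes = t Vector.∷ s ,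
    specializes-rename {ρˢ = b zero Vector.∷ ε Vector.∷ b ∘ suc} {t Vector.∷ e Vector.∷ s} swap
      (λ where
        zero          → refl
        (suc zero)    → refl
        (suc (suc i)) → refl)
      (λ where
        zero          → F.refl
        (suc zero)    → F.refl
        (suc (suc i)) → F.refl)
      (proj₂ extension)
    where
    -- `Extension` puts the new series in front, whereas `ε` is to remain the first generator.
    swap : Fin (suc (suc n)) → Fin (suc (suc n))
    swap zero          = suc zero
    swap (suc zero)    = zero
    swap (suc (suc i)) = suc (suc i)
    η : Poly (suc n)
    η = powP (var zero) r
    extension = Extension.extend (ε Vector.∷ b ∘ suc) (e Vector.∷ s) specializes P Q η
      (F.#0-cong (F.sym (F.trans (AK.eval-minus (con 1#) η (e Vector.∷ s)) (F.+-congˡ (F.-‿cong (AK.eval-pow (var zero) r (e Vector.∷ s))))))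
        1-eʳ#0)
      (b zero)
      (trans (relation zero) (*-congʳ {hornerˢ Q (b zero)} (sym (AS.eval-pow (var zero) r (ε Vector.∷ b ∘ suc)))))
      closed
    t = proj₁ extension

-- Frobenius and the additive polynomial

module Characteristic {c ℓ₁ ℓ₂} (em : ExcludedMiddle (c ⊔ ℓ₁ ⊔ ℓ₂)) (K : HeytingField c ℓ₁ ℓ₂)
  (p-2 : ℕ) (char : OverField.HasCharacteristic em K (2 ℕ.+ p-2)) where

  open FieldBase em K
  open import Data.Nat.Combinatorics using (_C_; nCn≡1; nCk≡n!/k![n-k]!; k![n∸k]!∣n!)
  open import Data.Nat.Divisibility using (∣⇒≤; ∣-refl)
  open import Data.Nat.DivMod using (m/n*n≡m)
  open import Data.Nat.Base using (_!)
  open Polynomials em K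
  open PolynomialFunctions em K
  open InAlgebra algebra-K
  open import Algebra.Properties.CommutativeSemiring.Binomial commutativeSemiring
    using (binomialTerm) renaming (theorem to binomial-theorem)
  open import Relation.Binary.Reasoning.Setoid setoid

  p : ℕ
  p = 2 ℕ.+ p-2

  p·1≈0 : p · 1# ≈ 0#
  p·1≈0 = Equivalence.from (char p) ∣-refl

  ·-as-* : ∀ k x → k · x ≈ (k · 1#) * x
  ·-as-* k x = trans (×-congʳ k (sym (*-identityˡ x))) (sym (×-assoc-* k 1# x))

  p·≈0 : ∀ x → p · x ≈ 0#
  p·≈0 x = trans (·-as-* p x) (trans (*-congʳ p·1≈0) (zeroˡ x))

  k·1#0 : ∀ k → .{{NonZero k}} → k ℕ.< p → k · 1# # 0#
  k·1#0 k k<p = ≉⇒# λ k≈0 → ℕ.<⇒≱ k<p (∣⇒≤ (Equivalence.to (char k) k≈0))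

  k!·1#0 : ∀ k → k ℕ.< p → (k !) · 1# # 0#
  k!·1#0 zero    _   = #0-cong (sym (+-identityʳ 1#)) 1#0
  k!·1#0 (suc k) k<p = #0-cong (sym (×1-homo-* (suc k) (k !)))
    (x#0y#0→xy#0 (k·1#0 (suc k) k<p) (k!·1#0 k (ℕ.<-trans (ℕ.n<1+n k) k<p)))

  -- The factorials of `k` and `p ∸ k` are nonzero in `K`, being products of nonzero multiples of
  -- `1#`; times the binomial coefficient they give the factorial of `p`, which vanishes.
  -- Cancellation in the field replaces the divisibility argument for primes.
  pCk·1≈0 : ∀ k → 0 ℕ.< k → k ℕ.< p → (p C k) · 1# ≈ 0#
  pCk·1≈0 k 0<k k<p = *-zero-# {d · 1#}
    (#0-cong (sym (×1-homo-* (k !) ((p ∸ k) !)))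
      (x#0y#0→xy#0 (k!·1#0 k k<p) (k!·1#0 (p ∸ k) (ℕ.∸-monoʳ-< 0<k (ℕ.<⇒≤ k<p)))))
    (begin
      (d · 1#) * ((p C k) · 1#)   ≈⟨ *-comm _ _ ⟩
      ((p C k) · 1#) * (d · 1#)   ≈⟨ ×1-homo-* (p C k) d ⟨
      ((p C k) ℕ.* d) · 1#          ≡⟨ ≡.cong (_· 1#) C*d ⟩
      (p !) · 1#                  ≈⟨ ×1-homo-* p ((suc p-2) !) ⟩
      (p · 1#) * (((suc p-2) !) · 1#) ≈⟨ *-congʳ p·1≈0 ⟩
      0# * (((suc p-2) !) · 1#)   ≈⟨ zeroˡ _ ⟩
      0#                          ∎)
    where
    d = k ! ℕ.* (p ∸ k) !
    instance
      d≢0 : NonZero d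
      d≢0 = ℕ.m*n≢0 (k !) ((p ∸ k) !) {{k ℕ.!≢0}} {{(p ∸ k) ℕ.!≢0}}
    C*d : (p C k) ℕ.* d ≡ p !
    C*d = ≡.trans (≡.cong (ℕ._* d) (nCk≡n!/k![n-k]! (ℕ.<⇒≤ k<p))) (m/n*n≡m (k![n∸k]!∣n! (ℕ.<⇒≤ k<p)))

  frobenius : ∀ x y → (x + y) ^ p ≈ x ^ p + y ^ p
  frobenius x y = begin
    (x + y) ^ p                                   ≈⟨ binomial-theorem p x y ⟩
    term zero + sum (term ∘ suc)                  ≈⟨ +-congˡ (sum-init-last (term ∘ suc)) ⟩
    term zero + (sum (λ i → term (suc (inject₁ i))) + term (suc (fromℕ (suc p-2))))
      ≈⟨ +-cong first (+-cong (sum-zero {suc p-2} middle) last) ⟩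
    y ^ p + (0# + x ^ p)                          ≈⟨ trans (+-congˡ (+-identityˡ _)) (+-comm _ _) ⟩
    x ^ p + y ^ p                                 ∎
    where
    term = binomialTerm x y p
    first : term zero ≈ y ^ p
    first = trans (+-identityʳ _) (*-identityˡ _)
    middle : ∀ i → term (suc (inject₁ i)) ≈ 0#
    middle i = trans (·-as-* (p C suc (toℕ (inject₁ i))) _) (trans (*-congʳ
      (pCk·1≈0 (suc (toℕ (inject₁ i))) (s≤s z≤n)
        (s≤s (ℕ.≤-trans (ℕ.≤-reflexive (≡.cong suc (toℕ-inject₁ i))) (toℕ<n i))))) (zeroˡ _))
    last : term (suc (fromℕ (suc p-2))) ≈ x ^ p
    last rewrite toℕ-fromℕ p-2 | nCn≡1 p | ℕ.n∸n≡0 p-2 = trans (+-identityʳ _) (*-identityʳ _)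

  0^p≈0 : 0# ^ p ≈ 0#
  0^p≈0 = zeroˡ _

  1^ : ∀ k → 1# ^ k ≈ 1#
  1^ zero    = refl
  1^ (suc k) = trans (*-identityˡ _) (1^ k)

  frobenius-sum : ∀ {n} (f : Vector Carrier n) → sum f ^ p ≈ sum (λ i → f i ^ p)
  frobenius-sum {zero}  f = 0^p≈0
  frobenius-sum {suc n} f = trans (frobenius (f zero) (sum (f ∘ suc))) (+-congˡ (frobenius-sum (f ∘ suc)))

  fermat : ∀ k → (k · 1#) ^ p ≈ k · 1#
  fermat zero    = 0^p≈0
  fermat (suc k) = trans (frobenius 1# (k · 1#)) (+-cong (1^ p) (fermat k))

  module AdditivePolynomial (a : Carrier) (distinct : ∀ i j → i ℕ.< p → j ℕ.< p → i ≢ j → i · a # j · a) where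

    h : Carrier → Carrier
    h u = u ^ p - a ^ (p ∸ 1) * u

    h-cong : ∀ {u v} → u ≈ v → h u ≈ h v
    h-cong u≈v = +-cong (^-congˡ p u≈v) (-‿cong (*-congˡ u≈v))

    h-+ : ∀ u v → h (u + v) ≈ h u + h v
    h-+ u v = trans (+-congʳ (frobenius u v))
      (solve 5 (λ U V b u v → (U ⊕ V) ⊟ b ⊗ (u ⊕ v) ⊜ (U ⊟ b ⊗ u) ⊕ (V ⊟ b ⊗ v)) refl (u ^ p) (v ^ p) (a ^ (p ∸ 1)) u v)

    h-0 : h 0# ≈ 0#
    h-0 = trans (+-cong 0^p≈0 (trans (-‿cong (zeroʳ _)) -0#≈0#)) (+-identityˡ 0#)

    h-neg : ∀ u → h (- u) ≈ - h u
    h-neg u = trans (solve 2 (λ x y → x ⊜ (y ⊕ x) ⊟ y) refl (h (- u)) (h u))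
      (trans (+-congʳ (trans (sym (h-+ u (- u))) (trans (h-cong (-‿inverseʳ u)) h-0))) (+-identityˡ _))

    h-minus : ∀ u v → h (u - v) ≈ h u - h v
    h-minus u v = trans (h-+ u (- v)) (+-congˡ (h-neg v))

    h-multiple : ∀ k → h (k · a) ≈ 0#
    h-multiple k = ≈⇒-≈0 (begin
      (k · a) ^ p                    ≈⟨ ^-congˡ p (·-as-* k a) ⟩
      ((k · 1#) * a) ^ p             ≈⟨ ^-distrib-* (k · 1#) a p ⟩
      (k · 1#) ^ p * a ^ p           ≈⟨ *-congʳ (fermat k) ⟩
      (k · 1#) * (a * a ^ (p ∸ 1))   ≈⟨ solve 3 (λ k a b → k ⊗ (a ⊗ b) ⊜ b ⊗ (k ⊗ a)) refl (k · 1#) a (a ^ (p ∸ 1)) ⟩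
      a ^ (p ∸ 1) * ((k · 1#) * a)   ≈⟨ *-congˡ (·-as-* k a) ⟨
      a ^ (p ∸ 1) * (k · a)          ∎)

    -- Both sides are monic of degree `p` and vanish at the `p` distinct points `- j a`, so their
    -- difference has too many roots for its degree.
    h-product : ∀ u → h u ≈ product {p} (λ j → u + toℕ j · a)
    h-product u = sym (-≈0⇒≈ (begin
      product {p} (λ j → u + toℕ j · a) - h u
        ≈⟨ +-cong (linear u) (-‿cong (sparse u)) ⟨
      value 1# L u - value 1# H u
        ≈⟨ solve 2 (λ x y → x ⊟ y ⊜ 𝟏 ⊗ x ⊕ ⊝ 𝟏 ⊗ y) refl (value 1# L u) (value 1# H u) ⟩
      1# * value 1# L u + - 1# * value 1# H u
        ≈⟨ difference u ⟨
      value 0# D u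
        ≈⟨ too-many-roots D (λ i → - (toℕ i · a)) roots-distinct roots u ⟩
      0# ∎))
      where
      L H D : Vec Carrier (p ℕ.+ 0)
      L = mulLinears {p} (λ j → toℕ j · a) []
      H = 0# ∷ - a ^ (p ∸ 1) ∷ replicate (p-2 ℕ.+ 0) 0#
      D = zipWith (λ c d → 1# * c + - 1# * d) L H
      linear : ∀ u → value 1# L u ≈ product {p} (λ j → u + toℕ j · a)
      linear u = trans (monic-mulLinears {p} (λ j → toℕ j · a) [] u) (*-identityʳ _)
      power : ∀ k u → value 1# (replicate k 0#) u ≈ u ^ k
      power zero    u = refl
      power (suc k) u = trans (+-identityˡ _) (*-congˡ (power k u))
      sparse : ∀ u → value 1# H u ≈ h u
      sparse u = begin
        0# + u * (- a ^ (p ∸ 1) + u * value 1# (replicate (p-2 ℕ.+ 0) 0#) u)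
          ≈⟨ +-congˡ (*-congˡ (+-congˡ (*-congˡ (trans (power (p-2 ℕ.+ 0) u) (reflexive (≡.cong (u ^_) (ℕ.+-identityʳ p-2))))))) ⟩
        0# + u * (- a ^ (p ∸ 1) + u * u ^ p-2)
          ≈⟨ solve 3 (λ u b w → 𝟎 ⊕ u ⊗ (⊝ b ⊕ u ⊗ w) ⊜ u ⊗ (u ⊗ w) ⊟ b ⊗ u) refl u (a ^ (p ∸ 1)) (u ^ p-2) ⟩
        h u ∎
      difference : ∀ u → value 0# D u ≈ 1# * value 1# L u + - 1# * value 1# H u
      difference = horner-linear 1# (- 1#) 1# 1# (solve 0 (𝟎 ⊜ 𝟏 ⊗ 𝟏 ⊕ ⊝ 𝟏 ⊗ 𝟏) refl) L H
      below : ∀ (i : Fin (p ℕ.+ 0)) → toℕ i ℕ.< p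
      below i = ℕ.<-≤-trans (toℕ<n i) (ℕ.≤-reflexive (ℕ.+-identityʳ p))
      roots-distinct : ∀ i j → i ≢ j → - (toℕ i · a) # - (toℕ j · a)
      roots-distinct i j i≢j = ≉⇒# λ eq → #⇒≉ (distinct (toℕ i) (toℕ j) (below i) (below j) (i≢j ∘ Fin.toℕ-injective))
        (trans (sym (-‿involutive _)) (trans (-‿cong eq) (-‿involutive _)))
      roots : ∀ i → value 0# D (- (toℕ i · a)) ≈ 0#
      roots i = trans (difference r) (trans (+-cong (trans (*-identityˡ _) (trans (linear r) vanishes))
        (trans (*-congˡ (trans (sparse r) (trans (h-neg (toℕ i · a)) (trans (-‿cong (h-multiple (toℕ i))) -0#≈0#)))) (zeroʳ _)))
        (+-identityˡ 0#))
        where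
        r = - (toℕ i · a)
        vanishes : product {p} (λ j → r + toℕ j · a) ≈ 0#
        vanishes = product-zero {p} {λ j → r + toℕ j · a} (fromℕ< (below i))
          (trans (+-congˡ (reflexive (≡.cong (_· a) (toℕ-fromℕ< (below i))))) (-‿inverseˡ _))

-- Eigenvectors and bases in coordinate spaces

module LinearAlgebra {c ℓ₁ ℓ₂} (em : ExcludedMiddle (c ⊔ ℓ₁ ⊔ ℓ₂)) (K : HeytingField c ℓ₁ ℓ₂) where

  open FieldBase em K
  open import Relation.Binary.Reasoning.Setoid setoid

  combination : ∀ {N n} → Vector Carrier N → (Fin N → Vector Carrier n) → Vector Carrier n
  combination t V k = sum λ i → t i * V i k

  -- Combinations of arbitrary length are allowed so that an operator can be applied to all `p`
  -- summands of `J` at once; the empty combination yields that zero goes to zero.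
  record IsLinear {n} (T : Vector Carrier n → Vector Carrier n) : Set (c ⊔ ℓ₁) where
    field
      cong        : ∀ {v w} → (∀ k → v k ≈ w k) → ∀ k → T v k ≈ T w k
      combination-homo : ∀ {N} t (V : Fin N → Vector Carrier n) k → T (combination t V) k ≈ combination t (T ∘ V) k

  open IsLinear public

  -- Applying `T - μ zero` to a relation removes the first eigenvector and multiplies the other
  -- coefficients by nonzero numbers, which leaves a shorter relation.
  eigenvectors-independent : ∀ {n} {T : Vector Carrier n → Vector Carrier n} → IsLinear T →
    ∀ {N} (v : Fin N → Vector Carrier n) (μ : Fin N → Carrier) → (∀ i j → i ≢ j → μ i # μ j) →
    (∀ i k → T (v i) k ≈ μ i * v i k) → (∀ i → NonZeroVector (v i)) → LinearlyIndependent v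
  eigenvectors-independent {T = T} linear {suc N} v μ distinct eigen nonzero t t·v≈0 = t≈0
    where
    tail≈0 : ∀ k → combination (λ i → t (suc i) * (μ (suc i) - μ zero)) (v ∘ suc) k ≈ 0#
    tail≈0 k = begin
      sum f                                            ≈⟨ +-identityˡ _ ⟨
      0# + sum f                                       ≈⟨ +-congʳ head≈0 ⟨
      t zero * (μ zero - μ zero) * v zero k + sum f    ≈⟨ sum-cong {suc N} (λ i →
        solve 4 (λ t m m₀ v → t ⊗ (m ⊟ m₀) ⊗ v ⊜ 𝟏 ⊗ (t ⊗ (m ⊗ v)) ⊕ ⊝ m₀ ⊗ (t ⊗ v)) refl (t i) (μ i) (μ zero) (v i k)) ⟩
      sum (λ i → 1# * (t i * (μ i * v i k)) + - μ zero * (t i * v i k))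
        ≈⟨ ∑-combine {suc N} 1# (- μ zero) (λ i → t i * (μ i * v i k)) (λ i → t i * v i k) ⟩
      1# * sum (λ i → t i * (μ i * v i k)) + - μ zero * combination t v k
        ≈⟨ +-cong (*-congˡ image≈0) (*-congˡ (t·v≈0 k)) ⟩
      1# * 0# + - μ zero * 0#                          ≈⟨ trans (+-cong (zeroʳ _) (zeroʳ _)) (+-identityˡ 0#) ⟩
      0# ∎
      where
      f : Fin N → Carrier
      f i = t (suc i) * (μ (suc i) - μ zero) * v (suc i) k
      head≈0 : t zero * (μ zero - μ zero) * v zero k ≈ 0#
      head≈0 = solve 3 (λ t m v → t ⊗ (m ⊟ m) ⊗ v ⊜ 𝟎) refl (t zero) (μ zero) (v zero k)
      image≈0 : sum (λ i → t i * (μ i * v i k)) ≈ 0#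
      image≈0 = begin
        sum (λ i → t i * (μ i * v i k))   ≈⟨ sum-cong {suc N} (λ i → *-congˡ {t i} (eigen i k)) ⟨
        combination t (T ∘ v) k           ≈⟨ combination-homo linear t v k ⟨
        T (combination t v) k             ≈⟨ cong linear t·v≈0 k ⟩
        T (combination Vector.[] (λ ())) k ≈⟨ combination-homo linear Vector.[] (λ ()) k ⟩
        0#                                ∎
    suc≈0 : ∀ i → t (suc i) ≈ 0#
    suc≈0 i = *-zero-# (≉⇒# λ eq → #⇒≉ (distinct (suc i) zero λ ()) (-≈0⇒≈ eq)) (trans (*-comm _ _)
      (eigenvectors-independent linear (v ∘ suc) (μ ∘ suc) (λ i j i≢j → distinct (suc i) (suc j) (i≢j ∘ suc-injective))
        (eigen ∘ suc) (nonzero ∘ suc) (λ i → t (suc i) * (μ (suc i) - μ zero)) tail≈0 i))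
    t≈0 : ∀ i → t i ≈ 0#
    t≈0 (suc i) = suc≈0 i
    t≈0 zero    = *-zero-# (proj₂ (nonzero zero)) (begin
      v zero k * t zero                 ≈⟨ *-comm _ _ ⟩
      t zero * v zero k                 ≈⟨ +-identityʳ _ ⟨
      t zero * v zero k + 0#            ≈⟨ +-congˡ (sum-zero {N} (λ i → trans (*-congʳ (suc≈0 i)) (zeroˡ _))) ⟨
      combination t v k                 ≈⟨ t·v≈0 k ⟩
      0#                                ∎)
      where k = proj₁ (nonzero zero)

  dependent : ∀ {N} (v : Fin (suc N) → Vector Carrier N) →
    ∃ λ t → (∃ λ i → t i # 0#) × (∀ k → combination t v k ≈ 0#)
  dependent {zero}  v = (λ _ → 1#) , (zero , 1#0) , λ ()
  dependent {suc N} v = eliminate (any? λ k → #0? (v zero k))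
    where
    eliminate : Dec (∃ λ k → v zero k # 0#) → ∃ λ t → (∃ λ i → t i # 0#) × (∀ k → combination t v k ≈ 0#)
    eliminate (no v₀≈0) = (1# Vector.∷ λ _ → 0#) , (zero , 1#0) , λ k →
      trans (+-cong (trans (*-identityˡ _) (vanishes k)) (sum-zero {suc N} (λ i → zeroˡ (v (suc i) k)))) (+-identityˡ 0#)
      where
      vanishes : ∀ k → v zero k ≈ 0#
      vanishes k with v zero k ≟ 0#
      ... | yes eq = eq
      ... | no neq = ⊥-elim (v₀≈0 (k , ≉⇒# neq))
    eliminate (yes (k₀ , pivot#0)) = t , (suc (proj₁ (proj₁ (proj₂ reduced))) , proj₂ (proj₁ (proj₂ reduced))) , vanishes
      where
      r : Fin (suc N) → Carrier
      r j = v (suc j) k₀ / v zero k₀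
      v′ : Fin (suc N) → Vector Carrier (suc N)
      v′ j k = v (suc j) k - r j * v zero k
      reduced = dependent (λ j l → v′ j (punchIn k₀ l))
      t′ = proj₁ reduced
      t : Vector Carrier (suc (suc N))
      t = (- sum (λ j → t′ j * r j)) Vector.∷ t′
      reduce : ∀ k → combination t v k ≈ combination t′ v′ k
      reduce k = begin
        - sum s * v zero k + sum w
          ≈⟨ solve 3 (λ s v w → ⊝ s ⊗ v ⊕ w ⊜ 𝟏 ⊗ w ⊕ ⊝ v ⊗ s) refl (sum s) (v zero k) (sum w) ⟩
        1# * sum w + - v zero k * sum s
          ≈⟨ ∑-combine {suc N} 1# (- v zero k) w s ⟨
        sum (λ j → 1# * w j + - v zero k * s j)
          ≈⟨ sum-cong {suc N} (λ j → solve 4 (λ t x r v → 𝟏 ⊗ (t ⊗ x) ⊕ ⊝ v ⊗ (t ⊗ r) ⊜ t ⊗ (x ⊟ r ⊗ v)) refl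
               (t′ j) (v (suc j) k) (r j) (v zero k)) ⟩
        combination t′ v′ k ∎
        where
        s w : Fin (suc N) → Carrier
        s j = t′ j * r j
        w j = t′ j * v (suc j) k
      vanishes : ∀ k → combination t v k ≈ 0#
      vanishes k with k₀ Fin.≟ k
      ... | yes ≡.refl = trans (reduce k₀) (sum-zero {suc N} (λ j → trans (*-congˡ {t′ j} (≈⇒-≈0 {v (suc j) k₀} (sym
                (trans (*-comm (r j) (v zero k₀)) (/-cancel pivot#0))))) (zeroʳ (t′ j))))
      ... | no  k₀≢k   = trans (reduce k) (trans (sum-cong {suc N} (λ j → *-congˡ {t′ j} (reflexive
                (≡.cong (v′ j) (≡.sym (punchIn-punchOut k₀≢k)))))) (proj₂ (proj₂ reduced) (punchOut k₀≢k)))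

  -- A relation among `w` and the independent vectors must involve `w`, so it can be solved for `w`.
  independent⇒spanning : ∀ {n} (v : Fin n → Vector Carrier n) → LinearlyIndependent v → Spanning v
  independent⇒spanning {n} v independent w = s , spans
    where
    relation = dependent (w Vector.∷ v)
    t = proj₁ relation
    t·≈0 = proj₂ (proj₂ relation)
    t₀#0 : t zero # 0#
    t₀#0 = ≉⇒# λ t₀≈0 →
      let rest≈0 = independent (t ∘ suc) (λ k → trans
            (sym (trans (+-congʳ (trans (*-congʳ t₀≈0) (zeroˡ (w k)))) (+-identityˡ _))) (t·≈0 k))
      in nontrivial t₀≈0 rest≈0 (proj₁ (proj₂ relation))
      where
      nontrivial : t zero ≈ 0# → (∀ i → t (suc i) ≈ 0#) → ¬ ∃ λ i → t i # 0#
      nontrivial t₀≈0 rest≈0 (zero , t#0)  = #⇒≉ t#0 t₀≈0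
      nontrivial t₀≈0 rest≈0 (suc i , t#0) = #⇒≉ t#0 (rest≈0 i)
    i = - ((t zero) ⁻¹)
    s : Fin n → Carrier
    s j = i * t (suc j)
    spans : ∀ k → combination s v k ≈ w k
    spans k = begin
      combination s v k
        ≈⟨ sum-cong {n} (λ j → *-assoc i (t (suc j)) (v j k)) ⟩
      sum (λ j → i * (t (suc j) * v j k))
        ≈⟨ *-distribˡ-sum i (λ j → t (suc j) * v j k) ⟨
      i * S
        ≈⟨ solve 4 (λ z t w S → ⊝ z ⊗ S ⊜ (z ⊗ t) ⊗ w ⊟ z ⊗ (t ⊗ w ⊕ S)) refl ((t zero) ⁻¹) (t zero) (w k) S ⟩
      ((t zero) ⁻¹ * t zero) * w k - (t zero) ⁻¹ * (t zero * w k + S)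
        ≈⟨ +-cong (*-congʳ (⁻¹-inverseˡ t₀#0)) (-‿cong (trans (*-congˡ (t·≈0 k)) (zeroʳ _))) ⟩
      1# * w k - 0#
        ≈⟨ trans (+-cong (*-identityˡ _) -0#≈0#) (+-identityʳ _) ⟩
      w k ∎
      where S = combination (t ∘ suc) v k

-- Linearity of the qKZ operators

module Transport {c ℓ₁ ℓ₂} (em : ExcludedMiddle (c ⊔ ℓ₁ ⊔ ℓ₂)) (K : HeytingField c ℓ₁ ℓ₂)
  (p : ℕ) {n : ℕ} (Λ : Vector (HeytingField.Carrier K) n) (a : HeytingField.Carrier K) where

  open FieldBase em K
  open LinearAlgebra em K
  open QKZ p Λ a
  open import Relation.Binary.Reasoning.Setoid setoid

  -- Omits one factor of a product while keeping the index set `Fin n`.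
  mask : ∀ {n} → Fin n → Vector Carrier n → Vector Carrier n
  mask j f l = if does (l Fin.≟ j) then 1# else f l

  mask-≢ : ∀ {n} {j l : Fin n} (f : Vector Carrier n) → l ≢ j → mask j f l ≡ f l
  mask-≢ {j = j} {l} f l≢j rewrite dec-false (l Fin.≟ j) l≢j = ≡.refl

  mask-cong : ∀ {n} {j : Fin n} (f g : Vector Carrier n) l → (l ≢ j → f l ≈ g l) → mask j f l ≈ mask j g l
  mask-cong {j = j} f g l f≈g with l Fin.≟ j
  ... | yes _   = refl
  ... | no  l≢j = f≈g l≢j

  mask-comm : ∀ {n} (i j : Fin n) (f : Vector Carrier n) l → mask i (mask j f) l ≡ mask j (mask i f) l
  mask-comm i j f l with does (l Fin.≟ i) | does (l Fin.≟ j)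
  ... | true  | true  = ≡.refl
  ... | true  | false = ≡.refl
  ... | false | true  = ≡.refl
  ... | false | false = ≡.refl

  product-mask : ∀ {n} (j : Fin n) f → product f ≈ f j * product (mask j f)
  product-mask zero    f = *-congˡ (sym (*-identityˡ _))
  product-mask (suc j) f = begin
    f zero * product (f ∘ suc)
      ≈⟨ *-congˡ (product-mask j (f ∘ suc)) ⟩
    f zero * (f (suc j) * product (mask j (f ∘ suc)))
      ≈⟨ solve 3 (λ x y z → x ⊗ (y ⊗ z) ⊜ y ⊗ (x ⊗ z)) refl (f zero) (f (suc j)) (product (mask j (f ∘ suc))) ⟩
    f (suc j) * product (mask (suc j) f) ∎

  R-at₁ : ∀ {i j} u v → i ≢ j → R i j u v i ≡ ((u - Λ i + Λ j) * v i - Λ j * v j) / (u - Λ i)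
  R-at₁ {i} {j} u v i≢j = ≡.trans (updateAt-minimal i j _ i≢j) (updateAt-updates i v)

  R-at₂ : ∀ i j u v → R i j u v j ≡ (u * v j - Λ i * v i) / (u - Λ i)
  R-at₂ i j u v = updateAt-updates j _

  R-other : ∀ {i j k} u v → k ≢ i → k ≢ j → R i j u v k ≡ v k
  R-other {i} {j} {k} u v k≢i k≢j = ≡.trans (updateAt-minimal k j _ k≢j) (updateAt-minimal k i v k≢i)

  two-term : ∀ {N} x y z (t f g : Vector Carrier N) →
    (x * sum (λ i → t i * f i) - y * sum (λ i → t i * g i)) / z ≈ sum (λ i → t i * ((x * f i - y * g i) / z))
  two-term {N} x y z t f g = begin
    (x * sum (λ i → t i * f i) - y * sum (λ i → t i * g i)) * z ⁻¹
      ≈⟨ solve 5 (λ x y w f g → (x ⊗ f ⊟ y ⊗ g) ⊗ w ⊜ (x ⊗ w) ⊗ f ⊕ (⊝ (y ⊗ w)) ⊗ g) refl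
           x y (z ⁻¹) (sum (λ i → t i * f i)) (sum (λ i → t i * g i)) ⟩
    (x * z ⁻¹) * sum (λ i → t i * f i) + - (y * z ⁻¹) * sum (λ i → t i * g i)
      ≈⟨ ∑-combine (x * z ⁻¹) (- (y * z ⁻¹)) (λ i → t i * f i) (λ i → t i * g i) ⟨
    sum (λ i → (x * z ⁻¹) * (t i * f i) + - (y * z ⁻¹) * (t i * g i))
      ≈⟨ sum-cong {N} (λ i → solve 6 (λ x y w t f g →
           (x ⊗ w) ⊗ (t ⊗ f) ⊕ (⊝ (y ⊗ w)) ⊗ (t ⊗ g) ⊜ t ⊗ ((x ⊗ f ⊟ y ⊗ g) ⊗ w)) refl x y (z ⁻¹) (t i) (f i) (g i)) ⟩
    sum (λ i → t i * ((x * f i - y * g i) / z)) ∎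

  -- In `R` the update at `j` is the outer one and prevails if `i` and `j` coincide, so `j` is
  -- tested first.
  R-cases : ∀ {ℓ} (i j k : Fin n) (P : Set ℓ) → (k ≡ j → P) → (k ≡ i → i ≢ j → P) → (k ≢ i → k ≢ j → P) → P
  R-cases i j k P at-j at-i other with k Fin.≟ j | k Fin.≟ i
  ... | yes k≡j | _        = at-j k≡j
  ... | no  k≢j | yes ≡.refl = at-i ≡.refl k≢j
  ... | no  k≢j | no  k≢i  = other k≢i k≢j

  R-linear : ∀ i j u → IsLinear (R i j u)
  R-linear i j u .cong {v} {w} v≈w k = R-cases i j k _
    (λ where ≡.refl → trans (reflexive (R-at₂ i j u v))
               (trans (*-congʳ (+-cong (*-congˡ (v≈w j)) (-‿cong (*-congˡ (v≈w i))))) (reflexive (≡.sym (R-at₂ i j u w)))))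
    (λ where ≡.refl i≢j → trans (reflexive (R-at₁ u v i≢j))
               (trans (*-congʳ (+-cong (*-congˡ (v≈w i)) (-‿cong (*-congˡ (v≈w j))))) (reflexive (≡.sym (R-at₁ u w i≢j)))))
    (λ k≢i k≢j → trans (reflexive (R-other u v k≢i k≢j)) (trans (v≈w k) (reflexive (≡.sym (R-other u w k≢i k≢j)))))
  R-linear i j u .combination-homo {N} t V k = R-cases i j k _
    (λ where ≡.refl → trans (reflexive (R-at₂ i j u (combination t V)))
               (trans (two-term u (Λ i) (u - Λ i) t (λ l → V l j) (λ l → V l i))
                 (sum-cong {N} λ l → *-congˡ {t l} (reflexive (≡.sym (R-at₂ i j u (V l)))))))
    (λ where ≡.refl i≢j → trans (reflexive (R-at₁ u (combination t V) i≢j))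
               (trans (two-term (u - Λ i + Λ j) (Λ j) (u - Λ i) t (λ l → V l i) (λ l → V l j))
                 (sum-cong {N} λ l → *-congˡ {t l} (reflexive (≡.sym (R-at₁ u (V l) i≢j))))))
    (λ k≢i k≢j → trans (reflexive (R-other u (combination t V) k≢i k≢j))
                 (sum-cong {N} λ l → *-congˡ {t l} (reflexive (≡.sym (R-other u (V l) k≢i k≢j)))))

  id-linear : IsLinear {n} id
  id-linear .cong v≈w = v≈w
  id-linear .combination-homo t V k = refl

  ∘-linear : ∀ {S T : V → V} → IsLinear S → IsLinear T → IsLinear (S ∘ T)
  ∘-linear S-lin T-lin .cong v≈w = S-lin .cong (T-lin .cong v≈w)
  ∘-linear {S} {T} S-lin T-lin .combination-homo t V k =
    trans (S-lin .cong (T-lin .combination-homo t V) k) (S-lin .combination-homo t (T ∘ V) k)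

  foldl-linear : ∀ {T : Fin n → V → V} → (∀ j → IsLinear (T j)) → ∀ js → IsLinear (λ v → foldl (λ w j → T j w) v js)
  foldl-linear T-lin []       = id-linear
  foldl-linear T-lin (j ∷ js) = ∘-linear (foldl-linear T-lin js) (T-lin j)

  twist-linear : ∀ κ m → IsLinear (λ (w : V) → updateAt w m (κ *_))
  twist-linear κ m .cong {v} {w} v≈w k with k Fin.≟ m
  ... | yes ≡.refl = trans (reflexive (updateAt-updates m v)) (trans (*-congˡ (v≈w m)) (reflexive (≡.sym (updateAt-updates m w))))
  ... | no  k≢m = trans (reflexive (updateAt-minimal k m v k≢m)) (trans (v≈w k) (reflexive (≡.sym (updateAt-minimal k m w k≢m))))
  twist-linear κ m .combination-homo {N} t V k with k Fin.≟ m
  ... | no  k≢m = trans (reflexive (updateAt-minimal k m (combination t V) k≢m))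
          (sum-cong {N} λ l → *-congˡ {t l} (reflexive (≡.sym (updateAt-minimal k m (V l) k≢m))))
  ... | yes ≡.refl = trans (reflexive (updateAt-updates m (combination t V)))
          (trans (*-distribˡ-sum {N} κ (λ l → t l * V l m)) (sum-cong {N} λ l →
            trans (solve 3 (λ k t v → k ⊗ (t ⊗ v) ⊜ t ⊗ (k ⊗ v)) refl κ (t l) (V l m))
                  (*-congˡ {t l} (reflexive (≡.sym (updateAt-updates m (V l)))))))

  module _ (m : Fin n) (x : Vector Carrier n) where

    above below : List (Fin n)
    above = filter (λ j → m Fin.<? j) (allFin n)
    below = filter (λ j → j Fin.<? m) (allFin n)

    Upper Lower : V → V
    Upper v = foldl (λ w j → R m j (x m - x j) w) v above
    Lower v = foldl (λ w j → R m j (x m - x j + a) w) v below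

    Upper-linear : IsLinear Upper
    Upper-linear = foldl-linear (λ j → R-linear m j (x m - x j)) above

    Lower-linear : IsLinear Lower
    Lower-linear = foldl-linear (λ j → R-linear m j (x m - x j + a)) below

  qKZ-linear : ∀ κ m x → IsLinear (qKZ κ m x)
  qKZ-linear κ m x = ∘-linear (Lower-linear m x) (∘-linear (twist-linear κ m) (Upper-linear m x))

  qKZ-iterate-linear : ∀ d κ m x → IsLinear (qKZ-iterate d κ m x)
  qKZ-iterate-linear zero    κ m x = id-linear
  qKZ-iterate-linear (suc d) κ m x = ∘-linear (qKZ-linear κ m (shift x m (d · a))) (qKZ-iterate-linear d κ m x)

  homogeneous : ∀ {T : V → V} → IsLinear T → ∀ t v k → T (λ k → t * v k) k ≈ t * T v k
  homogeneous {T} T-lin t v k = begin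
    T (λ k → t * v k) k                             ≈⟨ T-lin .cong (λ k → sym (+-identityʳ _)) k ⟩
    T (combination {1} (λ _ → t) (λ _ → v)) k       ≈⟨ T-lin .combination-homo {1} (λ _ → t) (λ _ → v) k ⟩
    t * T v k + 0#                                  ≈⟨ +-identityʳ _ ⟩
    t * T v k                                       ∎

  -- Moving one tensor factor through the ordering

  <ᵇ-true : ∀ {i j} → i ℕ.< j → (i <ᵇ j) ≡ true
  <ᵇ-true {i} {j} i<j = dec-true (i ℕ.<? j) i<j

  <ᵇ-false : ∀ {i j} → j ℕ.≤ i → (i <ᵇ j) ≡ false
  <ᵇ-false {i} {j} j≤i = dec-false (i ℕ.<? j) (ℕ.≤⇒≯ j≤i)

  <ᵇ-suc : ∀ {i j} → i ≢ j → (i <ᵇ suc j) ≡ (i <ᵇ j)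
  <ᵇ-suc {i} {j} i≢j with ℕ.<-cmp i j
  ... | tri< i<j _ _ = ≡.trans (<ᵇ-true (ℕ.m<n⇒m<1+n i<j)) (≡.sym (<ᵇ-true i<j))
  ... | tri≈ _ i≡j _ = ⊥-elim (i≢j i≡j)
  ... | tri> _ _ j<i = ≡.trans (<ᵇ-false j<i) (≡.sym (<ᵇ-false (ℕ.<⇒≤ j<i)))

  toℕ-≢ : ∀ {n} {i j : Fin n} → i ≢ j → toℕ i ≢ toℕ j
  toℕ-≢ i≢j eq = i≢j (toℕ-injective eq)

  -- The invariant is indexed by the position in all of `allFin n`, so that it can describe the
  -- progress by a threshold; the skipped indices must preserve it too.
  filtered-fold : ∀ {ℓ ℓ′} {P : Fin n → Set ℓ} (P? : ∀ j → Dec (P j)) (step : V → Fin n → V) (Inv : ℕ → V → Set ℓ′) →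
    (∀ j v → P j → Inv (toℕ j) v → Inv (suc (toℕ j)) (step v j)) →
    (∀ j v → ¬ P j → Inv (toℕ j) v → Inv (suc (toℕ j)) v) →
    ∀ v → Inv 0 v → Inv n (foldl step v (filter P? (allFin n)))
  filtered-fold P? step Inv hit miss v₀ inv₀ = go n id 0 (λ _ → ≡.refl) v₀ inv₀
    where
    -- `f` enumerates the `k` indices still to be visited, which start at `o`.
    go : ∀ k (f : Fin k → Fin n) o → (∀ i → toℕ (f i) ≡ o ℕ.+ toℕ i) → ∀ v → Inv o v →
         Inv (o ℕ.+ k) (foldl step v (filter P? (tabulate f)))
    go zero    f o f≡ v inv rewrite ℕ.+-identityʳ o = inv
    go (suc k) f o f≡ v inv rewrite ℕ.+-suc o k with P? (f zero)
    ... | yes P-f = go k (f ∘ suc) (suc o) (λ i → ≡.trans (f≡ (suc i)) (ℕ.+-suc o (toℕ i))) (step v (f zero))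
            (≡.subst (λ t → Inv (suc t) (step v (f zero))) f₀≡ (hit (f zero) v P-f (≡.subst (λ t → Inv t v) (≡.sym f₀≡) inv)))
      where f₀≡ = ≡.trans (f≡ zero) (ℕ.+-identityʳ o)
    ... | no ¬P-f = go k (f ∘ suc) (suc o) (λ i → ≡.trans (f≡ (suc i)) (ℕ.+-suc o (toℕ i))) v
            (≡.subst (λ t → Inv (suc t) v) f₀≡ (miss (f zero) v ¬P-f (≡.subst (λ t → Inv t v) (≡.sym f₀≡) inv)))
      where f₀≡ = ≡.trans (f≡ zero) (ℕ.+-identityʳ o)

  -- The weight function of the ordering in which m is moved behind the
  -- positions l with B l, the others keeping their order; α and β stand for
  -- s - x + Λ and s - x.
  module Reordered (m : Fin n) (α β : Vector Carrier n) where

    pick : (Fin n → Bool) → Vector Carrier n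
    pick B l = if B l then α l else β l

    before : Fin n → Fin n → Bool
    before k l = toℕ l <ᵇ toℕ k

    others : Fin n → Carrier
    others k = product (mask m (mask k (pick (before k))))

    weight : (Fin n → Bool) → V
    weight B k = if does (k Fin.≟ m) then product (mask m (pick B)) else (if B k then β m else α m) * others k

    weight-m : ∀ B → weight B m ≡ product (mask m (pick B))
    weight-m B rewrite dec-true (m Fin.≟ m) ≡.refl = ≡.refl

    weight-≢ : ∀ B {k} → k ≢ m → weight B k ≡ (if B k then β m else α m) * others k
    weight-≢ B {k} k≢m rewrite dec-false (k Fin.≟ m) k≢m = ≡.refl

    pick-≡ : ∀ B B′ l → B l ≡ B′ l → pick B l ≈ pick B′ l
    pick-≡ B B′ l eq rewrite eq = refl

    weight-cong : ∀ {B B′} → (∀ l → l ≢ m → B l ≡ B′ l) → ∀ k → weight B k ≈ weight B′ k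
    weight-cong {B} {B′} B≡B′ k with k Fin.≟ m
    ... | yes _   = product-cong λ l → mask-cong (pick B) (pick B′) l λ l≢m → pick-≡ B B′ l (B≡B′ l l≢m)
    ... | no  k≢m rewrite B≡B′ k k≢m = refl

    -- The last hypothesis says that `m` is adjacent to `j` in the ordering: every other position
    -- lies on the same side of both. Hence all factors but one agree with those of component `j`.
    weight-at-m : ∀ B {j b} → j ≢ m → B j ≡ b → (∀ l → l ≢ m → l ≢ j → B l ≡ before j l) →
                  weight B m ≈ (if b then α j else β j) * others j
    weight-at-m B {j} j≢m ≡.refl B≡before = begin
      weight B m                                             ≡⟨ weight-m B ⟩
      product (mask m (pick B))                              ≈⟨ product-mask j (mask m (pick B)) ⟩
      mask m (pick B) j * product (mask j (mask m (pick B))) ≈⟨ *-cong (reflexive (mask-≢ (pick B) j≢m)) (product-cong λ l →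
        trans (reflexive (mask-comm j m (pick B) l)) (mask-cong (mask j (pick B)) (mask j (pick (before j))) l λ l≢m → mask-cong (pick B) (pick (before j)) l λ l≢j → lemma l l≢m l≢j)) ⟩
      pick B j * others j                                    ∎
      where
      lemma : ∀ l → l ≢ m → l ≢ j → pick B l ≈ pick (before j) l
      lemma l l≢m l≢j = pick-≡ B (before j) l (B≡before l l≢m l≢j)

    -- The exchange relation of weight functions: `R` moves `m` from just before `j` to just after
    -- it. Only the components at `m` and `j` change; the common factor `others j` comes out and an
    -- identity in the remaining linear factors is left in each.
    weight-step : (∀ l → α l ≈ β l + Λ l) → ∀ {u j B B′} → u ≈ β j - β m → u - Λ m # 0# → j ≢ m →
      B j ≡ false → (∀ l → l ≢ m → l ≢ j → B l ≡ before j l) →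
      B′ j ≡ true → (∀ l → l ≢ m → l ≢ j → B′ l ≡ B l) →
      ∀ k → R m j u (weight B) k ≈ weight B′ k
    weight-step α≈ {u} {j} {B} {B′} u≈ u#Λ j≢m Bj Bl B′j B′l k = R-cases m j k _
      (λ where ≡.refl → trans (reflexive (R-at₂ m j u (weight B))) (trans (/-unique u#Λ (begin
                 u * weight B j - Λ m * weight B m
                   ≈⟨ +-cong (*-cong u≈ wBj) (-‿cong (*-congˡ wBm)) ⟩
                 (β j - β m) * ((β m + Λ m) * others j) - Λ m * (β j * others j)
                   ≈⟨ solve 4 (λ bj bm L o → (bj ⊟ bm) ⊗ ((bm ⊕ L) ⊗ o) ⊟ L ⊗ (bj ⊗ o) ⊜ ((bj ⊟ bm) ⊟ L) ⊗ (bm ⊗ o)) refl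
                        (β j) (β m) (Λ m) (others j) ⟩
                 ((β j - β m) - Λ m) * (β m * others j)
                   ≈⟨ *-congʳ (+-congʳ u≈) ⟨
                 (u - Λ m) * (β m * others j) ∎)) (sym wB′j)))
      (λ where ≡.refl _ → trans (reflexive (R-at₁ u (weight B) (j≢m ∘ ≡.sym))) (trans (/-unique u#Λ (begin
                 (u - Λ m + Λ j) * weight B m - Λ j * weight B j
                   ≈⟨ +-cong (*-cong (+-congʳ (+-congʳ u≈)) wBm) (-‿cong (*-congˡ wBj)) ⟩
                 (β j - β m - Λ m + Λ j) * (β j * others j) - Λ j * ((β m + Λ m) * others j)
                   ≈⟨ solve 5 (λ bj bm L L′ o → (bj ⊟ bm ⊟ L ⊕ L′) ⊗ (bj ⊗ o) ⊟ L′ ⊗ ((bm ⊕ L) ⊗ o) ⊜ ((bj ⊟ bm) ⊟ L) ⊗ ((bj ⊕ L′) ⊗ o)) refl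
                        (β j) (β m) (Λ m) (Λ j) (others j) ⟩
                 ((β j - β m) - Λ m) * ((β j + Λ j) * others j)
                   ≈⟨ *-cong (+-congʳ u≈) (*-congʳ (α≈ j)) ⟨
                 (u - Λ m) * (α j * others j) ∎)) (sym wB′m)))
      (λ k≢m k≢j → trans (reflexive (R-other u (weight B) k≢m k≢j)) (unchanged k≢m k≢j))
      where
      wBm : weight B m ≈ β j * others j
      wBm = weight-at-m B j≢m Bj Bl
      wB′m : weight B′ m ≈ α j * others j
      wB′m = weight-at-m B′ j≢m B′j λ l l≢m l≢j → ≡.trans (B′l l l≢m l≢j) (Bl l l≢m l≢j)
      wBj : weight B j ≈ (β m + Λ m) * others j
      wBj = trans (reflexive (≡.trans (weight-≢ B j≢m) (≡.cong (λ b → (if b then β m else α m) * others j) Bj)))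
                  (*-congʳ (α≈ m))
      wB′j : weight B′ j ≈ β m * others j
      wB′j = reflexive (≡.trans (weight-≢ B′ j≢m) (≡.cong (λ b → (if b then β m else α m) * others j) B′j))
      unchanged : k ≢ m → k ≢ j → weight B k ≈ weight B′ k
      unchanged k≢m k≢j = reflexive (≡.trans (weight-≢ B k≢m)
        (≡.trans (≡.cong (λ b → (if b then β m else α m) * others k) (≡.sym (B′l k k≢m k≢j))) (≡.sym (weight-≢ B′ k≢m))))

    module Passes (α≈ : ∀ l → α l ≈ β l + Λ l) (u : Fin n → Carrier)
      (u≈ : ∀ j → j ≢ m → u j ≈ β j - β m) (u#Λ : ∀ j → j ≢ m → u j - Λ m # 0#) (x : Vector Carrier n) where

      step : V → Fin n → V
      step w j = R m j (u j) w

      pass : ∀ {ℓ} {P : Fin n → Set ℓ} (P? : ∀ j → Dec (P j)) (B : ℕ → Fin n → Bool) →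
        (∀ j → P j → j ≢ m) →
        (∀ j → P j → B (toℕ j) j ≡ false) → (∀ j → P j → ∀ l → l ≢ m → l ≢ j → B (toℕ j) l ≡ before j l) →
        (∀ j → P j → B (suc (toℕ j)) j ≡ true) →
        (∀ j l → l ≢ j → B (suc (toℕ j)) l ≡ B (toℕ j) l) →
        (∀ j → ¬ P j → j ≢ m → B (suc (toℕ j)) j ≡ B (toℕ j) j) →
        ∀ k → foldl step (weight (B 0)) (filter P? (allFin n)) k ≈ weight (B n) k
      pass P? B P⇒≢ hit-j hit-l hit-j′ stable miss =
        filtered-fold P? step (λ t v → ∀ k → v k ≈ weight (B t) k)
          (λ j v P-j inv k → trans (R-linear m j (u j) .cong inv k)
            (weight-step α≈ (u≈ j (P⇒≢ j P-j)) (u#Λ j (P⇒≢ j P-j)) (P⇒≢ j P-j) (hit-j j P-j) (hit-l j P-j) (hit-j′ j P-j)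
              (λ l l≢m l≢j → stable j l l≢j) k))
          (λ j v ¬P-j inv k → trans (inv k) (weight-cong (λ l l≢m → ≡.sym (unchanged j ¬P-j l l≢m)) k))
          (weight (B 0)) (λ k → refl)
        where
        unchanged : ∀ j → ¬ _ → ∀ l → l ≢ m → B (suc (toℕ j)) l ≡ B (toℕ j) l
        unchanged j ¬P-j l l≢m with l Fin.≟ j
        ... | yes ≡.refl = miss j ¬P-j l≢m
        ... | no  l≢j    = stable j l l≢j

      upper-pass : ∀ k → foldl step (weight (before m)) (above m x) k ≈ weight (λ _ → true) k
      upper-pass k = begin
        foldl step (weight (before m)) (above m x) k
          ≈⟨ foldl-linear (λ j → R-linear m j (u j)) (above m x) .cong
               (weight-cong λ l _ → ≡.sym (∨-identityʳ (before m l))) k ⟩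
        foldl step (weight (B 0)) (above m x) k
          ≈⟨ pass (λ j → m Fin.<? j) B
               (λ j m<j → λ { ≡.refl → ℕ.<-irrefl ≡.refl m<j })
               (λ j m<j → ≡.cong₂ _∨_ (<ᵇ-false (ℕ.<⇒≤ m<j)) (<ᵇ-false {toℕ j} ℕ.≤-refl))
               (λ j m<j l l≢m l≢j → absorb m<j l)
               (λ j m<j → ≡.trans (≡.cong (before m j ∨_) (<ᵇ-true (ℕ.n<1+n (toℕ j)))) (∨-zeroʳ _))
               (λ j l l≢j → ≡.cong (before m l ∨_) (<ᵇ-suc (toℕ-≢ l≢j)))
               (λ j m≮j j≢m → let j<m = ℕ.≤∧≢⇒< (ℕ.≮⇒≥ m≮j) (toℕ-≢ j≢m) in
                 ≡.trans (≡.cong (_∨ (toℕ j <ᵇ suc (toℕ j))) (<ᵇ-true j<m)) (≡.sym (≡.cong (_∨ (toℕ j <ᵇ toℕ j)) (<ᵇ-true j<m)))) k ⟩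
        weight (B n) k
          ≈⟨ weight-cong (λ l _ → ≡.trans (≡.cong (before m l ∨_) (<ᵇ-true (toℕ<n l))) (∨-zeroʳ _)) k ⟩
        weight (λ _ → true) k ∎
        where
        -- When the threshold is `t`, the positions before `m` are its natural predecessors and all
        -- those below `t` it has passed.
        B : ℕ → Fin n → Bool
        B t l = before m l ∨ (toℕ l <ᵇ t)
        absorb : ∀ {j} → toℕ m ℕ.< toℕ j → ∀ l → before m l ∨ before j l ≡ before j l
        absorb {j} m<j l with toℕ l ℕ.<? toℕ m
        ... | yes l<m = ≡.trans (≡.cong (_∨ before j l) (<ᵇ-true l<m)) (≡.sym (<ᵇ-true (ℕ.<-trans l<m m<j)))
        ... | no  l≮m = ≡.cong (_∨ before j l) (<ᵇ-false (ℕ.≮⇒≥ l≮m))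

      lower-pass : ∀ k → foldl step (weight (λ _ → false)) (below m x) k ≈ weight (before m) k
      lower-pass k = begin
        foldl step (weight (λ _ → false)) (below m x) k
          ≈⟨ foldl-linear (λ j → R-linear m j (u j)) (below m x) .cong
               (weight-cong λ l _ → ≡.sym (∧-zeroʳ (before m l))) k ⟩
        foldl step (weight (B 0)) (below m x) k
          ≈⟨ pass (λ j → j Fin.<? m) B
               (λ j j<m → λ { ≡.refl → ℕ.<-irrefl ≡.refl j<m })
               (λ j j<m → ≡.trans (≡.cong (before m j ∧_) (<ᵇ-false {toℕ j} ℕ.≤-refl)) (∧-zeroʳ _))
               (λ j j<m l l≢m l≢j → absorb j<m l)
               (λ j j<m → ≡.cong₂ _∧_ (<ᵇ-true j<m) (<ᵇ-true (ℕ.n<1+n (toℕ j))))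
               (λ j l l≢j → ≡.cong (before m l ∧_) (<ᵇ-suc (toℕ-≢ l≢j)))
               (λ j j≮m j≢m → ≡.trans (≡.cong (_∧ (toℕ j <ᵇ suc (toℕ j))) (<ᵇ-false (ℕ.≮⇒≥ j≮m))) (≡.sym (≡.cong (_∧ (toℕ j <ᵇ toℕ j)) (<ᵇ-false (ℕ.≮⇒≥ j≮m))))) k ⟩
        weight (B n) k
          ≈⟨ weight-cong (λ l _ → ≡.trans (≡.cong (before m l ∧_) (<ᵇ-true (toℕ<n l))) (∧-identityʳ _)) k ⟩
        weight (before m) k ∎
        where
        -- Here `m` starts in front of all positions, so that only its natural predecessors below
        -- `t` have been passed.
        B : ℕ → Fin n → Bool
        B t l = before m l ∧ (toℕ l <ᵇ t)
        absorb : ∀ {j} → toℕ j ℕ.< toℕ m → ∀ l → before m l ∧ before j l ≡ before j l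
        absorb {j} j<m l with toℕ l ℕ.<? toℕ m
        ... | yes l<m = ≡.cong (_∧ before j l) (<ᵇ-true l<m)
        ... | no  l≮m = ≡.trans (≡.cong (_∧ before j l) (<ᵇ-false (ℕ.≮⇒≥ l≮m)))
                          (≡.sym (<ᵇ-false (ℕ.≤-trans (ℕ.<⇒≤ j<m) (ℕ.≮⇒≥ l≮m))))

-- Transport of the Bethe vector under a shift

module Curvature {c ℓ₁ ℓ₂} (em : ExcludedMiddle (c ⊔ ℓ₁ ⊔ ℓ₂)) (K : HeytingField c ℓ₁ ℓ₂)
  (p-2 : ℕ) (char : OverField.HasCharacteristic em K (2 ℕ.+ p-2))
  {n : ℕ} (Λ : Vector (HeytingField.Carrier K) n) (a : HeytingField.Carrier K) where

  open FieldBase em K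
  open LinearAlgebra em K
  open Characteristic em K p-2 char using (p; p·≈0; module AdditivePolynomial)
  open QKZ p Λ a hiding (h)
  open Transport em K p Λ a
  open import Relation.Binary.Reasoning.Setoid setoid

  φ : Carrier → Carrier → Vector Carrier n → ℕ → Carrier
  φ κ s x d = product {d} λ j → Φ κ (s + toℕ j · a) x

  α β : Carrier → Vector Carrier n → Vector Carrier n
  α σ x l = σ - x l + Λ l
  β σ x l = σ - x l

  α≈ : ∀ σ x l → α σ x l ≈ β σ x l + Λ l
  α≈ σ x l = refl

  -a≈ : (suc p-2) · a ≈ - a
  -a≈ = begin
    q              ≈⟨ solve 2 (λ q a → q ⊜ (a ⊕ q) ⊟ a) refl q a ⟩
    (a + q) - a    ≈⟨ +-congʳ (p·≈0 a) ⟩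
    0# - a         ≈⟨ +-identityˡ _ ⟩
    - a            ∎
    where q = (suc p-2) · a

  -- In characteristic `p` one step backwards is `p - 1` steps forwards, so conditions for all
  -- natural `d` also cover the shifted point.
  back : ∀ s d t → s + d · a - (t + a) ≈ s + (d ℕ.+ suc p-2) · a - t
  back s d t = sym (begin
    s + (d ℕ.+ suc p-2) · a - t          ≈⟨ +-congʳ (+-congˡ (trans (×-homo-+ a d (suc p-2)) (+-congˡ -a≈))) ⟩
    s + (d · a - a) - t                  ≈⟨ solve 4 (λ s d a t → s ⊕ (d ⊟ a) ⊟ t ⊜ s ⊕ d ⊟ (t ⊕ a)) refl s (d · a) a t ⟩
    s + d · a - (t + a)                  ∎)

  forward : ∀ s d t → s + d · a - t + a ≈ s + suc d · a - t
  forward s d t = solve 4 (λ s d t a → s ⊕ d ⊟ t ⊕ a ⊜ s ⊕ (a ⊕ d) ⊟ t) refl s (d · a) t a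

  W-cong : ∀ {σ σ′ x x′} → σ ≈ σ′ → (∀ l → x l ≈ x′ l) → ∀ k → W σ x k ≈ W σ′ x′ k
  W-cong {σ} {σ′} {x} {x′} σ≈ x≈ k = product-cong factor
    where
    factor : ∀ l → (if does (l Fin.<? k) then σ - x l + Λ l else if does (k Fin.<? l) then σ - x l else 1#)
                 ≈ (if does (l Fin.<? k) then σ′ - x′ l + Λ l else if does (k Fin.<? l) then σ′ - x′ l else 1#)
    factor l with does (l Fin.<? k) | does (k Fin.<? l)
    ... | true  | _     = +-congʳ (+-cong σ≈ (-‿cong (x≈ l)))
    ... | false | true  = +-cong σ≈ (-‿cong (x≈ l))
    ... | false | false = refl

  Φ-cong : ∀ κ {σ σ′ x x′} → σ ≈ σ′ → (∀ l → x l ≈ x′ l) → Φ κ σ x ≈ Φ κ σ′ x′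
  Φ-cong κ σ≈ x≈ = *-congˡ (product-cong λ l →
    /-cong (+-congʳ (+-cong σ≈ (-‿cong (x≈ l)))) (+-congʳ (+-cong σ≈ (-‿cong (x≈ l)))))

  φ-cong : ∀ κ {s s′ x x′} → s ≈ s′ → (∀ l → x l ≈ x′ l) → ∀ d → φ κ s x d ≈ φ κ s′ x′ d
  φ-cong κ s≈ x≈ d = product-cong {d} λ j → Φ-cong κ (+-congʳ s≈) x≈

  J-cong : ∀ κ {s s′ x x′} → s ≈ s′ → (∀ l → x l ≈ x′ l) → ∀ k → J κ s x k ≈ J κ s′ x′ k
  J-cong κ s≈ x≈ k = sum-cong {p} λ d → *-cong (W-cong (+-congʳ {toℕ d · a} s≈) x≈ k) (φ-cong κ s≈ x≈ (toℕ d))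

  W-factor : ∀ τ y k l → (if does (l Fin.<? k) then τ - y l + Λ l else if does (k Fin.<? l) then τ - y l else 1#)
    ≈ mask k (λ l → if toℕ l <ᵇ toℕ k then α τ y l else β τ y l) l
  W-factor τ y k l with l Fin.≟ k
  ... | yes ≡.refl rewrite <ᵇ-false (ℕ.≤-refl {toℕ l}) = refl
  ... | no  l≢k with toℕ l ℕ.<? toℕ k
  ...   | yes l<k rewrite <ᵇ-true l<k = refl
  ...   | no  l≮k rewrite <ᵇ-false (ℕ.≮⇒≥ l≮k) | <ᵇ-true (ℕ.≤∧≢⇒< (ℕ.≮⇒≥ l≮k) (toℕ-≢ l≢k ∘ ≡.sym)) = refl

  W-weight : ∀ m τ y k → W τ y k ≈ Reordered.weight m (α τ y) (β τ y) (λ l → toℕ l <ᵇ toℕ m) k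
  W-weight m τ y k = trans (product-cong (W-factor τ y k)) (cases (k Fin.≟ m))
    where
    open Reordered m (α τ y) (β τ y)
    cases : Dec (k ≡ m) → product (mask k (pick (before k))) ≈ weight (before m) k
    cases (yes ≡.refl) = reflexive (≡.sym (weight-m (before m)))
    cases (no k≢m) = begin
      product g                              ≈⟨ product-mask m g ⟩
      g m * product (mask m g)               ≈⟨ *-congʳ (trans (reflexive (mask-≢ (pick (before k)) (k≢m ∘ ≡.sym))) swap) ⟩
      (if before m k then β τ y m else α τ y m) * product (mask m g)  ≡⟨ weight-≢ (before m) k≢m ⟨
      weight (before m) k                    ∎
      where
      g = mask k (pick (before k))
      swap : pick (before k) m ≈ (if before m k then β τ y m else α τ y m)
      swap with toℕ k ℕ.<? toℕ m
      ... | yes k<m rewrite <ᵇ-true k<m | <ᵇ-false (ℕ.<⇒≤ k<m) = refl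
      ... | no  k≮m rewrite <ᵇ-false (ℕ.≮⇒≥ k≮m) | <ᵇ-true (ℕ.≤∧≢⇒< (ℕ.≮⇒≥ k≮m) (toℕ-≢ k≢m ∘ ≡.sym)) = refl

  module _ (m : Fin n) (κ s : Carrier) where

    -- Stated for all natural `d` so that the conditions are inherited when `x` is shifted at `m`.
    -- The Bethe equation enters through `periodic`.
    record Regular (x : Vector Carrier n) : Set (c ⊔ ℓ₁ ⊔ ℓ₂) where
      field
        β#0      : ∀ d l → s + d · a - x l # 0#
        α#0      : ∀ d l → s + d · a - x l + Λ l # 0#
        x#0      : ∀ d j → j ≢ m → x m + d · a - x j - Λ m # 0#
        periodic : φ κ s x p ≈ 1#

    Regular-cong : ∀ {x x′} → (∀ l → x l ≈ x′ l) → Regular x → Regular x′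
    Regular-cong x≈ reg = record
      { β#0 = λ d l → #0-cong (+-congˡ (-‿cong (x≈ l))) (β#0 d l)
      ; α#0 = λ d l → #0-cong (+-congʳ (+-congˡ (-‿cong (x≈ l)))) (α#0 d l)
      ; x#0 = λ d j j≢m → #0-cong (+-congʳ (+-cong (+-congʳ (x≈ m)) (-‿cong (x≈ j)))) (x#0 d j j≢m)
      ; periodic = trans (sym (φ-cong κ refl x≈ p)) periodic }
      where open Regular reg

    -- The ratio of the master functions at x + a f_m and x.
    ρ : Carrier → Vector Carrier n → Carrier
    ρ σ x = (σ - x m) / (σ - (x m + a) + Λ m)

    ρ-cong : ∀ {σ σ′} x → σ ≈ σ′ → ρ σ x ≈ ρ σ′ x
    ρ-cong x σ≈ = /-cong (+-congʳ σ≈) (+-congʳ (+-congʳ σ≈))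

    -- The shifted point is described by its coordinates because `x m + suc d · a` and
    -- `(x m + d · a) + a` agree only up to `_≈_`.
    module Shift (x x′ : Vector Carrier n) (x′m : x′ m ≈ x m + a) (x′l : ∀ l → l ≢ m → x′ l ≈ x l) (reg : Regular x) where
      open Regular reg

      σ : ℕ → Carrier
      σ d = s + d · a

      σp≈ : σ p ≈ σ 0
      σp≈ = +-congˡ (p·≈0 a)

      α′#0 : ∀ d → σ d - (x m + a) + Λ m # 0#
      α′#0 d = #0-cong (sym (+-congʳ (back s d (x m)))) (α#0 (d ℕ.+ suc p-2) m)

      ρ#0 : ∀ d → ρ (σ d) x # 0#
      ρ#0 d = x#0y#0→xy#0 (β#0 d m) (⁻¹-#0 (α′#0 d))

      α′-back : ∀ d → σ (suc d) - (x m + a) + Λ m ≈ α (σ d) x m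
      α′-back d = solve 5 (λ s a d x L → s ⊕ (a ⊕ d) ⊟ (x ⊕ a) ⊕ L ⊜ s ⊕ d ⊟ x ⊕ L) refl s a (d · a) (x m) (Λ m)

      γ#0 : ∀ d l → σ d - x l + a # 0#
      γ#0 d l = #0-cong (sym (forward s d (x l))) (β#0 (suc d) l)

      Φ-relation : ∀ d → Φ κ (σ d) x * product (β (σ (suc d)) x) ≈ κ * product (α (σ d) x)
      Φ-relation d = trans (*-assoc _ _ _) (*-congˡ (trans
        (*-congˡ (product-cong λ l → sym (forward s d (x l))))
        (product-/ (α (σ d) x) (λ l → σ d - x l + a) (γ#0 d))))

      φ-suc : ∀ y d → φ κ s y (suc d) ≈ φ κ s y d * Φ κ (σ d) y
      φ-suc y d = product-last d (λ j → Φ κ (σ j) y)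

      factors : Vector Carrier n → ℕ → Vector Carrier n
      factors y d i = (σ d - y i + Λ i) / (σ d - y i + a)

      -- Only the `m`-th factor of `Φ` depends on the shift, and on either side it cancels with `ρ`
      -- to `1#`.
      Φ-ρ : ∀ d → Φ κ (σ d) x * ρ (σ (suc d)) x ≈ ρ (σ d) x * Φ κ (σ d) x′
      Φ-ρ d = begin
        κ * product f * ρ′
          ≈⟨ *-congʳ (*-congˡ (product-mask m f)) ⟩
        κ * (f m * product (mask m f)) * ρ′
          ≈⟨ solve 4 (λ k f P r → k ⊗ (f ⊗ P) ⊗ r ⊜ (f ⊗ r) ⊗ (k ⊗ P)) refl κ (f m) (product (mask m f)) ρ′ ⟩
        (f m * ρ′) * (κ * product (mask m f))
          ≈⟨ *-cong (trans (/-inverse (α#0 d m) (γ#0 d m) (sym (α′-back d)) (forward s d (x m))) (sym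
               (/-inverse (β#0 d m) (α′#0 d) (sym γ′≈) (+-congʳ (+-congˡ (-‿cong (sym x′m)))))))
               (*-congˡ (product-cong λ l → mask-cong f f′ l λ l≢m →
                 /-cong (+-congʳ (+-congˡ (-‿cong (sym (x′l l l≢m))))) (+-congʳ (+-congˡ (-‿cong (sym (x′l l l≢m))))))) ⟩
        (ρ (σ d) x * f′ m) * (κ * product (mask m f′))
          ≈⟨ solve 4 (λ r f k P → (r ⊗ f) ⊗ (k ⊗ P) ⊜ r ⊗ (k ⊗ (f ⊗ P))) refl (ρ (σ d) x) (f′ m) κ (product (mask m f′)) ⟩
        ρ (σ d) x * (κ * (f′ m * product (mask m f′)))
          ≈⟨ *-congˡ (*-congˡ (product-mask m f′)) ⟨
        ρ (σ d) x * Φ κ (σ d) x′ ∎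
        where
        f = factors x d
        f′ = factors x′ d
        ρ′ = ρ (σ (suc d)) x
        γ′≈ : σ d - x′ m + a ≈ σ d - x m
        γ′≈ = trans (+-congʳ (+-congˡ (-‿cong x′m))) (solve 3 (λ s x a → s ⊟ (x ⊕ a) ⊕ a ⊜ s ⊟ x) refl (σ d) (x m) a)

      φ-ρ : ∀ d → φ κ s x d * ρ (σ d) x ≈ ρ (σ 0) x * φ κ s x′ d
      φ-ρ zero    = *-comm _ _
      φ-ρ (suc d) = begin
        φ κ s x (suc d) * ρ (σ (suc d)) x                ≈⟨ *-congʳ (φ-suc x d) ⟩
        φ κ s x d * Φ κ (σ d) x * ρ (σ (suc d)) x        ≈⟨ *-assoc _ _ _ ⟩
        φ κ s x d * (Φ κ (σ d) x * ρ (σ (suc d)) x)      ≈⟨ *-congˡ (Φ-ρ d) ⟩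
        φ κ s x d * (ρ (σ d) x * Φ κ (σ d) x′)           ≈⟨ *-assoc _ _ _ ⟨
        φ κ s x d * ρ (σ d) x * Φ κ (σ d) x′             ≈⟨ *-congʳ (φ-ρ d) ⟩
        ρ (σ 0) x * φ κ s x′ d * Φ κ (σ d) x′            ≈⟨ *-assoc _ _ _ ⟩
        ρ (σ 0) x * (φ κ s x′ d * Φ κ (σ d) x′)          ≈⟨ *-congˡ (φ-suc x′ d) ⟨
        ρ (σ 0) x * φ κ s x′ (suc d)                     ∎

      Regular-shift : Regular x′
      Regular-shift = record
        { β#0 = λ d l → β′#0 d l (l Fin.≟ m)
        ; α#0 = λ d l → α″#0 d l (l Fin.≟ m)
        ; x#0 = λ d j j≢m → #0-cong (+-congʳ (+-cong (begin
            x m + suc d · a       ≈⟨ solve 3 (λ x a d → x ⊕ (a ⊕ d) ⊜ (x ⊕ a) ⊕ d) refl (x m) a (d · a) ⟩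
            (x m + a) + d · a     ≈⟨ +-congʳ x′m ⟨
            x′ m + d · a          ∎) (-‿cong (sym (x′l j j≢m))))) (x#0 (suc d) j j≢m)
        ; periodic = *-cancelˡ-# (ρ#0 0) (begin
            ρ (σ 0) x * φ κ s x′ p     ≈⟨ φ-ρ p ⟨
            φ κ s x p * ρ (σ p) x      ≈⟨ *-cong periodic (ρ-cong x σp≈) ⟩
            1# * ρ (σ 0) x             ≈⟨ *-comm _ _ ⟩
            ρ (σ 0) x * 1#             ∎) }
        where
        β′#0 : ∀ d l → Dec (l ≡ m) → s + d · a - x′ l # 0#
        β′#0 d l (yes ≡.refl) = #0-cong (sym (trans (+-congˡ (-‿cong x′m)) (back s d (x m)))) (β#0 (d ℕ.+ suc p-2) m)
        β′#0 d l (no l≢m)     = #0-cong (+-congˡ (-‿cong (sym (x′l l l≢m)))) (β#0 d l)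
        α″#0 : ∀ d l → Dec (l ≡ m) → s + d · a - x′ l + Λ l # 0#
        α″#0 d l (yes ≡.refl) = #0-cong (+-congʳ (+-congˡ (-‿cong (sym x′m)))) (α′#0 d)
        α″#0 d l (no l≢m)     = #0-cong (+-congʳ (+-congˡ (-‿cong (sym (x′l l l≢m))))) (α#0 d l)


      open Reordered using (weight)

      allBefore noneBefore : Fin n → Bool
      allBefore  _ = true
      noneBefore _ = false

      t t′ : Vector Carrier p
      t  d = φ κ s x (toℕ d)
      t′ d = φ κ s x (toℕ d) * ρ (σ (toℕ d)) x

      -- The stations of a full turn: `m` in its natural place at `x`, last at `x`, first at `x′`,
      -- and again in its natural place at `x′`.
      V₁ V₂ V₃ V₄ : Fin p → V
      V₁ d = W (σ (toℕ d)) x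
      V₂ d = weight m (α (σ (toℕ d)) x) (β (σ (toℕ d)) x) allBefore
      V₃ d = weight m (α (σ (toℕ d)) x′) (β (σ (toℕ d)) x′) noneBefore
      V₄ d = W (σ (toℕ d)) x′

      upper-weight : ∀ d k → Upper m x (V₁ d) k ≈ V₂ d k
      upper-weight d k = trans (Upper-linear m x .cong (W-weight m τ x) k)
        (Reordered.Passes.upper-pass m (α τ x) (β τ x) (α≈ τ x) (λ j → x m - x j)
          (λ j _ → solve 3 (λ s m j → m ⊟ j ⊜ (s ⊟ j) ⊟ (s ⊟ m)) refl τ (x m) (x j))
          (λ j j≢m → #0-cong (+-congʳ (+-congʳ (+-identityʳ (x m)))) (x#0 0 j j≢m)) x k)
        where τ = σ (toℕ d)

      lower-weight : ∀ d k → Lower m x (V₃ d) k ≈ V₄ d k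
      lower-weight d k = trans
        (Reordered.Passes.lower-pass m (α τ x′) (β τ x′) (α≈ τ x′) (λ j → x m - x j + a)
          (λ j j≢m → trans (solve 4 (λ s m j a → m ⊟ j ⊕ a ⊜ (s ⊟ j) ⊟ (s ⊟ (m ⊕ a))) refl τ (x m) (x j) a)
            (+-cong (+-congˡ (-‿cong (sym (x′l j j≢m)))) (-‿cong (+-congˡ (-‿cong (sym x′m))))))
          (λ j j≢m → #0-cong (+-congʳ (solve 3 (λ m a j → m ⊕ (a ⊕ 𝟎) ⊟ j ⊜ m ⊟ j ⊕ a) refl (x m) a (x j))) (x#0 1 j j≢m)) x k)
        (sym (W-weight m τ x′ k))
        where τ = σ (toℕ d)

      product-others : ℕ → Carrier
      product-others d = product (mask m (β (σ d) x))

      rotate : (g : ℕ → Carrier) → g p ≈ g 0 → sum {p} (λ d → g (suc (toℕ d))) ≈ sum {p} (λ d → g (toℕ d))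
      rotate g gp≈g0 = begin
        sum {p} (λ d → g (suc (toℕ d)))
          ≈⟨ solve 2 (λ x y → y ⊜ (x ⊕ y) ⊟ x) refl (g 0) (sum {p} (λ d → g (suc (toℕ d)))) ⟩
        (g 0 + sum {p} (λ d → g (suc (toℕ d)))) - g 0
          ≈⟨ +-cong (sum-last p g) (-‿cong (sym gp≈g0)) ⟩
        (sum {p} (λ d → g (toℕ d)) + g p) - g p
          ≈⟨ solve 2 (λ x y → (x ⊕ y) ⊟ y ⊜ x) refl (sum {p} (λ d → g (toℕ d))) (g p) ⟩
        sum {p} (λ d → g (toℕ d)) ∎

      -- In this component the twist advances the summation index: `κ` times the product of the `α`
      -- is `Φ` times the product of the `β` at the next point. Summands do not match individually;
      -- the sums do, because `periodic` closes the cycle.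
      twist-at-m : κ * combination t V₂ m ≈ combination t′ V₃ m
      twist-at-m = begin
        κ * combination t V₂ m
          ≈⟨ *-distribˡ-sum {p} κ (λ d → t d * V₂ d m) ⟩
        sum {p} (λ d → κ * (t d * V₂ d m))
          ≈⟨ sum-cong {p} (λ d → step (toℕ d)) ⟩
        sum {p} (λ d → g (suc (toℕ d)))
          ≈⟨ rotate g gp≈g0 ⟩
        sum {p} (λ d → g (toℕ d))
          ≈⟨ sum-cong {p} (λ d → *-congˡ {t′ d} (final (toℕ d))) ⟩
        combination t′ V₃ m ∎
        where
        g : ℕ → Carrier
        g d = φ κ s x d * ρ (σ d) x * product-others d
        gp≈g0 : g p ≈ g 0
        gp≈g0 = *-cong (*-cong periodic (ρ-cong x σp≈)) (product-cong λ l → mask-cong (β (σ p) x) (β (σ 0) x) l λ _ → +-congʳ σp≈)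
        step : ∀ d → κ * (φ κ s x d * weight m (α (σ d) x) (β (σ d) x) allBefore m) ≈ g (suc d)
        step d = *-cancelˡ-# (α#0 d m) (begin
          A * (κ * (f * weight m (α (σ d) x) (β (σ d) x) allBefore m))
            ≈⟨ *-congˡ (*-congˡ (*-congˡ (reflexive (Reordered.weight-m m (α (σ d) x) (β (σ d) x) allBefore)))) ⟩
          A * (κ * (f * product (mask m (α (σ d) x))))
            ≈⟨ solve 4 (λ A k f P → A ⊗ (k ⊗ (f ⊗ P)) ⊜ f ⊗ (k ⊗ (A ⊗ P))) refl A κ f (product (mask m (α (σ d) x))) ⟩
          f * (κ * (A * product (mask m (α (σ d) x))))
            ≈⟨ *-congˡ (*-congˡ (product-mask m (α (σ d) x))) ⟨
          f * (κ * product (α (σ d) x))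
            ≈⟨ *-congˡ (Φ-relation d) ⟨
          f * (Φ κ (σ d) x * product (β (σ (suc d)) x))
            ≈⟨ trans (sym (*-assoc _ _ _)) (*-cong (sym (φ-suc x d)) (product-mask m (β (σ (suc d)) x))) ⟩
          φ κ s x (suc d) * (β (σ (suc d)) x m * product-others (suc d))
            ≈⟨ *-congˡ (*-congʳ (/-cancel (α′#0 (suc d)))) ⟨
          φ κ s x (suc d) * ((σ (suc d) - (x m + a) + Λ m) * ρ (σ (suc d)) x * product-others (suc d))
            ≈⟨ *-congˡ (*-congʳ (*-congʳ (α′-back d))) ⟩
          φ κ s x (suc d) * (A * ρ (σ (suc d)) x * product-others (suc d))
            ≈⟨ solve 4 (λ f A r P → f ⊗ (A ⊗ r ⊗ P) ⊜ A ⊗ (f ⊗ r ⊗ P)) refl (φ κ s x (suc d)) A (ρ (σ (suc d)) x) (product-others (suc d)) ⟩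
          A * g (suc d) ∎)
          where
          A = α (σ d) x m
          f = φ κ s x d
        final : ∀ d → product-others d ≈ weight m (α (σ d) x′) (β (σ d) x′) noneBefore m
        final d = trans (product-cong λ l → mask-cong (β (σ d) x) (β (σ d) x′) l λ l≢m → +-congˡ (-‿cong (sym (x′l l l≢m))))
          (reflexive (≡.sym (Reordered.weight-m m (α (σ d) x′) (β (σ d) x′) noneBefore)))

      -- Here the summands match one by one, since `ρ` is the factor `β` of `m` at `x` divided by
      -- its factor `α` at `x′`.
      twist-off-m : ∀ {k} → k ≢ m → ∀ d → t d * V₂ d k ≈ t′ d * V₃ d k
      twist-off-m {k} k≢m d = begin
        f * V₂ d k
          ≈⟨ *-congˡ {f} (reflexive (Reordered.weight-≢ m (α τ x) (β τ x) allBefore k≢m)) ⟩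
        f * (β τ x m * O)
          ≈⟨ *-congˡ {f} (*-congʳ (/-cancel (α′#0 (toℕ d)))) ⟨
        f * ((τ - (x m + a) + Λ m) * ρ τ x * O)
          ≈⟨ solve 4 (λ f A r O → f ⊗ (A ⊗ r ⊗ O) ⊜ f ⊗ r ⊗ (A ⊗ O)) refl f (τ - (x m + a) + Λ m) (ρ τ x) O ⟩
        f * ρ τ x * ((τ - (x m + a) + Λ m) * O)
          ≈⟨ *-congˡ {f * ρ τ x} (*-cong (+-congʳ (+-congˡ (-‿cong (sym x′m)))) (product-cong λ l →
               mask-cong (mask k P) (mask k P′) l λ l≢m → mask-cong P P′ l λ _ → pick≈ l l≢m)) ⟩
        f * ρ τ x * (α τ x′ m * O′)
          ≈⟨ *-congˡ {f * ρ τ x} (reflexive (Reordered.weight-≢ m (α τ x′) (β τ x′) noneBefore k≢m)) ⟨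
        t′ d * V₃ d k ∎
        where
        τ = σ (toℕ d)
        f = φ κ s x (toℕ d)
        O = Reordered.others m (α τ x) (β τ x) k
        O′ = Reordered.others m (α τ x′) (β τ x′) k
        P P′ : Vector Carrier n
        P l = if toℕ l <ᵇ toℕ k then α τ x l else β τ x l
        P′ l = if toℕ l <ᵇ toℕ k then α τ x′ l else β τ x′ l
        pick≈ : ∀ l → l ≢ m → P l ≈ P′ l
        pick≈ l l≢m with toℕ l <ᵇ toℕ k
        ... | true  = +-congʳ (+-congˡ (-‿cong (sym (x′l l l≢m))))
        ... | false = +-congˡ (-‿cong (sym (x′l l l≢m)))

      twist : ∀ k → updateAt (combination t V₂) m (κ *_) k ≈ combination t′ V₃ k
      twist k = cases (k Fin.≟ m)
        where
        cases : Dec (k ≡ m) → updateAt (combination t V₂) m (κ *_) k ≈ combination t′ V₃ k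
        cases (yes ≡.refl) = trans (reflexive (updateAt-updates m (combination t V₂))) twist-at-m
        cases (no  k≢m)    = trans (reflexive (updateAt-minimal k m (combination t V₂) k≢m)) (sum-cong {p} (twist-off-m k≢m))

      J-combination : ∀ y k → J κ s y k ≈ combination {p} (λ d → φ κ s y (toℕ d)) (λ d → W (σ (toℕ d)) y) k
      J-combination y k = sum-cong {p} λ d → *-comm (W (σ (toℕ d)) y k) (φ κ s y (toℕ d))

      transport : ∀ k → qKZ κ m x (J κ s x) k ≈ ρ (σ 0) x * J κ s x′ k
      transport k = begin
        qKZ κ m x (J κ s x) k
          ≈⟨ Lower-linear m x .cong (λ k → trans (twist-linear κ m .cong (λ k → begin
               Upper m x (J κ s x) k                  ≈⟨ Upper-linear m x .cong (J-combination x) k ⟩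
               Upper m x (combination t V₁) k         ≈⟨ Upper-linear m x .combination-homo t V₁ k ⟩
               combination t (λ d → Upper m x (V₁ d)) k ≈⟨ sum-cong {p} (λ d → *-congˡ {t d} (upper-weight d k)) ⟩
               combination t V₂ k                     ∎) k) (twist k)) k ⟩
        Lower m x (combination t′ V₃) k
          ≈⟨ Lower-linear m x .combination-homo t′ V₃ k ⟩
        combination t′ (λ d → Lower m x (V₃ d)) k
          ≈⟨ sum-cong {p} (λ d → *-cong (φ-ρ (toℕ d)) (lower-weight d k)) ⟩
        sum {p} (λ d → ρ (σ 0) x * φ κ s x′ (toℕ d) * V₄ d k)
          ≈⟨ sum-cong {p} (λ d → trans (*-assoc (ρ (σ 0) x) (φ κ s x′ (toℕ d)) (V₄ d k)) (*-congˡ (*-comm (φ κ s x′ (toℕ d)) (V₄ d k)))) ⟩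
        sum {p} (λ d → ρ (σ 0) x * (V₄ d k * φ κ s x′ (toℕ d)))
          ≈⟨ *-distribˡ-sum {p} (ρ (σ 0) x) (λ d → V₄ d k * φ κ s x′ (toℕ d)) ⟨
        ρ (σ 0) x * J κ s x′ k ∎

    -- The argument `s + 0#` is what `σ 0` in `transport` reduces to.
    iterated : ∀ {x} → Regular x → ∀ d → Regular (shift x m (d · a)) ×
      (∀ k → qKZ-iterate d κ m x (J κ s x) k
               ≈ product {d} (λ j → ρ (s + 0#) (shift x m (toℕ j · a))) * J κ s (shift x m (d · a)) k)
    iterated {x} reg zero = Regular-cong x≈ reg , λ k → trans (J-cong κ refl x≈ k) (sym (*-identityˡ _))
      where
      x≈ : ∀ l → x l ≈ shift x m 0# l
      x≈ l with l Fin.≟ m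
      ... | yes ≡.refl = sym (trans (reflexive (updateAt-updates m x)) (+-identityʳ (x m)))
      ... | no  l≢m    = reflexive (≡.sym (updateAt-minimal l m x l≢m))
    iterated {x} reg (suc d) = Regular-shift , λ k → begin
      qKZ κ m y (qKZ-iterate d κ m x (J κ s x)) k           ≈⟨ qKZ-linear κ m y .cong (proj₂ (iterated reg d)) k ⟩
      qKZ κ m y (λ k → P * J κ s y k) k                     ≈⟨ homogeneous (qKZ-linear κ m y) P (J κ s y) k ⟩
      P * qKZ κ m y (J κ s y) k                             ≈⟨ *-congˡ (transport k) ⟩
      P * (ρ (s + 0#) y * J κ s y′ k)                       ≈⟨ *-assoc _ _ _ ⟨
      P * ρ (s + 0#) y * J κ s y′ k                         ≈⟨ *-congʳ (product-last d (λ j → ρ (s + 0#) (shift x m (j · a)))) ⟨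
      product {suc d} (λ j → ρ (s + 0#) (shift x m (toℕ j · a))) * J κ s y′ k ∎
      where
      y y′ : Vector Carrier n
      y = shift x m (d · a)
      y′ = shift x m (suc d · a)
      P = product {d} (λ j → ρ (s + 0#) (shift x m (toℕ j · a)))
      y′m : y′ m ≈ y m + a
      y′m = begin
        y′ m                  ≡⟨ updateAt-updates m x ⟩
        x m + (a + d · a)     ≈⟨ solve 3 (λ x a d → x ⊕ (a ⊕ d) ⊜ x ⊕ d ⊕ a) refl (x m) a (d · a) ⟩
        x m + d · a + a       ≡⟨ ≡.cong (_+ a) (updateAt-updates m x) ⟨
        y m + a               ∎
      y′l : ∀ l → l ≢ m → y′ l ≈ y l
      y′l l l≢m = reflexive (≡.trans (updateAt-minimal l m x l≢m) (≡.sym (updateAt-minimal l m x l≢m)))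
      open Shift y y′ y′m y′l (proj₁ (iterated reg d)) using (Regular-shift; transport)

  -- Products over an orbit and the eigenvalues of the p-curvature

  module _ (distinct : ∀ i j → i ℕ.< p → j ℕ.< p → i ≢ j → i · a # j · a) where

    open AdditivePolynomial a distinct

    h-a : h a ≈ 0#
    h-a = trans (h-cong (sym (+-identityʳ a))) (h-multiple 1)

    h-+a : ∀ u → h (u + a) ≈ h u
    h-+a u = trans (h-+ u a) (trans (+-congˡ h-a) (+-identityʳ _))

    -- Reversing the index turns `- (p - 1 - j) a` into `(j + 1) a`, as `p · a` vanishes, and `h`
    -- has period `a`.
    h-product-backwards : ∀ u → product {p} (λ j → u - toℕ j · a) ≈ h u
    h-product-backwards u = begin
      product {p} (λ j → u - toℕ j · a)
        ≈⟨ product-permute {p} (λ j → u - toℕ j · a) Perm.reverse ⟩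
      product {p} (λ j → u - toℕ (opposite j) · a)
        ≈⟨ product-cong {p} reflect ⟩
      product {p} (λ j → u + a + toℕ j · a)
        ≈⟨ h-product (u + a) ⟨
      h (u + a)
        ≈⟨ h-+a u ⟩
      h u ∎
      where
      reflect : ∀ (j : Fin p) → u - toℕ (opposite j) · a ≈ u + a + toℕ j · a
      reflect j = begin
        u - o                     ≈⟨ solve 3 (λ u o w → u ⊟ o ⊜ u ⊕ w ⊟ (o ⊕ w)) refl u o (suc (toℕ j) · a) ⟩
        u + suc (toℕ j) · a - (o + suc (toℕ j) · a)
          ≈⟨ +-congˡ (-‿cong (×-homo-+ a (toℕ (opposite j)) (suc (toℕ j)))) ⟨
        u + suc (toℕ j) · a - (toℕ (opposite j) ℕ.+ suc (toℕ j)) · a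
          ≡⟨ ≡.cong (λ k → u + suc (toℕ j) · a - k · a)
               (≡.trans (≡.cong (ℕ._+ suc (toℕ j)) (opposite-prop j)) (ℕ.m∸n+n≡m (toℕ<n j))) ⟩
        u + suc (toℕ j) · a - p · a
          ≈⟨ +-congˡ (trans (-‿cong (p·≈0 a)) -0#≈0#) ⟩
        u + (a + toℕ j · a) + 0#
          ≈⟨ solve 3 (λ u a j → u ⊕ (a ⊕ j) ⊕ 𝟎 ⊜ u ⊕ a ⊕ j) refl u a (toℕ j · a) ⟩
        u + a + toℕ j · a ∎
        where o = toℕ (opposite j) · a

    product-quotient : ∀ {u v} (f g : Fin p → Carrier) → (∀ j → g j # 0#) →
      product f ≈ u → product g ≈ v → product (λ j → f j / g j) ≈ u / v
    product-quotient {u} {v} f g g#0 f≈ g≈ = sym (/-unique (#0-cong g≈ (product-#0 g#0)) (begin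
      u                                       ≈⟨ f≈ ⟨
      product f                               ≈⟨ product-/ f g g#0 ⟨
      product (λ j → f j / g j) * product g   ≈⟨ *-comm _ _ ⟩
      product g * product (λ j → f j / g j)   ≈⟨ *-congʳ g≈ ⟩
      v * product (λ j → f j / g j)           ∎))

    curvature-eigenvector : ∀ m κ s x → Regular m κ s x →
      ∀ k → pCurvature κ m x (J κ s x) k ≈ eigenvalue x s m * J κ s x k
    curvature-eigenvector m κ s x reg k = trans (proj₂ (iterated m κ s reg p) k)
      (*-cong ratio (J-cong κ refl x≈ k))
      where
      y : ℕ → Vector Carrier n
      y d = shift x m (d · a)
      y-m : ∀ d → y d m ≡ x m + d · a
      y-m d = updateAt-updates m x
      x≈ : ∀ l → y p l ≈ x l
      x≈ l with l Fin.≟ m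
      ... | yes ≡.refl = trans (reflexive (updateAt-updates m x)) (trans (+-congˡ (p·≈0 a)) (+-identityʳ (x m)))
      ... | no  l≢m    = reflexive (updateAt-minimal l m x l≢m)
      f g : Fin p → Carrier
      f j = s + 0# - y (toℕ j) m
      g j = s + 0# - (y (toℕ j) m + a) + Λ m
      g#0 : ∀ j → g j # 0#
      g#0 j = Shift.α′#0 m κ s (y (toℕ j)) (shift (y (toℕ j)) m a) (reflexive (updateAt-updates m (y (toℕ j))))
        (λ l l≢m → reflexive (updateAt-minimal l m (y (toℕ j)) l≢m)) (proj₁ (iterated m κ s reg (toℕ j))) 0
      ratio : product {p} (λ j → f j / g j) ≈ eigenvalue x s m
      ratio = product-quotient f g g#0
        (trans (product-cong {p} (λ j → trans (+-congˡ (-‿cong (reflexive (y-m (toℕ j)))))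
          (solve 3 (λ s x d → s ⊕ 𝟎 ⊟ (x ⊕ d) ⊜ s ⊟ x ⊟ d) refl s (x m) (toℕ j · a)))) (h-product-backwards (s - x m)))
        (trans (product-cong {p} (λ j → trans (+-congʳ (+-congˡ (-‿cong (+-congʳ (reflexive (y-m (toℕ j)))))))
          (solve 5 (λ s x d a L → s ⊕ 𝟎 ⊟ (x ⊕ d ⊕ a) ⊕ L ⊜ s ⊟ x ⊕ L ⊟ a ⊟ d) refl s (x m) (toℕ j · a) a (Λ m))))
          (trans (h-product-backwards (s - x m + Λ m - a))
            (trans (sym (h-+a (s - x m + Λ m - a))) (h-cong (solve 2 (λ u a → u ⊟ a ⊕ a ⊜ u) refl (s - x m + Λ m) a)))))

    -- Exchanging the products over the orbit and over the positions produces the left side of the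
    -- Bethe equation; the additional `a` in the denominators only moves the starting point of an
    -- orbit of length `p`.
    bethe-periodic : ∀ κ s x → (∀ d l → s + d · a - x l # 0#) → BetheEquation κ x s → φ κ s x p ≈ 1#
    bethe-periodic κ s x β#0 (_ , bethe) = begin
      product {p} (λ j → κ * product (λ i → f i j / g i j))
        ≈⟨ product-distrib-* {p} (λ _ → κ) (λ j → product (λ i → f i j / g i j)) ⟩
      product {p} (λ _ → κ) * product {p} (λ j → product (λ i → f i j / g i j))
        ≈⟨ *-cong (product-^ p κ) (product-comm {p} {n} (λ j i → f i j / g i j)) ⟩
      κ ^ p * product (λ i → product {p} (λ j → f i j / g i j))
        ≈⟨ *-congˡ (product-cong λ i → product-quotient (f i) (g i)
             (λ j → #0-cong (sym (forward s (toℕ j) (x i))) (β#0 (suc (toℕ j)) i))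
             (trans (product-cong {p} (λ j → solve 4 (λ s d x L → s ⊕ d ⊟ x ⊕ L ⊜ s ⊟ x ⊕ L ⊕ d) refl s (toℕ j · a) (x i) (Λ i)))
               (sym (h-product (s - x i + Λ i))))
             (trans (product-cong {p} (λ j → solve 4 (λ s d x a → s ⊕ d ⊟ x ⊕ a ⊜ s ⊟ x ⊕ a ⊕ d) refl s (toℕ j · a) (x i) a))
               (trans (sym (h-product (s - x i + a))) (h-+a (s - x i))))) ⟩
      κ ^ p * product (λ i → h (s - x i + Λ i) / h (s - x i))
        ≈⟨ bethe ⟩
      1# ∎
      where
      f g : Fin n → Fin p → Carrier
      f i j = s + toℕ j · a - x i + Λ i
      g i j = s + toℕ j · a - x i + a

-- Formal branches through simple zeros

module Branches {c ℓ₁ ℓ₂} (em : ExcludedMiddle (c ⊔ ℓ₁ ⊔ ℓ₂)) (K : HeytingField c ℓ₁ ℓ₂) where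

  private module F = FieldBase em K
  open F using (Carrier; _≈_; _#_; 0#; 1#; Poly; con; var; _:+_; _:*_; ⟦_⟧; ⟦_⟧ˢ; Series; ε; constant)
  open FormalSeries em K
  open Polynomials em K
  private module AK = InAlgebra algebra-K
  private module AS = InAlgebra algebra-S
  open AS using (at; pair; eval-DD; eval-subst; eval-cong)

  -- On the diagonal the divided difference is the derivative.
  SimpleZero : Poly 1 → Carrier → Set _
  SimpleZero G y = (⟦ G ⟧ (AK.at y) ≈ 0#) × (⟦ DD G ⟧ (AK.pair y y) # 0#)

  simple-zero-linear : ∀ t y → y F.+ t ≈ 0# → SimpleZero (var zero :+ con t) y
  simple-zero-linear t y y+t≈0 = y+t≈0 , F.#0-cong (F.sym (F.+-identityʳ 1#)) F.1#0

  eval-relabel : ∀ G {k} (i : Fin k) ρ → ⟦ substP G (λ _ → var i) ⟧ ρ ≈ ⟦ G ⟧ (AK.at (ρ i))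
  eval-relabel G i ρ = AK.eval-subst G (λ _ → var i) ρ

  -- By the product rule only the term that differentiates the vanishing factor survives.
  simple-zero-product : ∀ {n} (f : Fin n → Poly 1) y i → SimpleZero (f i) y →
    (∀ j → j ≢ i → ⟦ f j ⟧ (AK.at y) # 0#) → SimpleZero (productP f) y
  simple-zero-product {suc n} f y zero (f≈0 , Df#0) others#0 =
    F.trans (F.*-congʳ f≈0) (F.zeroˡ _) ,
    F.#0-cong (F.sym (F.trans (F.+-cong
        (F.trans (F.*-congʳ (F.trans (eval-relabel (f zero) zero (AK.pair y y)) f≈0)) (F.zeroˡ _))
        (F.*-congˡ (eval-relabel (productP (f ∘ suc)) (suc zero) (AK.pair y y)))) (F.+-identityˡ _)))
      (F.x#0y#0→xy#0 Df#0 (F.#0-cong (F.sym (AK.eval-product (f ∘ suc) (AK.at y)))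
        (F.product-#0 λ j → others#0 (suc j) λ ())))
  simple-zero-product {suc n} f y (suc i) zero-fi others#0 =
    F.trans (F.*-congˡ (proj₁ rest)) (F.zeroʳ _) ,
    F.#0-cong (F.sym (F.trans (F.+-cong
        (F.*-congʳ (eval-relabel (f zero) zero (AK.pair y y)))
        (F.trans (F.*-congˡ (F.trans (eval-relabel (productP (f ∘ suc)) (suc zero) (AK.pair y y)) (proj₁ rest))) (F.zeroʳ _)))
        (F.+-identityʳ _)))
      (F.x#0y#0→xy#0 (others#0 zero λ ()) (proj₂ rest))
    where
    rest = simple-zero-product (f ∘ suc) y i zero-fi (λ j j≢i → others#0 (suc j) (j≢i ∘ suc-injective))

  open CommutativeRing ring-S hiding (zero; rawRing; Carrier)
    renaming (_≈_ to _≈ˢ_; _+_ to _+ˢ_; _*_ to _*ˢ_; -_ to -ˢ_; _-_ to _-ˢ_; 0# to 0ˢ; 1# to 1ˢ)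
  open RingLemmas ring-S renaming (_^_ to _^ˢ_)
  open import Relation.Binary.Reasoning.Setoid setoid

  eval-constant : ∀ {m} (G : Poly m) ρ → ⟦ G ⟧ˢ (constant ∘ ρ) ≈ˢ constant (⟦ G ⟧ ρ)
  eval-constant (con t)  ρ = refl
  eval-constant (var i)  ρ = refl
  eval-constant (G :+ H) ρ = trans (+-cong (eval-constant G ρ) (eval-constant H ρ)) (sym (constant-+-homo (⟦ G ⟧ ρ) (⟦ H ⟧ ρ)))
  eval-constant (G :* H) ρ = trans (*-cong (eval-constant G ρ) (eval-constant H ρ)) (sym (constant-*-homo (⟦ G ⟧ ρ) (⟦ H ⟧ ρ)))

  ≈[]-eval : ∀ {m} (G : Poly m) {k ρ ρ′} → (∀ i → ρ i ≈[ k ] ρ′ i) → ⟦ G ⟧ˢ ρ ≈[ k ] ⟦ G ⟧ˢ ρ′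
  ≈[]-eval (con t)  ρ≈ρ′ _ = F.refl
  ≈[]-eval (var i)  ρ≈ρ′ = ρ≈ρ′ i
  ≈[]-eval (G :+ H) {ρ = ρ} {ρ′} ρ≈ρ′ =
    ≈[]-+ {f = ⟦ G ⟧ˢ ρ} {⟦ G ⟧ˢ ρ′} {⟦ H ⟧ˢ ρ} {⟦ H ⟧ˢ ρ′} (≈[]-eval G ρ≈ρ′) (≈[]-eval H ρ≈ρ′)
  ≈[]-eval (G :* H) {ρ = ρ} {ρ′} ρ≈ρ′ =
    ≈[]-* {f = ⟦ G ⟧ˢ ρ} {⟦ G ⟧ˢ ρ′} {⟦ H ⟧ˢ ρ} {⟦ H ⟧ˢ ρ′} (≈[]-eval G ρ≈ρ′) (≈[]-eval H ρ≈ρ′)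

  -- Writing b = y + ε δ, the equation P(b) = ε² R becomes
  -- δ = g⁻¹ ε (R - δ² H(b)), where P(X) = (X - y) (g + (X - y) H(X)), and
  -- this is a contraction for the ε-adic topology.
  hensel : ∀ P Q r y → SimpleZero P y →
    ∃ λ b → (b 0 ≈ y) × (⟦ P ⟧ˢ (at b) ≈ˢ ε ^ˢ (2 ℕ.+ r) *ˢ ⟦ Q ⟧ˢ (at b))
  hensel P Q r y (Py≈0 , g#0) = b , b₀≈y , (begin
      ⟦ P ⟧ˢ (at b)
        ≈⟨ solve 2 (λ P z → P ⊜ (P ⊟ z) ⊕ z) refl (⟦ P ⟧ˢ (at b)) (⟦ P ⟧ˢ (at ŷ)) ⟩
      (⟦ P ⟧ˢ (at b) -ˢ ⟦ P ⟧ˢ (at ŷ)) +ˢ ⟦ P ⟧ˢ (at ŷ)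
        ≈⟨ +-cong (eval-DD P b ŷ) (trans (eval-constant P (AK.at y)) (trans (constant-cong Py≈0) (KAlgebra.ι-0 algebra-S))) ⟩
      (b -ˢ ŷ) *ˢ ⟦ DD P ⟧ˢ (pair b ŷ) +ˢ 0ˢ
        ≈⟨ trans (+-identityʳ ((b -ˢ ŷ) *ˢ ⟦ DD P ⟧ˢ (pair b ŷ))) (*-cong b-ŷ G-b) ⟩
      (ε *ˢ δ) *ˢ (ĝ +ˢ (ε *ˢ δ) *ˢ H b)
        ≈⟨ solve 4 (λ e d g h → (e ⊗ d) ⊗ (g ⊕ (e ⊗ d) ⊗ h) ⊜ e ⊗ (g ⊗ d ⊕ e ⊗ (d ⊗ d ⊗ h))) refl ε δ ĝ (H b) ⟩
      ε *ˢ (ĝ *ˢ δ +ˢ ε *ˢ (δ *ˢ δ *ˢ H b))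
        ≈⟨ *-congˡ {ε} (+-congʳ {ε *ˢ (δ *ˢ δ *ˢ H b)} gδ) ⟩
      ε *ˢ (ε *ˢ (ε ^ˢ r *ˢ ⟦ Q ⟧ˢ (at b) -ˢ δ *ˢ δ *ˢ H b) +ˢ ε *ˢ (δ *ˢ δ *ˢ H b))
        ≈⟨ solve 4 (λ e r q h → e ⊗ (e ⊗ (r ⊗ q ⊟ h) ⊕ e ⊗ h) ⊜ e ⊗ (e ⊗ r) ⊗ q) refl ε (ε ^ˢ r) (⟦ Q ⟧ˢ (at b)) (δ *ˢ δ *ˢ H b) ⟩
      ε ^ˢ (2 ℕ.+ r) *ˢ ⟦ Q ⟧ˢ (at b) ∎)
    where
    ŷ = constant y
    g = ⟦ DD P ⟧ (AK.pair y y)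
    ĝ = constant g
    i = constant (g F.⁻¹)
    σ : Fin 2 → Poly 1
    σ zero    = var zero
    σ (suc _) = con y
    -- `G` represents `P(X) / (X - y)` at a zero `y` of `P`; its own divided difference at `y` is
    -- the second-order remainder `H`.
    G : Poly 1
    G = substP (DD P) σ
    H : Series → Series
    H b = ⟦ DD G ⟧ˢ (pair b ŷ)
    point : Series → Series
    point δ = ŷ +ˢ ε *ˢ δ
    -- One `ε` of the right side is cancelled against the one in `b - y`. The second must remain to
    -- make the map a contraction, hence the exponent `2 + r`.
    inner : Series → Series
    inner δ = ε ^ˢ r *ˢ ⟦ Q ⟧ˢ (at (point δ)) -ˢ δ *ˢ δ *ˢ H (point δ)
    contraction : ∀ k f f′ → f ≈[ k ] f′ → i *ˢ (ε *ˢ inner f) ≈[ suc k ] i *ˢ (ε *ˢ inner f′)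
    contraction k f f′ f≈ = ≈[]-* {f = i} {i} {ε *ˢ inner f} {ε *ˢ inner f′} (λ _ → F.refl)
      (≈[]-ε {f = inner f} {inner f′} (≈[]-+ {f = ε ^ˢ r *ˢ Q₁} {ε ^ˢ r *ˢ Q₂} { -ˢ (f *ˢ f *ˢ H₁)} { -ˢ (f′ *ˢ f′ *ˢ H₂)}
        (≈[]-* {f = ε ^ˢ r} {ε ^ˢ r} {Q₁} {Q₂} (λ _ → F.refl) (≈[]-eval Q (λ _ → point≈)))
        (λ j<k → F.-‿cong (≈[]-* {f = f *ˢ f} {f′ *ˢ f′} {H₁} {H₂} (≈[]-* {f = f} {f′} {f} {f′} f≈ f≈) (≈[]-eval (DD G) pair≈) j<k))))
      where
      Q₁ = ⟦ Q ⟧ˢ (at (point f))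
      Q₂ = ⟦ Q ⟧ˢ (at (point f′))
      H₁ = H (point f)
      H₂ = H (point f′)
      point≈ : point f ≈[ k ] point f′
      point≈ j<k = F.+-congˡ (≈[]-ε {f = f} {f′} f≈ (ℕ.m<n⇒m<1+n j<k))
      pair≈ : ∀ j → pair (point f) ŷ j ≈[ k ] pair (point f′) ŷ j
      pair≈ zero    = point≈
      pair≈ (suc _) = λ _ → F.refl
    solution = fixed-point (λ δ → i *ˢ (ε *ˢ inner δ)) contraction
    δ = proj₁ solution
    b = point δ
    b₀≈y : b 0 ≈ y
    b₀≈y = F.trans (F.+-congˡ (ε-zero δ)) (F.+-identityʳ y)
    b-ŷ : b -ˢ ŷ ≈ˢ ε *ˢ δ
    b-ŷ = solve 2 (λ y e → (y ⊕ e) ⊟ y ⊜ e) refl ŷ (ε *ˢ δ)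
    G-at : ∀ z → ⟦ G ⟧ˢ (at z) ≈ˢ ⟦ DD P ⟧ˢ (pair z ŷ)
    G-at z = trans (eval-subst (DD P) σ (at z)) (eval-cong (DD P) (λ where
      zero    → refl
      (suc _) → refl))
    G-ŷ : ⟦ G ⟧ˢ (at ŷ) ≈ˢ ĝ
    G-ŷ = trans (G-at ŷ) (trans (eval-cong (DD P) (λ where
      zero    → refl
      (suc _) → refl)) (eval-constant (DD P) (AK.pair y y)))
    G-b : ⟦ DD P ⟧ˢ (pair b ŷ) ≈ˢ ĝ +ˢ (ε *ˢ δ) *ˢ H b
    G-b = begin
      ⟦ DD P ⟧ˢ (pair b ŷ)                                ≈⟨ G-at b ⟨
      ⟦ G ⟧ˢ (at b)                                       ≈⟨ solve 2 (λ x y → x ⊜ y ⊕ (x ⊟ y)) refl (⟦ G ⟧ˢ (at b)) (⟦ G ⟧ˢ (at ŷ)) ⟩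
      ⟦ G ⟧ˢ (at ŷ) +ˢ (⟦ G ⟧ˢ (at b) -ˢ ⟦ G ⟧ˢ (at ŷ))   ≈⟨ +-cong G-ŷ (trans (eval-DD G b ŷ) (*-congʳ {H b} b-ŷ)) ⟩
      ĝ +ˢ (ε *ˢ δ) *ˢ H b                                ∎
    gδ : ĝ *ˢ δ ≈ˢ ε *ˢ inner δ
    gδ = begin
      ĝ *ˢ δ                        ≈⟨ *-congˡ {ĝ} (proj₂ solution) ⟩
      ĝ *ˢ (i *ˢ (ε *ˢ inner δ))    ≈⟨ *-assoc ĝ i (ε *ˢ inner δ) ⟨
      ĝ *ˢ i *ˢ (ε *ˢ inner δ)      ≈⟨ *-congʳ {ε *ˢ inner δ} (trans (sym (constant-*-homo g (g F.⁻¹))) (constant-cong (F.⁻¹-inverseʳ g#0))) ⟩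
      1ˢ *ˢ (ε *ˢ inner δ)          ≈⟨ *-identityˡ (ε *ˢ inner δ) ⟩
      ε *ˢ inner δ                  ∎

-- Nonvanishing of the Bethe vector

module BetheVector {c ℓ₁ ℓ₂} (em : ExcludedMiddle (c ⊔ ℓ₁ ⊔ ℓ₂)) (K : HeytingField c ℓ₁ ℓ₂)
  (p-2 : ℕ) (char : OverField.HasCharacteristic em K (2 ℕ.+ p-2))
  {n : ℕ} (Λ : Vector (HeytingField.Carrier K) n) (a : HeytingField.Carrier K)
  (x : Vector (HeytingField.Carrier K) n) (k : Fin n) where

  open FieldBase em K
  open PolynomialFunctions em K
  open Characteristic em K p-2 char using (p; p·≈0; frobenius-sum; 0^p≈0)
  open QKZ p Λ a hiding (h)
  open Curvature em K p-2 char Λ a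
  open import Relation.Binary.Reasoning.Setoid setoid

  p-1 : ℕ
  p-1 = suc p-2

  numerator denominator : Carrier → Carrier
  numerator   σ = product (α σ x)
  denominator σ = product (β σ x)

  -- The numerators of the first `d` factors `Φ` and the denominators of the remaining ones. The
  -- second `suc` in `from` is there because the denominator of `Φ` at a point is `denominator` at
  -- the next one.
  upto from : Carrier → ℕ → Carrier
  upto s d = product {d} λ j → numerator (s + suc (toℕ j) · a)
  from s d = product {p-1 ∸ d} λ j → denominator (s + suc (suc (d ℕ.+ toℕ j)) · a)

  coefficient : Carrier → ℕ → Carrier
  coefficient s d = W (s + suc d · a) x k * (upto s d * from s d)

  -- J starting from the argument s + a instead of s: its last summand is
  -- the one that dominates near the roots s = x - Λ for large κ.
  rotated : Carrier → Carrier → Carrier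
  rotated κ s = sum {p} λ d → W (s + suc (toℕ d) · a) x k * product {toℕ d} λ j → Φ κ (s + suc (toℕ j) · a) x

  module _ (P Q : Carrier → Carrier) where

    -- Homogenized by `p - 1` factors of `P`, so that the powers of `Q / P` require no division.
    resultant-term : Carrier → ℕ → Carrier
    resultant-term s d = P s ^ (p-1 ∸ d) * Q s ^ d * coefficient s d ^ p

    -- Since κ ^ p = Q / P, the p-th power of the component of J is a
    -- rational function of s alone.
    resultant : Carrier → Carrier
    resultant s = sum {p} λ d → resultant-term s (toℕ d)

  module _ (κ s : Carrier) (β#0 : ∀ d l → s + d · a - x l # 0#) (periodic : φ κ s x p ≈ 1#) where

    ψ : ℕ → Carrier
    ψ d = product {d} λ j → Φ κ (s + suc (toℕ j) · a) x

    -- By periodicity the summand with index `p` equals that with index `0`, so the sum may run from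
    -- `1` to `p`; then all its terms share the first `Φ`.
    J-rotated : J κ s x k ≈ Φ κ (s + 0#) x * rotated κ s
    J-rotated = begin
      J κ s x k
        ≈⟨ solve 2 (λ x y → x ⊜ (x ⊕ y) ⊟ y) refl (J κ s x k) (g p) ⟩
      (J κ s x k + g p) - g p
        ≈⟨ +-cong (sym (sum-last p g)) (-‿cong g-periodic) ⟩
      (g 0 + sum {p} (λ d → g (suc (toℕ d)))) - g 0
        ≈⟨ solve 2 (λ x y → (x ⊕ y) ⊟ x ⊜ y) refl (g 0) (sum {p} (λ d → g (suc (toℕ d)))) ⟩
      sum {p} (λ d → g (suc (toℕ d)))
        ≈⟨ sum-cong {p} (λ d → solve 3 (λ w f p → w ⊗ (f ⊗ p) ⊜ f ⊗ (w ⊗ p)) refl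
             (W (s + suc (toℕ d) · a) x k) (Φ κ (s + 0#) x) (ψ (toℕ d))) ⟩
      sum {p} (λ d → Φ κ (s + 0#) x * (W (s + suc (toℕ d) · a) x k * ψ (toℕ d)))
        ≈⟨ *-distribˡ-sum {p} (Φ κ (s + 0#) x) (λ d → W (s + suc (toℕ d) · a) x k * ψ (toℕ d)) ⟨
      Φ κ (s + 0#) x * rotated κ s ∎
      where
      g : ℕ → Carrier
      g d = W (s + d · a) x k * φ κ s x d
      g-periodic : g p ≈ g 0
      g-periodic = *-cong (W-cong (+-congˡ (p·≈0 a)) (λ _ → refl) k) periodic

    -- The first `Φ` is nonzero as a factor of the product that `periodic` equates with `1#`.
    rotated≈0 : J κ s x k ≈ 0# → rotated κ s ≈ 0#
    rotated≈0 J≈0 = *-zero-# (#0-*ˡ {y = ψ p-1} (#0-cong (sym periodic) 1#0)) (trans (sym J-rotated) J≈0)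

    Φ-numerator : ∀ d → denominator (s + suc d · a) * Φ κ (s + d · a) x ≈ κ * numerator (s + d · a)
    Φ-numerator d = begin
      denominator (s + suc d · a) * (κ * product (λ l → α σ x l / γ l))
        ≈⟨ solve 3 (λ D k R → D ⊗ (k ⊗ R) ⊜ k ⊗ (R ⊗ D)) refl (denominator (s + suc d · a)) κ (product (λ l → α σ x l / γ l)) ⟩
      κ * (product (λ l → α σ x l / γ l) * denominator (s + suc d · a))
        ≈⟨ *-congˡ (trans (*-congˡ (product-cong λ l → sym (forward s d (x l))))
             (product-/ (α σ x) γ (λ l → #0-cong (sym (forward s d (x l))) (β#0 (suc d) l)))) ⟩
      κ * numerator σ ∎
      where
      σ = s + d · a
      γ : Vector Carrier n
      γ l = σ - x l + a

    from-step : ∀ d → d ℕ.< p-1 → from s d ≈ denominator (s + suc (suc d) · a) * from s (suc d)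
    from-step d (ℕ.s≤s d≤) rewrite ℕ.+-∸-assoc 1 d≤ =
      *-cong (reflexive (≡.cong (λ i → denominator (s + suc (suc i) · a)) (ℕ.+-identityʳ d)))
        (product-cong {p-2 ∸ d} λ j → reflexive (≡.cong (λ i → denominator (s + suc (suc i) · a)) (ℕ.+-suc d (toℕ j))))

    ψ-cleared : ∀ d → d ℕ.≤ p-1 → ψ d * from s 0 ≈ κ ^ d * (upto s d * from s d)
    ψ-cleared zero    _    = *-congˡ (sym (*-identityˡ _))
    ψ-cleared (suc d) d<p-1 = begin
      ψ (suc d) * from s 0
        ≈⟨ *-congʳ (product-last d (λ j → Φ κ (s + suc j · a) x)) ⟩
      ψ d * F * from s 0
        ≈⟨ solve 3 (λ p F D → p ⊗ F ⊗ D ⊜ (p ⊗ D) ⊗ F) refl (ψ d) F (from s 0) ⟩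
      (ψ d * from s 0) * F
        ≈⟨ *-congʳ (trans (ψ-cleared d (ℕ.<⇒≤ d<p-1)) (*-congˡ (*-congˡ (from-step d d<p-1)))) ⟩
      κ ^ d * (upto s d * (D * from s (suc d))) * F
        ≈⟨ solve 5 (λ k u D f F → k ⊗ (u ⊗ (D ⊗ f)) ⊗ F ⊜ k ⊗ (u ⊗ ((D ⊗ F) ⊗ f))) refl (κ ^ d) (upto s d) D (from s (suc d)) F ⟩
      κ ^ d * (upto s d * ((D * F) * from s (suc d)))
        ≈⟨ *-congˡ (*-congˡ (*-congʳ (Φ-numerator (suc d)))) ⟩
      κ ^ d * (upto s d * ((κ * numerator (s + suc d · a)) * from s (suc d)))
        ≈⟨ solve 5 (λ k κ u N f → k ⊗ (u ⊗ ((κ ⊗ N) ⊗ f)) ⊜ (κ ⊗ k) ⊗ ((u ⊗ N) ⊗ f)) refl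
             (κ ^ d) κ (upto s d) (numerator (s + suc d · a)) (from s (suc d)) ⟩
      κ ^ suc d * ((upto s d * numerator (s + suc d · a)) * from s (suc d))
        ≈⟨ *-congˡ (*-congʳ (product-last d (λ j → numerator (s + suc j · a)))) ⟨
      κ ^ suc d * (upto s (suc d) * from s (suc d)) ∎
      where
      F = Φ κ (s + suc d · a) x
      D = denominator (s + suc (suc d) · a)

    -- Frobenius distributes the `p`-th power over the sum, after which `κ` occurs only through
    -- `κ ^ p` and can be eliminated.
    resultant≈0 : ∀ P Q → κ ^ p * P s ≈ Q s → J κ s x k ≈ 0# → resultant P Q s ≈ 0#
    resultant≈0 P Q κP≈Q J≈0 = begin
      resultant P Q s
        ≈⟨ sum-cong {p} (λ d → term (toℕ d) (ℕ.≤-pred (toℕ<n d))) ⟩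
      sum {p} (λ d → P s ^ p-1 * (w (toℕ d) * ψ (toℕ d) * from s 0) ^ p)
        ≈⟨ *-distribˡ-sum {p} (P s ^ p-1) (λ d → (w (toℕ d) * ψ (toℕ d) * from s 0) ^ p) ⟨
      P s ^ p-1 * sum {p} (λ d → (w (toℕ d) * ψ (toℕ d) * from s 0) ^ p)
        ≈⟨ *-congˡ (frobenius-sum {p} (λ d → w (toℕ d) * ψ (toℕ d) * from s 0)) ⟨
      P s ^ p-1 * sum {p} (λ d → w (toℕ d) * ψ (toℕ d) * from s 0) ^ p
        ≈⟨ *-congˡ (^-congˡ p (*-distribʳ-sum {p} (from s 0) (λ d → w (toℕ d) * ψ (toℕ d)))) ⟨
      P s ^ p-1 * (rotated κ s * from s 0) ^ p
        ≈⟨ *-congˡ (^-congˡ p (trans (*-congʳ (rotated≈0 J≈0)) (zeroˡ _))) ⟩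
      P s ^ p-1 * 0# ^ p
        ≈⟨ trans (*-congˡ 0^p≈0) (zeroʳ _) ⟩
      0# ∎
      where
      w : ℕ → Carrier
      w d = W (s + suc d · a) x k
      powers : ∀ d → d ℕ.≤ p-1 → P s ^ (p-1 ∸ d) * Q s ^ d ≈ P s ^ p-1 * (κ ^ d) ^ p
      powers d d≤ = begin
        P s ^ (p-1 ∸ d) * Q s ^ d
          ≈⟨ *-congˡ (^-congˡ d κP≈Q) ⟨
        P s ^ (p-1 ∸ d) * (κ ^ p * P s) ^ d
          ≈⟨ *-congˡ (^-distrib-* (κ ^ p) (P s) d) ⟩
        P s ^ (p-1 ∸ d) * ((κ ^ p) ^ d * P s ^ d)
          ≈⟨ solve 3 (λ x k y → x ⊗ (k ⊗ y) ⊜ (x ⊗ y) ⊗ k) refl (P s ^ (p-1 ∸ d)) ((κ ^ p) ^ d) (P s ^ d) ⟩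
        P s ^ (p-1 ∸ d) * P s ^ d * (κ ^ p) ^ d
          ≈⟨ *-cong (sym (^-homo-* (P s) (p-1 ∸ d) d)) (trans (^-assocʳ κ p d)
               (trans (reflexive (≡.cong (κ ^_) (ℕ.*-comm p d))) (sym (^-assocʳ κ d p)))) ⟩
        P s ^ (p-1 ∸ d ℕ.+ d) * (κ ^ d) ^ p
          ≡⟨ ≡.cong (λ i → P s ^ i * (κ ^ d) ^ p) (ℕ.m∸n+n≡m d≤) ⟩
        P s ^ p-1 * (κ ^ d) ^ p ∎
      term : ∀ d → d ℕ.≤ p-1 → resultant-term P Q s d ≈ P s ^ p-1 * (w d * ψ d * from s 0) ^ p
      term d d≤ = begin
        P s ^ (p-1 ∸ d) * Q s ^ d * coefficient s d ^ p
          ≈⟨ *-congʳ (powers d d≤) ⟩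
        P s ^ p-1 * (κ ^ d) ^ p * coefficient s d ^ p
          ≈⟨ *-assoc _ _ _ ⟩
        P s ^ p-1 * ((κ ^ d) ^ p * coefficient s d ^ p)
          ≈⟨ *-congˡ (^-distrib-* (κ ^ d) (coefficient s d) p) ⟨
        P s ^ p-1 * (κ ^ d * coefficient s d) ^ p
          ≈⟨ *-congˡ (^-congˡ p (begin
               κ ^ d * (w d * (upto s d * from s d))  ≈⟨ solve 3 (λ k w u → k ⊗ (w ⊗ u) ⊜ w ⊗ (k ⊗ u)) refl (κ ^ d) (w d) (upto s d * from s d) ⟩
               w d * (κ ^ d * (upto s d * from s d))  ≈⟨ *-congˡ (ψ-cleared d d≤) ⟨
               w d * (ψ d * from s 0)                 ≈⟨ *-assoc _ _ _ ⟨
               w d * ψ d * from s 0                   ∎)) ⟩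
        P s ^ p-1 * (w d * ψ d * from s 0) ^ p ∎

  -- At a zero of `P` every term but the last has a factor `P`, and the last is a product of nonzero
  -- values.
  resultant-#0 : ∀ P Q y → P y ≈ 0# → Q y # 0# → W y x k # 0# →
    (∀ j → j ℕ.< p-1 → numerator (y + suc j · a) # 0#) → resultant P Q y # 0#
  resultant-#0 P Q y P≈0 Q#0 W#0 numerator#0 = #0-cong (sym (begin
      resultant P Q y
        ≈⟨ sum-last p-1 (resultant-term P Q y) ⟩
      sum {p-1} (λ d → resultant-term P Q y (toℕ d)) + resultant-term P Q y p-1
        ≈⟨ +-cong (sum-zero {p-1} (λ d → vanishes (toℕ d) (toℕ<n d))) refl ⟩
      0# + resultant-term P Q y p-1
        ≈⟨ +-identityˡ _ ⟩
      P y ^ (p-1 ∸ p-1) * Q y ^ p-1 * coefficient y p-1 ^ p ∎))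
    (x#0y#0→xy#0 (x#0y#0→xy#0 P⁰#0 (^-#0 p-1 Q#0)) (^-#0 p (x#0y#0→xy#0
      -- The last summand evaluates `W` at `y + p · a`, which is `y` again; the rotation was made
      -- for this.
      (#0-cong (W-cong (sym (trans (+-congˡ (p·≈0 a)) (+-identityʳ y))) (λ _ → refl) k) W#0)
      (x#0y#0→xy#0 (product-#0 {p-1} λ j → numerator#0 (toℕ j) (toℕ<n j)) from#0))))
    where
    P⁰#0 : P y ^ (p-1 ∸ p-1) # 0#
    P⁰#0 rewrite ℕ.n∸n≡0 p-2 = 1#0
    from#0 : from y p-1 # 0#
    from#0 rewrite ℕ.n∸n≡0 p-2 = 1#0
    vanishes : ∀ d → d ℕ.< p-1 → resultant-term P Q y d ≈ 0#
    vanishes d (ℕ.s≤s d≤) rewrite ℕ.+-∸-assoc 1 d≤ =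
      trans (*-congʳ (trans (*-congʳ (trans (*-congʳ P≈0) (zeroˡ _))) (zeroˡ _))) (zeroˡ _)

  resultant-polynomial : ∀ {P Q} → IsPolynomial P → IsPolynomial Q → IsPolynomial (resultant P Q)
  resultant-polynomial P-poly Q-poly = poly-sum {p} λ d →
    poly-* (poly-* (poly-^ (p-1 ∸ toℕ d) P-poly) (poly-^ (toℕ d) Q-poly)) (poly-^ p
      (poly-* (poly-product λ l → W-poly (suc (toℕ d) · a) l)
        (poly-* (poly-product {toℕ d} λ j → poly-product λ l → poly-+ (linear (suc (toℕ j) · a) (x l)) (poly-const (Λ l)))
          (poly-product {p-1 ∸ toℕ d} λ j → poly-product λ l → linear (suc (suc (toℕ d ℕ.+ toℕ j)) · a) (x l)))))
    where
    linear : ∀ t z → IsPolynomial (λ s → s + t - z)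
    linear t z = poly-+ (poly-+ poly-id (poly-const t)) (poly-const (- z))
    W-poly : ∀ t l → IsPolynomial (λ s → if does (l Fin.<? k) then s + t - x l + Λ l else
                                         if does (k Fin.<? l) then s + t - x l       else 1#)
    W-poly t l with does (l Fin.<? k) | does (k Fin.<? l)
    ... | true  | _     = poly-+ (linear t (x l)) (poly-const (Λ l))
    ... | false | true  = linear t (x l)
    ... | false | false = poly-const 1#

  J-zeros-finite : ∀ {P Q} → IsPolynomial P → IsPolynomial Q → ∀ y → P y ≈ 0# → Q y # 0# → W y x k # 0# →
    (∀ j → j ℕ.< p-1 → numerator (y + suc j · a) # 0#) →
    ∃ λ rs → ∀ κ s → (∀ d l → s + d · a - x l # 0#) → φ κ s x p ≈ 1# → κ ^ p * P s ≈ Q s →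
             J κ s x k ≈ 0# → Any (s ≈_) rs
  J-zeros-finite {P} {Q} P-poly Q-poly y P≈0 Q#0 W#0 numerator#0 =
    proj₁ roots , λ κ s β#0 periodic κP≈Q J≈0 → proj₂ roots s (resultant≈0 κ s β#0 periodic P Q κP≈Q J≈0)
    where
    roots = finite-roots (resultant-polynomial P-poly Q-poly) y (resultant-#0 P Q y P≈0 Q#0 W#0 numerator#0)

-- Products of linear factors with period a

module PeriodicProducts {c ℓ₁ ℓ₂} (em : ExcludedMiddle (c ⊔ ℓ₁ ⊔ ℓ₂)) (K : HeytingField c ℓ₁ ℓ₂)
  (p-2 : ℕ) (char : OverField.HasCharacteristic em K (2 ℕ.+ p-2)) (a : HeytingField.Carrier K) where

  private module F = FieldBase em K
  open F using (Carrier; 1#; Poly; con; var; _:+_; ⟦_⟧ˢ; Series; constant; _·_)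
  open FormalSeries em K using (ring-S; constant-cong; constant-+-homo)
  open Polynomials em K
  open Characteristic em K p-2 char using (p; p·≈0)
  private module AK = InAlgebra algebra-K
  private module AS = InAlgebra algebra-S

  linear : Carrier → Fin p → Poly 1
  linear t j = var zero :+ con (t F.+ toℕ j · a)

  periodic : ∀ {n} → Vector Carrier n → Poly 1
  periodic {n} t = productP {n = n} λ l → productP {n = p} (linear (t l))

  -- Follows the lengths produced by `mulLinears`; for `suc n` it reduces to a successor, the form
  -- that `specialization` requires.
  size : ℕ → ℕ
  size zero    = 0
  size (suc n) = p ℕ.+ size n

  -- A monic Horner form of `periodic`: divided differences need the syntax tree, lying over needs
  -- the coefficients.
  periodic-vec : ∀ {n} → Vector Carrier n → Vec Carrier (size n)
  periodic-vec {zero}  t = []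
  periodic-vec {suc n} t = mulLinears {p} (λ j → t zero F.+ toℕ j · a) (periodic-vec (t ∘ suc))

  module InAlgebra′ (𝔸 : KAlgebra) where
    open KAlgebra 𝔸
    open InAlgebra 𝔸
    private module R = CommutativeRing algebraRing
    private module L = RingLemmas algebraRing

    eval-periodic : ∀ {n} (t : Vector Carrier n) x → eval (periodic t) (at x) R.≈
      L.product λ l → L.product {p} λ j → x R.+ ι (t l F.+ toℕ j · a)
    eval-periodic {n} t x = R.trans (eval-product {n = n} (λ l → productP {n = p} (linear (t l))) (at x)) (L.product-cong {n} λ l →
      R.trans (eval-product {n = p} (linear (t l)) (at x)) (L.product-cong {p} λ j →
        R.trans (eval-+ (var zero) (con (t l F.+ toℕ j · a)) (at x))
          (R.+-cong (eval-var zero (at x)) (eval-con (t l F.+ toℕ j · a) (at x)))))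

    horner-periodic : ∀ {n} (t : Vector Carrier n) x → horner 𝔸 1# (periodic-vec t) x R.≈
      L.product λ l → L.product {p} λ j → x R.+ ι (t l F.+ toℕ j · a)
    horner-periodic {zero}  t x = ι-1
    horner-periodic {suc n} t x = R.trans (monic-mulLinears {p} (λ j → t zero F.+ toℕ j · a) (periodic-vec (t ∘ suc)) x)
      (R.*-congˡ (horner-periodic (t ∘ suc) x))

    horner≈eval : ∀ {n} (t : Vector Carrier n) x → horner 𝔸 1# (periodic-vec t) x R.≈ eval (periodic t) (at x)
    horner≈eval t x = R.trans (horner-periodic t x) (R.sym (eval-periodic t x))

  private module PS = InAlgebra′ algebra-S
  open CommutativeRing ring-S hiding (zero; rawRing; Carrier)
    renaming (_≈_ to _≈ˢ_; _+_ to _+ˢ_; _*_ to _*ˢ_)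
  open RingLemmas ring-S using (product; product-cong; product-last)
  open import Relation.Binary.Reasoning.Setoid setoid

  -- Adding `a` rotates the `p` factors at each position. The statement concerns series because it
  -- is applied to branches before they are specialized.
  periodic-+a : ∀ {n} (t : Vector Carrier n) X → ⟦ periodic t ⟧ˢ (AS.at (X +ˢ constant a)) ≈ˢ ⟦ periodic t ⟧ˢ (AS.at X)
  periodic-+a {n} t X = trans (PS.eval-periodic t (X +ˢ constant a)) (trans (product-cong {n} rotate) (sym (PS.eval-periodic t X)))
    where
    rotate : ∀ l → product {p} (λ j → (X +ˢ constant a) +ˢ constant (t l F.+ toℕ j · a))
               ≈ˢ product {p} (λ j → X +ˢ constant (t l F.+ toℕ j · a))
    rotate l = begin
      product {p} (λ j → (X +ˢ constant a) +ˢ constant (t l F.+ toℕ j · a))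
        ≈⟨ product-cong {p} (λ j → trans (+-assoc X (constant a) (constant (t l F.+ toℕ j · a)))
             (+-congˡ {X} (trans (sym (constant-+-homo a (t l F.+ toℕ j · a)))
               (constant-cong (F.solve 3 (λ a t d → a F.⊕ (t F.⊕ d) F.⊜ t F.⊕ (a F.⊕ d)) F.refl a (t l) (toℕ j · a)))))) ⟩
      product {p} (λ j → f (suc (toℕ j)))
        ≈⟨ product-last (suc p-2) (f ∘ suc) ⟩
      product {suc p-2} (λ j → f (suc (toℕ j))) *ˢ f p
        ≈⟨ *-comm (product {suc p-2} (λ j → f (suc (toℕ j)))) (f p) ⟩
      f p *ˢ product {suc p-2} (λ j → f (suc (toℕ j)))
        ≈⟨ *-congʳ {product {suc p-2} (λ j → f (suc (toℕ j)))} (+-congˡ {X} (constant-cong (F.+-congˡ (p·≈0 a)))) ⟩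
      product {p} (λ j → f (toℕ j)) ∎
      where
      f : ℕ → Series
      f d = X +ˢ constant (t l F.+ d · a)

  periodic-+k·a : ∀ {n} (t : Vector Carrier n) X k → ⟦ periodic t ⟧ˢ (AS.at (X +ˢ constant (k · a))) ≈ˢ ⟦ periodic t ⟧ˢ (AS.at X)
  periodic-+k·a t X zero    = AS.eval-cong (periodic t) λ _ → trans (+-congˡ {X} (KAlgebra.ι-0 algebra-S)) (+-identityʳ X)
  periodic-+k·a t X (suc k) = begin
    ⟦ periodic t ⟧ˢ (AS.at (X +ˢ constant (a F.+ k · a)))
      ≈⟨ AS.eval-cong (periodic t) (λ _ → trans (+-congˡ {X} (trans (constant-cong (F.+-comm a (k · a))) (constant-+-homo (k · a) a)))
           (sym (+-assoc X (constant (k · a)) (constant a)))) ⟩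
    ⟦ periodic t ⟧ˢ (AS.at ((X +ˢ constant (k · a)) +ˢ constant a))
      ≈⟨ periodic-+a t (X +ˢ constant (k · a)) ⟩
    ⟦ periodic t ⟧ˢ (AS.at (X +ˢ constant (k · a)))
      ≈⟨ periodic-+k·a t X k ⟩
    ⟦ periodic t ⟧ˢ (AS.at X) ∎

-- The Bethe equation, its branches and the exceptional parameters

module Solution {c ℓ₁ ℓ₂} (em : ExcludedMiddle (c ⊔ ℓ₁ ⊔ ℓ₂)) (K : HeytingField c ℓ₁ ℓ₂)
  (closed : OverField.AlgebraicallyClosed em K)
  (p-2 : ℕ) (char : OverField.HasCharacteristic em K (2 ℕ.+ p-2)) {n′ : ℕ}
  (Λ : Vector (HeytingField.Carrier K) (suc n′)) (a : HeytingField.Carrier K)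
  (x : Vector (HeytingField.Carrier K) (suc n′))
  (distinct-factors : OverField.QKZ.DistinctFactors em K (2 ℕ.+ p-2) Λ a x) where

  private
    n = suc n′

  open FieldBase em K
  open Polynomials em K
  open PolynomialFunctions em K
  open Branches em K
  open LinearAlgebra em K
  open Characteristic em K p-2 char hiding (module AdditivePolynomial)
  open PeriodicProducts em K p-2 char a
  open QKZ p Λ a hiding (h)
  open Curvature em K p-2 char Λ a using (φ; Regular; module Regular; bethe-periodic; curvature-eigenvector)
  private module AK = InAlgebra algebra-K
  private module AS = InAlgebra algebra-S
  private module PK = InAlgebra′ algebra-K
  private module PS = InAlgebra′ algebra-S
  private module S = CommutativeRing (FormalSeries.ring-S em K)
  private module L = RingLemmas (FormalSeries.ring-S em K)
  private module SR = SetoidReasoning S.setoid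
  open import Relation.Binary.Reasoning.Setoid setoid

  inj₁≢inj₂ : ∀ {u v : Fin n × Fin p} → inj₁ u ≢ inj₂ v
  inj₁≢inj₂ ()

  -- Two denominator factors at one position differ by the difference of their multiples of `a`.
  multiples-distinct : ∀ i j → i ℕ.< p → j ℕ.< p → i ≢ j → i · a # j · a
  multiples-distinct i j i<p j<p i≢j = ≉⇒# λ eq → #⇒≉
    (distinct-factors (inj₂ (zero , fromℕ< i<p)) (inj₂ (zero , fromℕ< j<p)) λ same →
      i≢j (≡.trans (≡.sym (toℕ-fromℕ< i<p)) (≡.trans (≡.cong toℕ (,-injectiveʳ (inj₂-injective same))) (toℕ-fromℕ< j<p))))
    (+-congˡ (trans (reflexive (≡.cong (_· a) (toℕ-fromℕ< i<p))) (trans eq (reflexive (≡.cong (_· a) (≡.sym (toℕ-fromℕ< j<p)))))))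

  open Characteristic.AdditivePolynomial em K p-2 char a multiples-distinct

  y : Fin n → Carrier
  y i = x i - Λ i

  y-root : ∀ i → y i + constantTerm x (inj₁ (i , zero)) ≈ 0#
  y-root i = solve 2 (λ x L → x ⊟ L ⊕ (⊝ x ⊕ L ⊕ 𝟎) ⊜ 𝟎) refl (x i) (Λ i)

  y-other : ∀ i u → u ≢ inj₁ (i , zero) → y i + constantTerm x u # 0#
  y-other i u u≢ = ≉⇒# λ y+u≈0 → #⇒≉ (distinct-factors u (inj₁ (i , zero)) u≢) (begin
    u′                      ≈⟨ solve 2 (λ y u → u ⊜ (y ⊕ u) ⊟ y) refl (y i) u′ ⟩
    (y i + u′) - y i        ≈⟨ +-congʳ (trans y+u≈0 (sym (y-root i))) ⟩
    (y i + v′) - y i        ≈⟨ solve 2 (λ y u → u ⊜ (y ⊕ u) ⊟ y) refl (y i) v′ ⟨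
    v′                      ∎)
    where
    u′ = constantTerm x u
    v′ = constantTerm x (inj₁ (i , zero))

  c₁ c₂ : Vector Carrier n
  c₁ l = - x l + Λ l
  c₂ l = - x l

  P Q : Poly 1
  P = periodic c₁
  Q = periodic c₂

  value-P value-Q : Carrier → Carrier
  value-P s = ⟦ P ⟧ (AK.at s)
  value-Q s = ⟦ Q ⟧ (AK.at s)

  P-simple : ∀ i → SimpleZero P (y i)
  P-simple i = simple-zero-product (λ l → productP {n = p} (linear (c₁ l))) (y i) i
    (simple-zero-product (linear (c₁ i)) (y i) zero (simple-zero-linear (c₁ i + 0#) (y i) (y-root i))
      (λ j j≢0 → y-other i (inj₁ (i , j)) λ same → j≢0 (,-injectiveʳ (inj₁-injective same))))
    (λ l l≢i → #0-cong (sym (AK.eval-product (linear (c₁ l)) (AK.at (y i))))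
      (product-#0 {p} λ j → y-other i (inj₁ (l , j)) λ same → l≢i (,-injectiveˡ (inj₁-injective same))))

  Q-y : ∀ i → value-Q (y i) # 0#
  Q-y i = #0-cong (sym (PK.eval-periodic c₂ (y i))) (product-#0 λ l → product-#0 {p} λ j → y-other i (inj₂ (l , j)) λ ())

  branch : ∀ i → ∃ λ b → (b 0 ≈ y i) × (⟦ P ⟧ˢ (AS.at b) S.≈ ε L.^ p S.* ⟦ Q ⟧ˢ (AS.at b))
  branch i = hensel P Q p-2 (y i) (P-simple i)

  b : Vector Series n
  b i = proj₁ (branch i)

  b-equation : ∀ i → ⟦ P ⟧ˢ (AS.at (b i)) S.≈ ε L.^ p S.* ⟦ Q ⟧ˢ (AS.at (b i))
  b-equation i = proj₂ (proj₂ (branch i))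

  is-branch : ∀ i → IsBranch x i (b i)
  is-branch i = proj₁ (proj₂ (branch i)) ,
    S.trans (S.sym (PS.eval-periodic c₁ (b i))) (S.trans (b-equation i) (S.*-congˡ {ε L.^ p} (PS.eval-periodic c₂ (b i))))

  value-P≈ : ∀ s → value-P s ≈ product λ l → h (s - x l + Λ l)
  value-P≈ s = trans (PK.eval-periodic c₁ s) (product-cong λ l → trans
    (product-cong {p} λ j → solve 4 (λ s x L d → s ⊕ (⊝ x ⊕ L ⊕ d) ⊜ s ⊟ x ⊕ L ⊕ d) refl s (x l) (Λ l) (toℕ j · a))
    (sym (h-product (s - x l + Λ l))))

  value-Q≈ : ∀ s → value-Q s ≈ product λ l → h (s - x l)
  value-Q≈ s = trans (PK.eval-periodic c₂ s) (product-cong λ l → trans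
    (product-cong {p} λ j → sym (+-assoc s (- x l) (toℕ j · a)))
    (sym (h-product (s - x l))))

  root-of : ∀ {u v} s → s + constantTerm x u ≈ 0# → s + constantTerm x v ≈ 0# → ¬ u ≢ v
  root-of {u} {v} s u≈0 v≈0 u≢v = #⇒≉ (distinct-factors u v u≢v) (begin
    constantTerm x u            ≈⟨ solve 2 (λ s u → u ⊜ (s ⊕ u) ⊟ s) refl s (constantTerm x u) ⟩
    (s + constantTerm x u) - s  ≈⟨ +-congʳ (trans u≈0 (sym v≈0)) ⟩
    (s + constantTerm x v) - s  ≈⟨ solve 2 (λ s u → u ⊜ (s ⊕ u) ⊟ s) refl s (constantTerm x v) ⟨
    constantTerm x v            ∎)

  factor-zero : ∀ (t : Vector Carrier n) s → ⟦ periodic t ⟧ (AK.at s) ≈ 0# → ∃ λ l → ∃ λ j → s + (t l + toℕ j · a) ≈ 0#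
  factor-zero t s ≈0 = proj₁ outer , product-≈0 {p} {f (proj₁ outer)} (proj₂ outer)
    where
    f : Fin n → Fin p → Carrier
    f l j = s + (t l + toℕ j · a)
    outer : ∃ λ l → product (f l) ≈ 0#
    outer = product-≈0 {n} {λ l → product (f l)} (trans (sym (PK.eval-periodic t s)) ≈0)

  no-common-zero : ∀ s → value-P s ≈ 0# → ¬ value-Q s ≈ 0#
  no-common-zero s P≈0 Q≈0 = root-of {inj₁ (proj₁ u , proj₁ (proj₂ u))} {inj₂ (proj₁ v , proj₁ (proj₂ v))} s
      (proj₂ (proj₂ u)) (proj₂ (proj₂ v)) λ ()
    where
    u = factor-zero c₁ s P≈0
    v = factor-zero c₂ s Q≈0

  Bethe : Carrier → Carrier → Set ℓ₁
  Bethe r κ = κ ^ p * value-P r ≈ value-Q r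

  -- As a polynomial in `κ` the equation is not trivial because `P` and `Q` have no common zero: it
  -- fails at `1#` if `Q` vanishes at `r`, and at `0#` otherwise.
  bethe-finite : ∀ r → ∃ λ ks → ∀ κ → Bethe r κ → Any (κ ≈_) ks
  bethe-finite r = proj₁ roots , λ κ bethe → proj₂ roots κ (≈⇒-≈0 bethe)
    where
    f : Carrier → Carrier
    f κ = κ ^ p * value-P r - value-Q r
    f-polynomial : IsPolynomial f
    f-polynomial = poly-+ (poly-* (poly-^ p poly-id) (poly-const (value-P r))) (poly-const (- value-Q r))
    nonzero : Dec (value-Q r ≈ 0#) → ∃ λ κ → f κ # 0#
    nonzero (yes Q≈0) = 1# , ≉⇒# λ f≈0 → no-common-zero r (begin
      value-P r                          ≈⟨ trans (*-congʳ (1^ p)) (*-identityˡ _) ⟨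
      1# ^ p * value-P r                 ≈⟨ -≈0⇒≈ f≈0 ⟩
      value-Q r                          ≈⟨ Q≈0 ⟩
      0#                                 ∎) Q≈0
    nonzero (no Q≉0) = 0# , ≉⇒# λ f≈0 → Q≉0 (begin
      value-Q r                          ≈⟨ -≈0⇒≈ f≈0 ⟨
      0# ^ p * value-P r                 ≈⟨ trans (*-congʳ 0^p≈0) (zeroˡ _) ⟩
      0#                                 ∎)
    point = nonzero (value-Q r ≟ 0#)
    roots = finite-roots f-polynomial (proj₁ point) (proj₂ point)

  bethe-cong : ∀ {r r′} κ → r ≈ r′ → Bethe r κ → Bethe r′ κ
  bethe-cong κ r≈r′ bethe = trans (*-congˡ (AK.eval-cong P λ _ → sym r≈r′)) (trans bethe (AK.eval-cong Q λ _ → r≈r′))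

  -- Its zeros are the critical points of P / Q, where two solutions of the
  -- Bethe equation can merge.
  wronskian : Carrier → Carrier
  wronskian t = ⟦ DD P ⟧ (AK.pair t t) * value-Q t - value-P t * ⟦ DD Q ⟧ (AK.pair t t)

  diagonal : ∀ (i : Fin 2) → IsPolynomial (λ t → AK.pair t t i)
  diagonal zero    = poly-id
  diagonal (suc _) = poly-id

  P-polynomial : IsPolynomial value-P
  P-polynomial = P , λ _ → refl

  Q-polynomial : IsPolynomial value-Q
  Q-polynomial = Q , λ _ → refl

  wronskian-polynomial : IsPolynomial wronskian
  wronskian-polynomial = poly-+ (poly-* (poly-eval (DD P) diagonal) Q-polynomial)
    (poly-neg (poly-* P-polynomial (poly-eval (DD Q) diagonal)))

  -- At a simple zero of `P` where `Q` does not vanish, only the term with the derivative of `P`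
  -- survives, and it is nonzero.
  wronskian-#0 : wronskian (y zero) # 0#
  wronskian-#0 = #0-cong (sym (trans (+-congˡ (trans (-‿cong (trans (*-congʳ (proj₁ (P-simple zero))) (zeroˡ _))) -0#≈0#))
    (+-identityʳ _))) (x#0y#0→xy#0 (proj₂ (P-simple zero)) (Q-y zero))

  module V (k : Fin n) = BetheVector em K p-2 char Λ a x k

  -- The only numerator factor that vanishes at `y k` belongs to position `k`, which component `k`
  -- omits.
  W-y : ∀ k → W (y k) x k # 0#
  W-y k = product-#0 factor
    where
    factor : ∀ l → (if does (l Fin.<? k) then y k - x l + Λ l else if does (k Fin.<? l) then y k - x l else 1#) # 0#
    factor l with toℕ l ℕ.<ᵇ toℕ k in l<k | toℕ k ℕ.<ᵇ toℕ l
    ... | true  | _     = #0-cong (solve 3 (λ y x L → y ⊕ (⊝ x ⊕ L ⊕ 𝟎) ⊜ y ⊟ x ⊕ L) refl (y k) (x l) (Λ l))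
      (y-other k (inj₁ (l , zero)) λ same → Fin.<⇒≢ (ℕ.<ᵇ⇒< _ _ (≡.subst Bool.T (≡.sym l<k) tt)) (,-injectiveˡ (inj₁-injective same)))
    ... | false | true  = #0-cong (solve 2 (λ y x → y ⊕ (⊝ x ⊕ 𝟎) ⊜ y ⊟ x) refl (y k) (x l))
      (y-other k (inj₂ (l , zero)) λ ())
    ... | false | false = 1#0

  numerator-y : ∀ k j → j ℕ.< suc p-2 → V.numerator k (y k + suc j · a) # 0#
  numerator-y k j j<p-1 = product-#0 λ l → #0-cong (begin
    y k + (- x l + Λ l + toℕ j′ · a)    ≈⟨ solve 4 (λ y x L d → y ⊕ (⊝ x ⊕ L ⊕ d) ⊜ y ⊕ d ⊟ x ⊕ L) refl (y k) (x l) (Λ l) (toℕ j′ · a) ⟩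
    y k + toℕ j′ · a - x l + Λ l        ≡⟨ ≡.cong (λ i → y k + i · a - x l + Λ l) (toℕ-fromℕ< (ℕ.s≤s j<p-1)) ⟩
    y k + suc j · a - x l + Λ l         ∎)
    (y-other k (inj₁ (l , j′)) λ same → nonzero (≡.trans (≡.sym (toℕ-fromℕ< (ℕ.s≤s j<p-1))) (≡.cong toℕ (,-injectiveʳ (inj₁-injective same)))))
    where
    j′ : Fin p
    j′ = fromℕ< (ℕ.s≤s j<p-1)
    nonzero : ¬ (suc j ≡ 0)
    nonzero ()

  J-zeros : ∀ k → ∃ λ rs → ∀ κ s → (∀ d l → s + d · a - x l # 0#) → φ κ s x p ≈ 1# → Bethe s κ →
            J κ s x k ≈ 0# → Any (s ≈_) rs
  J-zeros k = V.J-zeros-finite k P-polynomial Q-polynomial (y k) (proj₁ (P-simple k)) (Q-y k) (W-y k) (numerator-y k)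

  wronskian-roots : ∃ λ rs → ∀ t → wronskian t ≈ 0# → Any (t ≈_) rs
  wronskian-roots = finite-roots wronskian-polynomial (y zero) wronskian-#0

  critical : List Carrier
  critical = proj₁ wronskian-roots ++ List.concat (List.tabulate λ k → proj₁ (J-zeros k))

  bethe-critical : ∃ λ ks → ∀ r κ → Any (r ≈_) critical → Bethe r κ → Any (κ ≈_) ks
  bethe-critical = finite-union bethe-cong bethe-finite critical

  -- The parameters at which the branches cease to be integral: the leading coefficient `1 - ε ^ p`
  -- vanishes at `κ ⁻¹`.
  roots-of-unity : ∃ λ ks → ∀ κ → κ ^ p - 1# ≈ 0# → Any (κ ≈_) ks
  roots-of-unity = finite-roots (poly-+ (poly-^ p poly-id) (poly-const (- 1#))) 0#
    (≉⇒# λ eq → #⇒≉ 1#0 (trans (sym (-≈0⇒≈ eq)) 0^p≈0))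

  exceptional : List Carrier
  exceptional = proj₁ roots-of-unity ++ proj₁ bethe-critical

  -- Solutions, eigenvectors and the basis at a generic parameter

  module AtParameter (b : Vector Series n) (b₀≈y : ∀ i → b i 0 ≈ y i)
    (b-equation : ∀ i → ⟦ P ⟧ˢ (AS.at (b i)) S.≈ ε L.^ p S.* ⟦ Q ⟧ˢ (AS.at (b i)))
    (κ : Carrier) (κ#0 : κ # 0#) (avoids : ¬ Any (κ ≈_) exceptional) where

    e : Carrier
    e = κ ⁻¹

    κe : κ ^ p * e ^ p ≈ 1#
    κe = trans (sym (^-distrib-* κ e p)) (trans (^-congˡ p (⁻¹-inverseʳ κ#0)) (1^ p))

    1-eᵖ#0 : 1# - e ^ p # 0#
    1-eᵖ#0 = ≉⇒# λ eq → avoids (++⁺ˡ (proj₂ roots-of-unity κ (≈⇒-≈0 (begin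
      κ ^ p           ≈⟨ *-identityʳ _ ⟨
      κ ^ p * 1#      ≈⟨ *-congˡ (-≈0⇒≈ eq) ⟩
      κ ^ p * e ^ p   ≈⟨ κe ⟩
      1#              ∎))))

    specialize : ∀ {N} (P-vec Q-vec : Vec Carrier (suc N)) → _
    specialize {N} P-vec Q-vec = Specialization.specialization em K closed {n} {N} P-vec Q-vec p e 1-eᵖ#0 b

    specialized : ∃ λ s → IsSpecialization b e s
    specialized = specialize P-vec Q-vec relation
      where
      P-vec Q-vec : Vec Carrier (size n)
      P-vec = periodic-vec c₁
      Q-vec = periodic-vec c₂
      relation : ∀ i → horner algebra-S 1# P-vec (b i) S.≈ ε L.^ p S.* horner algebra-S 1# Q-vec (b i)
      relation i = SR.begin
        horner algebra-S 1# P-vec (b i)                    SR.≈⟨ PS.horner≈eval c₁ (b i) ⟩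
        ⟦ P ⟧ˢ (AS.at (b i))                               SR.≈⟨ b-equation i ⟩
        ε L.^ p S.* ⟦ Q ⟧ˢ (AS.at (b i))                   SR.≈⟨ S.*-congˡ {ε L.^ p} (PS.horner≈eval c₂ (b i)) ⟨
        ε L.^ p S.* horner algebra-S 1# Q-vec (b i)        SR.∎

    module AtSolution (s : Fin n → Carrier) (specializes : IsSpecialization b e s) where

      specializes-equal : ∀ G H → ⟦ G ⟧ˢ (ε Vector.∷ b) S.≈ ⟦ H ⟧ˢ (ε Vector.∷ b) → ⟦ G ⟧ (e Vector.∷ s) ≈ ⟦ H ⟧ (e Vector.∷ s)
      specializes-equal G H G≈H = -≈0⇒≈ (trans (sym (AK.eval-minus G H (e Vector.∷ s)))
        (specializes (G :- H) (S.trans (AS.eval-minus G H (ε Vector.∷ b)) (L.≈⇒-≈0 G≈H))))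

      bethe-specialized : ∀ i → value-P (s i) ≈ e ^ p * value-Q (s i)
      bethe-specialized i = begin
        value-P (s i)                 ≈⟨ AK.eval-subst P (λ _ → var (suc i)) (e Vector.∷ s) ⟨
        ⟦ Pᵢ ⟧ (e Vector.∷ s)         ≈⟨ specializes-equal Pᵢ (powP (var zero) p :* Qᵢ) (S.trans
          (AS.eval-subst P (λ _ → var (suc i)) (ε Vector.∷ b)) (S.trans (b-equation i)
            (S.sym (S.*-cong (AS.eval-pow (var zero) p (ε Vector.∷ b)) (AS.eval-subst Q (λ _ → var (suc i)) (ε Vector.∷ b)))))) ⟩
        ⟦ powP (var zero) p ⟧ (e Vector.∷ s) * ⟦ Qᵢ ⟧ (e Vector.∷ s)
          ≈⟨ *-cong (AK.eval-pow (var zero) p (e Vector.∷ s)) (AK.eval-subst Q (λ _ → var (suc i)) (e Vector.∷ s)) ⟩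
        e ^ p * value-Q (s i)         ∎
        where
        Pᵢ Qᵢ : Poly (suc n)
        Pᵢ = substP P (λ _ → var (suc i))
        Qᵢ = substP Q (λ _ → var (suc i))

      bethe : ∀ i → Bethe (s i) κ
      bethe i = begin
        κ ^ p * value-P (s i)               ≈⟨ *-congˡ (bethe-specialized i) ⟩
        κ ^ p * (e ^ p * value-Q (s i))     ≈⟨ *-assoc _ _ _ ⟨
        κ ^ p * e ^ p * value-Q (s i)       ≈⟨ *-congʳ κe ⟩
        1# * value-Q (s i)                  ≈⟨ *-identityˡ _ ⟩
        value-Q (s i)                       ∎

      not-critical : ∀ i → ¬ Any (s i ≈_) critical
      not-critical i s∈ = avoids (++⁺ʳ (proj₁ roots-of-unity) (proj₂ bethe-critical (s i) κ s∈ (bethe i)))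

      Q#0 : ∀ i → value-Q (s i) # 0#
      Q#0 i = ≉⇒# λ Q≈0 → no-common-zero (s i) (trans (bethe-specialized i) (trans (*-congˡ Q≈0) (zeroʳ _))) Q≈0

      P#0 : ∀ i → value-P (s i) # 0#
      P#0 i = #0-cong (sym (bethe-specialized i)) (x#0y#0→xy#0 (^-#0 p (⁻¹-#0 κ#0)) (Q#0 i))

      factor-#0 : ∀ {f : Vector Carrier n} → product f # 0# → ∀ l → f l # 0#
      factor-#0 {f} product#0 l = ≉⇒# λ fl≈0 → #⇒≉ product#0 (product-zero {n} {f} l fl≈0)

      hβ#0 : ∀ i l → h (s i - x l) # 0#
      hβ#0 i = factor-#0 {λ l → h (s i - x l)} (#0-cong (value-Q≈ (s i)) (Q#0 i))

      hα#0 : ∀ i l → h (s i - x l + Λ l) # 0#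
      hα#0 i = factor-#0 {λ l → h (s i - x l + Λ l)} (#0-cong (value-P≈ (s i)) (P#0 i))

      h-#0 : ∀ {u} → h u # 0# → u # 0#
      h-#0 hu#0 = ≉⇒# λ u≈0 → #⇒≉ hu#0 (trans (h-cong u≈0) h-0)

      h-shift : ∀ u d → h (u + d · a) ≈ h u
      h-shift u d = trans (h-+ u (d · a)) (trans (+-congˡ (h-multiple d)) (+-identityʳ _))

      bethe-equation : ∀ i → BetheEquation κ x (s i)
      bethe-equation i = hβ#0 i , *-cancelˡ-# (Q#0 i) (begin
        value-Q (s i) * (κ ^ p * product (λ l → f l / g l))   ≈⟨ solve 3 (λ q k r → q ⊗ (k ⊗ r) ⊜ k ⊗ (r ⊗ q)) refl
                                                                   (value-Q (s i)) (κ ^ p) (product (λ l → f l / g l)) ⟩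
        κ ^ p * (product (λ l → f l / g l) * value-Q (s i))   ≈⟨ *-congˡ (*-congˡ (value-Q≈ (s i))) ⟩
        κ ^ p * (product (λ l → f l / g l) * product g)       ≈⟨ *-congˡ (product-/ f g (hβ#0 i)) ⟩
        κ ^ p * product f                                     ≈⟨ *-congˡ (value-P≈ (s i)) ⟨
        κ ^ p * value-P (s i)                                 ≈⟨ bethe i ⟩
        value-Q (s i)                                         ≈⟨ *-identityʳ _ ⟨
        value-Q (s i) * 1#                                    ∎)
        where
        f g : Vector Carrier n
        f l = h (s i - x l + Λ l)
        g l = h (s i - x l)

      regular : ∀ m i → Regular m κ (s i) x
      regular m i = record { β#0 = β#0 ; α#0 = α#0 ; x#0 = λ d j _ → x#0 d j ; periodic = periodic-φ }
        where
        β#0 : ∀ d l → s i + d · a - x l # 0#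
        β#0 d l = #0-cong (solve 3 (λ s x d → s ⊟ x ⊕ d ⊜ s ⊕ d ⊟ x) refl (s i) (x l) (d · a))
          (h-#0 (#0-cong (sym (h-shift (s i - x l) d)) (hβ#0 i l)))
        α#0 : ∀ d l → s i + d · a - x l + Λ l # 0#
        α#0 d l = #0-cong (solve 4 (λ s x L d → s ⊟ x ⊕ L ⊕ d ⊜ s ⊕ d ⊟ x ⊕ L) refl (s i) (x l) (Λ l) (d · a))
          (h-#0 (#0-cong (sym (h-shift (s i - x l + Λ l) d)) (hα#0 i l)))
        -- A pole of an R-matrix would place `y m`, up to a multiple of `a`, at a zero of `Q`.
        x#0 : ∀ d j → x m + d · a - x j - Λ m # 0#
        x#0 d j = #0-cong (solve 4 (λ x y L d → x ⊟ L ⊟ y ⊕ d ⊜ x ⊕ d ⊟ y ⊟ L) refl (x m) (x j) (Λ m) (d · a))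
          (h-#0 (#0-cong (sym (trans (h-shift (y m - x j) d) (h-product (y m - x j))))
            (product-#0 {p} λ k → #0-cong (sym (+-assoc (y m) (- x j) (toℕ k · a))) (y-other m (inj₂ (j , k)) λ ()))))
        periodic-φ = bethe-periodic multiples-distinct κ (s i) x β#0 (bethe-equation i)

      J-nonzero : ∀ i → NonZeroVector (J κ (s i) x)
      J-nonzero i = i , ≉⇒# λ J≈0 → not-critical i (++⁺ʳ (proj₁ wronskian-roots)
        (concat⁺ (tabulate⁺ {f = λ k → proj₁ (J-zeros k)} i (proj₂ (J-zeros i) κ (s i) (Regular.β#0 reg) (Regular.periodic reg) (bethe i) J≈0))))
        where reg = regular i i

      -- Since `P` and `Q` have period `a`, the series `X` and `Y` solve the same equation. Their
      -- difference has the nonzero constant term `y i + k a - y j`, so it can be cancelled among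
      -- series, although it specializes to zero under the assumed coincidence.
      h-distinct : ∀ i j → i ≢ j → h (s i - s j) # 0#
      h-distinct i j i≢j = ≉⇒# λ h≈0 → not-critical j (++⁺ˡ (proj₂ wronskian-roots (s j) (wronskian≈0 (coincidence h≈0))))
        where
        coincidence : h (s i - s j) ≈ 0# → ∃ λ k → s i - s j + toℕ k · a ≈ 0#
        coincidence h≈0 = product-≈0 {p} {λ k → s i - s j + toℕ k · a} (trans (sym (h-product (s i - s j))) h≈0)
        module _ (k : Fin p) where
          t = s j
          X Y D-P D-Q εᵖ : Series
          X = b i S.+ constant (toℕ k · a)
          Y = b j
          D-P = ⟦ DD P ⟧ˢ (AS.pair X Y)
          D-Q = ⟦ DD Q ⟧ˢ (AS.pair X Y)
          εᵖ = ε L.^ p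
          X-Y#0 : (X S.- Y) 0 # 0#
          X-Y#0 = #0-cong (begin
            y i + (- x j + Λ j + toℕ k · a)    ≈⟨ solve 4 (λ y x L d → y ⊕ (⊝ x ⊕ L ⊕ d) ⊜ y ⊕ d ⊟ (x ⊟ L)) refl (y i) (x j) (Λ j) (toℕ k · a) ⟩
            y i + toℕ k · a - y j              ≈⟨ +-cong (+-congʳ (sym (b₀≈y i))) (-‿cong (sym (b₀≈y j))) ⟩
            b i 0 + toℕ k · a - b j 0          ∎)
            (y-other i (inj₁ (j , k)) λ same → i≢j (≡.sym (,-injectiveˡ (inj₁-injective same))))
          difference≈0 : (X S.- Y) S.* (D-P S.- εᵖ S.* D-Q) S.≈ S.0#
          difference≈0 = SR.begin
            (X S.- Y) S.* (D-P S.- εᵖ S.* D-Q)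
              SR.≈⟨ L.solve 4 (λ z d e d′ → z L.⊗ (d L.⊟ e L.⊗ d′) L.⊜ z L.⊗ d L.⊟ e L.⊗ (z L.⊗ d′)) S.refl (X S.- Y) D-P εᵖ D-Q ⟩
            (X S.- Y) S.* D-P S.- εᵖ S.* ((X S.- Y) S.* D-Q)
              SR.≈⟨ S.+-cong (AS.eval-DD P X Y) (S.-‿cong (S.*-congˡ {εᵖ} (AS.eval-DD Q X Y))) ⟨
            (P-X S.- P-Y) S.- εᵖ S.* (Q-X S.- Q-Y)
              SR.≈⟨ S.+-cong (S.+-cong P-X≈ (S.-‿cong (b-equation j))) (S.-‿cong (S.*-congˡ {εᵖ} (S.+-congʳ {S.- Q-Y} Q-X≈))) ⟩
            (εᵖ S.* Q-b S.- εᵖ S.* Q-Y) S.- εᵖ S.* (Q-b S.- Q-Y)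
              SR.≈⟨ L.solve 3 (λ e q q′ → (e L.⊗ q L.⊟ e L.⊗ q′) L.⊟ e L.⊗ (q L.⊟ q′) L.⊜ L.𝟎) S.refl εᵖ Q-b Q-Y ⟩
            S.0# SR.∎
            where
            P-X P-Y Q-X Q-Y Q-b : Series
            P-X = ⟦ P ⟧ˢ (AS.at X)
            P-Y = ⟦ P ⟧ˢ (AS.at Y)
            Q-X = ⟦ Q ⟧ˢ (AS.at X)
            Q-Y = ⟦ Q ⟧ˢ (AS.at Y)
            Q-b = ⟦ Q ⟧ˢ (AS.at (b i))
            Q-X≈ : Q-X S.≈ Q-b
            Q-X≈ = periodic-+k·a c₂ (b i) (toℕ k)
            P-X≈ : P-X S.≈ εᵖ S.* Q-b
            P-X≈ = S.trans (periodic-+k·a c₁ (b i) (toℕ k)) (b-equation i)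
          D≈ : D-P S.≈ εᵖ S.* D-Q
          D≈ = L.-≈0⇒≈ {D-P} {εᵖ S.* D-Q} (FormalSeries.cancel-unit em K (X S.- Y) (D-P S.- εᵖ S.* D-Q) X-Y#0 difference≈0)
          σ : Fin 2 → Poly (suc n)
          σ zero    = var (suc i) :+ con (toℕ k · a)
          σ (suc _) = var (suc j)
          DP DQ : Poly (suc n)
          DP = substP (DD P) σ
          DQ = substP (DD Q) σ
          series-point : ∀ (F : Poly 2) → ⟦ substP F σ ⟧ˢ (ε Vector.∷ b) S.≈ ⟦ F ⟧ˢ (AS.pair X Y)
          series-point F = S.trans (AS.eval-subst F σ (ε Vector.∷ b)) (AS.eval-cong F λ where
            zero    → S.refl {X}
            (suc _) → S.refl {Y})
          field-point : s i - s j + toℕ k · a ≈ 0# → ∀ (F : Poly 2) → ⟦ substP F σ ⟧ (e Vector.∷ s) ≈ ⟦ F ⟧ (AK.pair t t)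
          field-point coincide F = trans (AK.eval-subst F σ (e Vector.∷ s)) (AK.eval-cong F λ where
            zero    → trans (solve 3 (λ s t d → s ⊕ d ⊜ (s ⊟ t ⊕ d) ⊕ t) refl (s i) t (toℕ k · a))
                        (trans (+-congʳ coincide) (+-identityˡ t))
            (suc _) → refl)
          D-specialized : s i - s j + toℕ k · a ≈ 0# → ⟦ DD P ⟧ (AK.pair t t) ≈ e ^ p * ⟦ DD Q ⟧ (AK.pair t t)
          D-specialized coincide = begin
            ⟦ DD P ⟧ (AK.pair t t)            ≈⟨ field-point coincide (DD P) ⟨
            ⟦ DP ⟧ (e Vector.∷ s)             ≈⟨ specializes-equal DP (powP (var zero) p :* DQ) (SR.begin
              ⟦ DP ⟧ˢ (ε Vector.∷ b)          SR.≈⟨ series-point (DD P) ⟩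
              D-P                             SR.≈⟨ D≈ ⟩
              εᵖ S.* D-Q                      SR.≈⟨ S.*-cong (AS.eval-pow (var zero) p (ε Vector.∷ b)) (series-point (DD Q)) ⟨
              ⟦ powP (var zero) p :* DQ ⟧ˢ (ε Vector.∷ b) SR.∎) ⟩
            ⟦ powP (var zero) p :* DQ ⟧ (e Vector.∷ s)
              ≈⟨ *-cong (AK.eval-pow (var zero) p (e Vector.∷ s)) (field-point coincide (DD Q)) ⟩
            e ^ p * ⟦ DD Q ⟧ (AK.pair t t)    ∎
        wronskian≈0 : (∃ λ k → s i - s j + toℕ k · a ≈ 0#) → wronskian (s j) ≈ 0#
        wronskian≈0 (k , coincide) = begin
          D * value-Q τ - value-P τ * D′
            ≈⟨ +-cong (*-congʳ (D-specialized k coincide)) (-‿cong (*-congʳ (bethe-specialized j))) ⟩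
          e ^ p * D′ * value-Q τ - e ^ p * value-Q τ * D′
            ≈⟨ solve 3 (λ e d q → e ⊗ d ⊗ q ⊟ e ⊗ q ⊗ d ⊜ 𝟎) refl (e ^ p) D′ (value-Q τ) ⟩
          0# ∎
          where
          τ = s j
          D = ⟦ DD P ⟧ (AK.pair τ τ)
          D′ = ⟦ DD Q ⟧ (AK.pair τ τ)

      s-distinct : ∀ i j → i ≢ j → s i # s j
      s-distinct i j i≢j = ≉⇒# λ eq → #⇒≉ (h-distinct i j i≢j) (trans (h-cong (≈⇒-≈0 eq)) h-0)

      -- `h` vanishes only at multiples of `a`. Were `Λ m` one of them, a numerator and a
      -- denominator factor at position `m` would coincide.
      h-Λ#0 : ∀ m → h (Λ m) # 0#
      h-Λ#0 m = ≉⇒# λ hΛ≈0 → #⇒≉ (product-#0 {p} λ k → ≉⇒# λ eq → #⇒≉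
          (distinct-factors (inj₁ (m , zero)) (inj₂ (m , k)) λ ()) (begin
            - x m + Λ m + 0#                     ≈⟨ solve 3 (λ x L d → ⊝ x ⊕ L ⊕ 𝟎 ⊜ ⊝ x ⊕ d ⊟ (⊝ L ⊕ d)) refl (x m) (Λ m) (toℕ k · a) ⟩
            - x m + toℕ k · a - (- Λ m + toℕ k · a) ≈⟨ +-congˡ (trans (-‿cong eq) -0#≈0#) ⟩
            - x m + toℕ k · a + 0#               ≈⟨ +-identityʳ _ ⟩
            - x m + toℕ k · a                    ∎))
        (trans (sym (h-product (- Λ m))) (trans (h-neg (Λ m)) (trans (-‿cong hΛ≈0) -0#≈0#)))

      -- By additivity the eigenvalue is `u / (u + L)` with `u = h (s - x m)` and `L = h (Λ m)`, a
      -- fractional linear function of `u` with determinant `L`, hence injective.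
      eigenvalues-distinct : ∀ m i j → i ≢ j → eigenvalue x (s i) m # eigenvalue x (s j) m
      eigenvalues-distinct m i j i≢j = ≉⇒# λ eq → #⇒≉ (x#0y#0→xy#0 (h-distinct i j i≢j) (h-Λ#0 m)) (begin
        h (s i - s j) * L
          ≈⟨ *-congʳ (trans (h-cong (solve 3 (λ s t x → s ⊟ t ⊜ (s ⊟ x) ⊟ (t ⊟ x)) refl (s i) (s j) (x m))) (h-minus (s i - x m) (s j - x m))) ⟩
        (u - v) * L
          ≈⟨ solve 3 (λ u v L → (u ⊟ v) ⊗ L ⊜ u ⊗ (v ⊕ L) ⊟ v ⊗ (u ⊕ L)) refl u v L ⟩
        u * (v + L) - v * (u + L)
          ≈⟨ ≈⇒-≈0 (begin
               u * (v + L)                            ≈⟨ *-congʳ (/-cancel (α-#0 i)) ⟨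
               (u + L) * (u / (u + L)) * (v + L)      ≈⟨ *-congʳ (*-congˡ (quotients eq)) ⟩
               (u + L) * (v / (v + L)) * (v + L)      ≈⟨ solve 3 (λ x y z → x ⊗ y ⊗ z ⊜ (z ⊗ y) ⊗ x) refl (u + L) (v / (v + L)) (v + L) ⟩
               (v + L) * (v / (v + L)) * (u + L)      ≈⟨ *-congʳ (/-cancel (α-#0 j)) ⟩
               v * (u + L)                            ∎) ⟩
        0# ∎)
        where
        L = h (Λ m)
        u = h (s i - x m)
        v = h (s j - x m)
        α-#0 : ∀ i → h (s i - x m) + L # 0#
        α-#0 i = #0-cong (h-+ (s i - x m) (Λ m)) (hα#0 i m)
        quotients : eigenvalue x (s i) m ≈ eigenvalue x (s j) m → u / (u + L) ≈ v / (v + L)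
        quotients eq = trans (/-cong refl (sym (h-+ (s i - x m) (Λ m)))) (trans eq (/-cong refl (h-+ (s j - x m) (Λ m))))

      eigenvector : ∀ i m k → pCurvature κ m x (J κ (s i) x) k ≈ eigenvalue x (s i) m * J κ (s i) x k
      eigenvector i m = curvature-eigenvector multiples-distinct m κ (s i) x (regular m i)

      J-basis : IsBasis (λ i → J κ (s i) x)
      J-basis = independent , independent⇒spanning (λ i → J κ (s i) x) independent
        where
        independent : LinearlyIndependent (λ i → J κ (s i) x)
        -- The spectrum of a single p-curvature operator already separates the vectors; index `zero`
        -- is available as there is at least one position.
        independent = eigenvectors-independent (Transport.qKZ-iterate-linear em K p Λ a p κ zero x) (λ i → J κ (s i) x)
          (λ i → eigenvalue x (s i) zero) (eigenvalues-distinct zero) (λ i → eigenvector i zero) J-nonzero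

theoremB5 : ∀ {c ℓ₁ ℓ₂} (em : ExcludedMiddle (c ⊔ ℓ₁ ⊔ ℓ₂)) (K : HeytingField c ℓ₁ ℓ₂) →
    let open OverField em K in
    AlgebraicallyClosed →
    (p : ℕ) → p > 2 → HasCharacteristic p →
    (n : ℕ) → n ≥ 1 →
    (Λ : Vector Carrier n) → (∀ i → InPrimeField (Λ i) × Λ i # 0#) →
    (a : Carrier) → ¬ InPrimeField a →
    (x⁰ : Vector Carrier n) →
    let open QKZ p Λ a in
    DistinctFactors x⁰ →
    ∃ λ (b : Vector Series n) →
    (∀ i → IsBranch x⁰ i (b i)) ×
    ForGenericUnit λ κ →
    ∃ λ (s⁰ : Vector Carrier n) →
    IsSpecialization b (κ ⁻¹) s⁰ ×
    (∀ i j → i ≢ j → s⁰ i # s⁰ j) ×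
    (∀ i → BetheEquation κ x⁰ (s⁰ i)) ×
    (∀ i → NonZeroVector (J κ (s⁰ i) x⁰)) ×
    IsBasis (λ i → J κ (s⁰ i) x⁰) ×
    (∀ i m k → pCurvature κ m x⁰ (J κ (s⁰ i) x⁰) k
    ≈ eigenvalue x⁰ (s⁰ i) m * J κ (s⁰ i) x⁰ k)
theoremB5 em K closed (suc zero) (s≤s ()) _ _ _ _ _ _ _ _ _
theoremB5 em K closed (suc (suc p-2)) _ char (suc n′) _ Λ _ a _ x⁰ distinct-factors =
  b , is-branch , PolynomialFunctions.generic-avoiding em K exceptional λ κ κ#0 avoids →
    let module A = AtParameter b (λ i → proj₁ (proj₂ (branch i))) b-equation κ κ#0 avoids
        module B = A.AtSolution (proj₁ A.specialized) (proj₂ A.specialized)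
    in proj₁ A.specialized , proj₂ A.specialized , B.s-distinct , B.bethe-equation , B.J-nonzero , B.J-basis , B.eigenvector
  where open Solution em K closed p-2 char Λ a x⁰ distinct-factors
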